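{- Let $q=p^n$ be a power of an odd prime $p\neq 3$ with $q\equiv 3 \pmod 8$ and $q>43$. Then the differential uniformity of $F_{2,\frac13}(x)=x^2\big(1+\frac{1}{3}\eta(x)\big)$ over $\mathbb{F}_q$ equals $4$.
   Context: $\eta$ denotes the quadratic character of $\mathbb{F}_q$: $\eta(0)=0$, $\eta(x)=1$ if $x$ is a nonzero square, $\eta(x)=-1$ if $x$ is a non-square. For $f:\mathbb{F}_q\to\mathbb{F}_q$ and $a,b\in\mathbb{F}_q$, $\delta_f(a,b)=\#\{x\in\mathbb{F}_q: f(x+a)-f(x)=b\}$, and the differential uniformity of $f$ is $\delta_f=\max_{a\in\mathbb{F}_q^*,\,b\in\mathbb{F}_q}\delta_f(a,b)$. -}

module Defs where

open import Level using (0ℓ)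
open import Data.Nat as ℕ using (ℕ)
open import Data.Fin using (Fin)
open import Data.Fin.Properties using (any?)
open import Data.List using (List; map; filter; length; allFin)
open import Data.Product using (∃; _,_; Σ; _×_)
open import Relation.Nullary using (Dec; yes; no; ¬_)
open import Relation.Binary.PropositionalEquality using (_≡_; _≢_)
open import Relation.Binary.Definitions using (DecidableEquality)
open import Algebra.Structures using (IsCommutativeRing)
open import Function.Bundles using (_↔_; Inverse)

-- A finite field with exactly q elements.  Equality is propositional.
-- The multiplicative inverse is a total operation (value at 0 irrelevant)
-- with x * x ⁻¹ ≡ 1 for x ≢ 0.
record FiniteField (q : ℕ) : Set₁ where
  infixl 6 _+_ _-_
  infixl 7 _*_
  infix  8 -_
  infix  9 _⁻¹
  field
    Carrier : Set
    _+_ _*_ : Carrier → Carrier → Carrier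
    -_ _⁻¹ : Carrier → Carrier
    0# 1#   : Carrier
    isCommutativeRing : IsCommutativeRing _≡_ _+_ _*_ -_ 0# 1#
    0≢1      : 0# ≢ 1#
    ⁻¹-inverse : ∀ x → x ≢ 0# → x * x ⁻¹ ≡ 1#
    _≟_      : DecidableEquality Carrier
    enum     : Fin q ↔ Carrier

  _-_ : Carrier → Carrier → Carrier
  x - y = x + (- y)

  elements : List Carrier
  elements = map (Inverse.to enum) (allFin q)

  IsSquare : Carrier → Set
  IsSquare x = ∃ λ y → y * y ≡ x

  isSquare? : ∀ x → Dec (IsSquare x)
  isSquare? x with any? {P = λ i → Inverse.to enum i * Inverse.to enum i ≡ x}
                        (λ i → (Inverse.to enum i * Inverse.to enum i) ≟ x)
  ... | yes (i , e) = yes (Inverse.to enum i , e)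
  ... | no ¬p = no λ { (y , e) → ¬p (Inverse.from enum y , lemma y e) }
    where
    lemma : ∀ y → y * y ≡ x →
            Inverse.to enum (Inverse.from enum y) * Inverse.to enum (Inverse.from enum y) ≡ x
    lemma y e rewrite Inverse.strictlyInverseˡ enum y = e

  η : Carrier → Carrier
  η x with x ≟ 0#
  ... | yes _ = 0#
  ... | no  _ with isSquare? x
  ...   | yes _ = 1#
  ...   | no  _ = - 1#

  three : Carrier
  three = 1# + 1# + 1#

  F₂,⅓ : Carrier → Carrier
  F₂,⅓ x = x * x * (1# + three ⁻¹ * η x)

  δ : (Carrier → Carrier) → Carrier → Carrier → ℕ
  δ f a b = length (filter (λ x → (f (x + a) - f x) ≟ b) elements)

  DiffUniformity≡ : (Carrier → Carrier) → ℕ → Set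
  DiffUniformity≡ f d =
    (∀ a b → a ≢ 0# → δ f a b ℕ.≤ d) ×
    (∃ λ a → ∃ λ b → a ≢ 0# × δ f a b ≡ d)

{-# OPTIONS --safe #-}
module Submission where

-- Up to scaling, F is 2x² on nonzero squares and x² on non-squares, while -1 and 2 are non-squares.  The equation
-- F(x + a) - F(x) = b therefore splits, according to the quadratic characters of x + a and x, into two linear and two
-- quadratic equations; the characters of B ± 2a² and B ± a² (where B is b rescaled) exclude more than four solutions.
-- Four solutions occur as soon as some u ≠ 0 makes 1 + u², 1 - 3u² and u² ± 4u + 1 all nonzero squares.
-- For q ≥ 13603 such a u exists by Stepanov's method: if f is the product of some of these quadratics, then f takes
-- non-square values at not much more than q/2 points, because a nonzero polynomial Σⱼ (rⱼ + sⱼ f^((q-1)/2)) x^(qj) of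
-- small degree can be made to vanish to high order at each of them; f must not be a square times a constant, which is
-- an infinite descent in K[x].  Averaging over all products of the four quadratics gives u.  Every smaller q is a
-- prime, where u is found by search, or 11³ or 19³, where u is exhibited in an explicit cubic extension.

open import Defs
open import Algebra.Bundles using (CommutativeRing)
import Algebra.Properties.CommutativeMonoid.Sum as Sum
import Algebra.Properties.CommutativeSemiring.Binomial as Binomial
import Algebra.Properties.CommutativeSemiring.Exp as Exp
import Algebra.Properties.Ring as RingProperties
import Algebra.Properties.Semiring.Mult as Multᵤ
import Algebra.Properties.Semiring.Mult.TCOptimised as Mult
import Algebra.Solver.Ring as RingSolver
open import Algebra.Solver.Ring.AlmostCommutativeRing using (fromCommutativeRing; _-Raw-AlmostCommutative⟶_)
open import Data.Empty using (⊥-elim)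
open import Data.Fin.Base using (Fin; zero; suc; fromℕ; inject₁)
import Data.Fin.Properties as Finₚ
import Data.Integer.Base as ℤ
import Data.Integer.Properties as ℤₚ
open import Data.List.Base using (List; []; _∷_; length; map)
open import Data.List.Properties using (length-map)
open import Data.Maybe.Base as Maybe using (Maybe)
open import Data.Nat.Base as ℕ using (ℕ; zero; suc; z≤n; s≤s)
open import Data.Nat.Combinatorics using (_C_; nCn≡1; nC1≡n; nCk+nC[k+1]≡[n+1]C[k+1]; k>n⇒nCk≡0)
open import Data.Nat.Divisibility using (_∣_; divides; ∣⇒≤; m∣m*n)
open import Data.Nat.Primality using (Prime; euclidsLemma; prime⇒nonZero)
import Data.Nat.Properties as ℕₚ
open import Data.Nat.Solver using (module +-*-Solver)
open import Data.Product.Base using (_,_)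
open import Data.Sum.Base using (inj₁; inj₂)
open import Function.Base using (_∘_)
open import Level using (0ℓ)
open import Relation.Binary.PropositionalEquality as ≡ using (_≡_)
import Relation.Binary.Reasoning.Setoid as SetoidReasoning
open import Relation.Nullary.Decidable.Core using (dec⇒maybe)

-- Commutative rings and polynomials as coefficient lists

-- The vanishing conditions in Stepanov's method are imposed once for all points: substituting x = a
-- + f(a)S gives a polynomial in S over K[a] that describes the expansion at every a with f(a)^e =
-- -1 simultaneously, where e = (q-1)/2. Their number therefore depends on the order of vanishing
-- and on the degrees involved, but not on the number of points. Scaling S by f(a) turns f(x)^e into
-- a polynomial in S whose coefficients have degrees bounded independently of e, which is what lets
-- the unknowns outnumber the conditions. Both halves of the theorem hinge on one identity. For a
-- square a and s² = B + 2a², the candidates x = -2a ± s have values x + a with product -(B + a²).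
-- If B + a² is a nonzero square, exactly one of these values is a square, so a solution with x and
-- x + a both non-squares replaces one candidate instead of joining both. The example with four
-- solutions meets the same alternative in the choice of its fourth solution.

Ring : Set₁
Ring = CommutativeRing 0ℓ 0ℓ

module IntegerSolver (R : Ring) where
  open CommutativeRing R
  open RingProperties ring
  open Mult semiring
  open SetoidReasoning setoid
  open ℤ using (ℤ; +_; -[1+_])

  -- Integer coefficients have decidable equality, so the solver can cancel terms over any ring.
  -- With this variant of `_×_` the numerals `num 3` and `num 4` unfold to `1# + 1# + 1#` and
  -- `1# + 1# + 1# + 1#`, so that it applies directly to `three` and `four`.
  ι : ℤ → Carrier
  ι (+ n)     = n × 1#
  ι -[1+ n ]  = - (suc n × 1#)

  ι-⊖ : ∀ m n → ι (m ℤ.⊖ n) ≈ m × 1# - n × 1#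
  ι-⊖ m zero = sym (trans (+-congˡ -0#≈0#) (+-identityʳ _))
  ι-⊖ zero (suc n) = sym (+-identityˡ _)
  ι-⊖ (suc m) (suc n) = begin
    ι (suc m ℤ.⊖ suc n)  ≡⟨ ≡.cong ι (ℤₚ.[1+m]⊖[1+n]≡m⊖n m n) ⟩
    ι (m ℤ.⊖ n)  ≈⟨ ι-⊖ m n ⟩
    m × 1# - n × 1#  ≈⟨ +-congʳ (+-identityʳ _) ⟨
    m × 1# + 0# - n × 1#  ≈⟨ +-congʳ (+-congˡ (-‿inverseʳ 1#)) ⟨
    m × 1# + (1# - 1#) - n × 1#  ≈⟨ +-congʳ (+-assoc _ _ _) ⟨
    m × 1# + 1# - 1# - n × 1#  ≈⟨ +-assoc _ _ _ ⟩
    m × 1# + 1# + (- 1# - n × 1#)  ≈⟨ +-cong (+-comm _ _) (-‿+-comm 1# _) ⟩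
    1# + m × 1# - (1# + n × 1#)  ≈⟨ +-cong (1+× m 1#) (-‿cong (1+× n 1#)) ⟨
    suc m × 1# - suc n × 1#  ∎

  ι-neg : ∀ i → ι (ℤ.- i) ≈ - ι i
  ι-neg (+ zero)   = sym -0#≈0#
  ι-neg (+ suc n)  = refl
  ι-neg -[1+ n ]   = sym (-‿involutive _)

  ι-+ : ∀ i j → ι (i ℤ.+ j) ≈ ι i + ι j
  ι-+ (+ m)    (+ n)    = ×-homo-+ 1# m n
  ι-+ (+ m)    -[1+ n ] = ι-⊖ m (suc n)
  ι-+ -[1+ m ] (+ n)    = trans (ι-⊖ n (suc m)) (+-comm _ _)
  ι-+ -[1+ m ] -[1+ n ] = begin
    - (suc (suc (m ℕ.+ n)) × 1#)  ≡⟨ ≡.cong (λ k → - (k × 1#)) (≡.cong suc (ℕₚ.+-suc m n)) ⟨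
    - ((suc m ℕ.+ suc n) × 1#)  ≈⟨ -‿cong (×-homo-+ 1# (suc m) (suc n)) ⟩
    - (suc m × 1# + suc n × 1#)  ≈⟨ -‿+-comm _ _ ⟨
    - (suc m × 1#) - suc n × 1#  ∎

  ι-pos-* : ∀ m j → ι (+ m ℤ.* j) ≈ ι (+ m) * ι j
  ι-pos-* m (+ n)    = trans (reflexive (≡.cong ι (≡.sym (ℤₚ.pos-* m n)))) (×1-homo-* m n)
  ι-pos-* m -[1+ n ] = begin
    ι (+ m ℤ.* -[1+ n ])  ≡⟨ ≡.cong ι (ℤₚ.neg-distribʳ-* (+ m) (+ suc n)) ⟨
    ι (ℤ.- (+ m ℤ.* + suc n))  ≈⟨ ι-neg (+ m ℤ.* + suc n) ⟩
    - ι (+ m ℤ.* + suc n)  ≈⟨ -‿cong (ι-pos-* m (+ suc n)) ⟩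
    - (ι (+ m) * ι (+ suc n))  ≈⟨ -‿distribʳ-* _ _ ⟩
    ι (+ m) * ι -[1+ n ]  ∎

  ι-* : ∀ i j → ι (i ℤ.* j) ≈ ι i * ι j
  ι-* (+ m)    j = ι-pos-* m j
  ι-* -[1+ m ] j = begin
    ι (-[1+ m ] ℤ.* j)  ≡⟨ ≡.cong ι (ℤₚ.neg-distribˡ-* (+ suc m) j) ⟨
    ι (ℤ.- (+ suc m ℤ.* j))  ≈⟨ ι-neg (+ suc m ℤ.* j) ⟩
    - ι (+ suc m ℤ.* j)  ≈⟨ -‿cong (ι-pos-* (suc m) j) ⟩
    - (ι (+ suc m) * ι j)  ≈⟨ -‿distribˡ-* _ _ ⟩
    ι -[1+ m ] * ι j  ∎

  ι-morphism : ℤ.+-*-rawRing -Raw-AlmostCommutative⟶ fromCommutativeRing R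
  ι-morphism = record
    { ⟦_⟧ = ι ; +-homo = ι-+ ; *-homo = ι-* ; -‿homo = ι-neg ; 0-homo = refl ; 1-homo = refl }

  ι-≟ : ∀ i j → Maybe (ι i ≈ ι j)
  ι-≟ i j = Maybe.map (λ i≡j → reflexive (≡.cong ι i≡j)) (dec⇒maybe (i ℤₚ.≟ j))

  open RingSolver ℤ.+-*-rawRing (fromCommutativeRing R) ι-morphism ι-≟ public
    using (Polynomial; solve; _:=_; con; _:+_; _:*_; _:-_; :-_; _:^_)

  num : ∀ {n} → ℕ → Polynomial n
  num k = con (+ k)

record Hom (R S : Ring) : Set where
  private
    module R = CommutativeRing R
    module S = CommutativeRing S
  field
    ⟦_⟧    : R.Carrier → S.Carrier
    ⟦⟧-cong : ∀ {x y} → x R.≈ y → ⟦ x ⟧ S.≈ ⟦ y ⟧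
    +-homo : ∀ x y → ⟦ x R.+ y ⟧ S.≈ ⟦ x ⟧ S.+ ⟦ y ⟧
    *-homo : ∀ x y → ⟦ x R.* y ⟧ S.≈ ⟦ x ⟧ S.* ⟦ y ⟧
    1-homo : ⟦ R.1# ⟧ S.≈ S.1#

  open RingProperties S.ring using (+-identityʳ-unique; +-inverseˡ-unique)
  open Exp R.commutativeSemiring using () renaming (_^_ to _^R_)
  open Exp S.commutativeSemiring using () renaming (_^_ to _^S_)

  0-homo : ⟦ R.0# ⟧ S.≈ S.0#
  0-homo = +-identityʳ-unique _ _ (S.trans (S.sym (+-homo R.0# R.0#)) (⟦⟧-cong (R.+-identityˡ R.0#)))

  -‿homo : ∀ x → ⟦ R.- x ⟧ S.≈ S.- ⟦ x ⟧
  -‿homo x = +-inverseˡ-unique _ _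
    (S.trans (S.sym (+-homo _ _)) (S.trans (⟦⟧-cong (R.-‿inverseˡ x)) 0-homo))

  ^-homo : ∀ x n → ⟦ x ^R n ⟧ S.≈ ⟦ x ⟧ ^S n
  ^-homo x zero    = 1-homo
  ^-homo x (suc n) = S.trans (*-homo _ _) (S.*-congˡ (^-homo x n))

_∘ₕ_ : ∀ {R S T} → Hom S T → Hom R S → Hom R T
_∘ₕ_ {T = T} g f = record
  { ⟦_⟧     = λ x → G.⟦ F.⟦ x ⟧ ⟧
  ; ⟦⟧-cong = λ x≈y → G.⟦⟧-cong (F.⟦⟧-cong x≈y)
  ; +-homo  = λ x y → trans (G.⟦⟧-cong (F.+-homo x y)) (G.+-homo _ _)
  ; *-homo  = λ x y → trans (G.⟦⟧-cong (F.*-homo x y)) (G.*-homo _ _)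
  ; 1-homo  = trans (G.⟦⟧-cong F.1-homo) G.1-homo
  }
  where
  module F = Hom f
  module G = Hom g
  open CommutativeRing T using (trans)

idₕ : ∀ {R} → Hom R R
idₕ {R} = record
  { ⟦_⟧ = λ x → x ; ⟦⟧-cong = λ e → e ; +-homo = λ _ _ → refl ; *-homo = λ _ _ → refl ; 1-homo = refl }
  where open CommutativeRing R using (refl)

module Polynomials (R : Ring) where
  open CommutativeRing R
  open RingProperties ring using (-0#≈0#)
  private module RS = IntegerSolver R

  -- Trailing zeros are allowed: equality is coefficientwise, `length` only bounds the degree, and
  -- all degree estimates are bounds on lengths.
  Poly : Set
  Poly = List Carrier

  coeff : Poly → ℕ → Carrier
  coeff []      _       = 0#
  coeff (c ∷ p) zero    = c
  coeff (c ∷ p) (suc n) = coeff p n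

  infix 4 _≋_
  -- A record rather than a bare function type, so that unification can recover p and q from the
  -- type of an equation.
  record _≋_ (p q : Poly) : Set where
    constructor coeffwise
    field coeff-≈ : ∀ n → coeff p n ≈ coeff q n
  open _≋_ public

  ≋-refl : ∀ {p} → p ≋ p
  ≋-refl = coeffwise λ _ → refl

  ≋-sym : ∀ {p q} → p ≋ q → q ≋ p
  ≋-sym e = coeffwise λ n → sym (coeff-≈ e n)

  ≋-trans : ∀ {p q r} → p ≋ q → q ≋ r → p ≋ r
  ≋-trans e f = coeffwise λ n → trans (coeff-≈ e n) (coeff-≈ f n)

  ∷-cong : ∀ {c d p q} → c ≈ d → p ≋ q → c ∷ p ≋ d ∷ q
  ∷-cong e f = coeffwise λ { zero → e ; (suc n) → coeff-≈ f n }

  ∷-zero : ∀ {c p} → c ≈ 0# → p ≋ [] → c ∷ p ≋ []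
  ∷-zero e f = coeffwise λ { zero → e ; (suc n) → coeff-≈ f n }

  tail-≋ : ∀ {c d p q} → c ∷ p ≋ d ∷ q → p ≋ q
  tail-≋ e = coeffwise λ n → coeff-≈ e (suc n)

  tail-zero : ∀ {c p} → c ∷ p ≋ [] → p ≋ []
  tail-zero e = coeffwise λ n → coeff-≈ e (suc n)

  infixl 6 _+ₚ_
  infixl 7 _*ₚ_ _·_

  -- Opaque so that conversion checking never expands products of polynomials.
  opaque
    _+ₚ_ : Poly → Poly → Poly
    []      +ₚ q       = q
    (c ∷ p) +ₚ []      = c ∷ p
    (c ∷ p) +ₚ (d ∷ q) = c + d ∷ p +ₚ q

    _·_ : Carrier → Poly → Poly
    c · p = map (c *_) p

    -ₚ_ : Poly → Poly
    -ₚ p = map -_ p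

    coeff-+ : ∀ p q n → coeff (p +ₚ q) n ≈ coeff p n + coeff q n
    coeff-+ []      q       n       = sym (+-identityˡ _)
    coeff-+ (c ∷ p) []      n       = sym (+-identityʳ _)
    coeff-+ (c ∷ p) (d ∷ q) zero    = refl
    coeff-+ (c ∷ p) (d ∷ q) (suc n) = coeff-+ p q n

    coeff-· : ∀ c p n → coeff (c · p) n ≈ c * coeff p n
    coeff-· c []      n       = sym (zeroʳ c)
    coeff-· c (d ∷ p) zero    = refl
    coeff-· c (d ∷ p) (suc n) = coeff-· c p n

    coeff-neg : ∀ p n → coeff (-ₚ p) n ≈ - coeff p n
    coeff-neg []      n       = sym -0#≈0#
    coeff-neg (c ∷ p) zero    = refl
    coeff-neg (c ∷ p) (suc n) = coeff-neg p n

    +ₚ-cong : ∀ {p p′ q q′} → p ≋ p′ → q ≋ q′ → p +ₚ q ≋ p′ +ₚ q′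
    +ₚ-cong {p} {p′} {q} {q′} e f = coeffwise λ n →
      trans (coeff-+ p q n) (trans (+-cong (coeff-≈ e n) (coeff-≈ f n)) (sym (coeff-+ p′ q′ n)))

    ·-cong : ∀ {c d p q} → c ≈ d → p ≋ q → c · p ≋ d · q
    ·-cong {c} {d} {p} {q} e f = coeffwise λ n →
      trans (coeff-· c p n) (trans (*-cong e (coeff-≈ f n)) (sym (coeff-· d q n)))

    +ₚ-assoc : ∀ p q r → (p +ₚ q) +ₚ r ≋ p +ₚ (q +ₚ r)
    +ₚ-assoc p q r = coeffwise λ n →
      trans (coeff-+ (p +ₚ q) r n) (trans (+-congʳ (coeff-+ p q n)) (trans (+-assoc _ _ _)
        (sym (trans (coeff-+ p (q +ₚ r) n) (+-congˡ (coeff-+ q r n))))))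

    +ₚ-comm : ∀ p q → p +ₚ q ≋ q +ₚ p
    +ₚ-comm p q = coeffwise λ n → trans (coeff-+ p q n) (trans (+-comm _ _) (sym (coeff-+ q p n)))

    +ₚ-identityʳ : ∀ p → p +ₚ [] ≋ p
    +ₚ-identityʳ p = +ₚ-comm p []

    -ₚ-inverseˡ : ∀ p → -ₚ p +ₚ p ≋ []
    -ₚ-inverseˡ p = coeffwise λ n →
      trans (coeff-+ (-ₚ p) p n) (trans (+-congʳ (coeff-neg p n)) (-‿inverseˡ _))

    +ₚ-interchange : ∀ p q r s → (p +ₚ q) +ₚ (r +ₚ s) ≋ (p +ₚ r) +ₚ (q +ₚ s)
    +ₚ-interchange p q r s = coeffwise λ n →
      trans (coeff-+₂ p q r s n)
      (trans (RS.solve 4 (λ a b c d → (a RS.:+ b) RS.:+ (c RS.:+ d) RS.:= (a RS.:+ c) RS.:+ (b RS.:+ d)) refl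
                      (coeff p n) (coeff q n) (coeff r n) (coeff s n))
      (sym (coeff-+₂ p r q s n)))
      where
      coeff-+₂ : ∀ p q r s n → coeff ((p +ₚ q) +ₚ (r +ₚ s)) n ≈ (coeff p n + coeff q n) + (coeff r n + coeff s n)
      coeff-+₂ p q r s n = trans (coeff-+ (p +ₚ q) (r +ₚ s) n) (+-cong (coeff-+ p q n) (coeff-+ r s n))

    ·-distribˡ : ∀ c p q → c · (p +ₚ q) ≋ c · p +ₚ c · q
    ·-distribˡ c p q = coeffwise λ n →
      trans (coeff-· c (p +ₚ q) n) (trans (*-congˡ (coeff-+ p q n)) (trans (distribˡ _ _ _)
        (sym (trans (coeff-+ (c · p) (c · q) n) (+-cong (coeff-· c p n) (coeff-· c q n))))))

    ·-distribʳ : ∀ c d p → (c + d) · p ≋ c · p +ₚ d · p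
    ·-distribʳ c d p = coeffwise λ n →
      trans (coeff-· (c + d) p n) (trans (distribʳ _ _ _)
        (sym (trans (coeff-+ (c · p) (d · p) n) (+-cong (coeff-· c p n) (coeff-· d p n)))))

    ·-assoc : ∀ c d p → c · (d · p) ≋ (c * d) · p
    ·-assoc c d p = coeffwise λ n →
      trans (coeff-· c (d · p) n) (trans (*-congˡ (coeff-· d p n)) (trans (sym (*-assoc _ _ _)) (sym (coeff-· (c * d) p n))))

    ·-zero : ∀ {c} p → c ≈ 0# → c · p ≋ []
    ·-zero {c} p e = coeffwise λ n → trans (coeff-· c p n) (trans (*-congʳ e) (zeroˡ _))

    ·-identity : ∀ p → 1# · p ≋ p
    ·-identity p = coeffwise λ n → trans (coeff-· 1# p n) (*-identityˡ _)

    shift-+ : ∀ p q → 0# ∷ (p +ₚ q) ≋ (0# ∷ p) +ₚ (0# ∷ q)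
    shift-+ p q = ∷-cong (sym (+-identityˡ 0#)) ≋-refl

    length-+ : ∀ {n} p q → length p ℕ.≤ n → length q ℕ.≤ n → length (p +ₚ q) ℕ.≤ n
    length-+ []      q       _       f       = f
    length-+ (c ∷ p) []      e       _       = e
    length-+ (c ∷ p) (d ∷ q) (s≤s e) (s≤s f) = s≤s (length-+ p q e f)

    length-· : ∀ c p → length (c · p) ≡ length p
    length-· c p = length-map (c *_) p

    _*ₚ_ : Poly → Poly → Poly
    []      *ₚ q = []
    (c ∷ p) *ₚ q = c · q +ₚ (0# ∷ p *ₚ q)

    *ₚ-zeroʳ : ∀ p → p *ₚ [] ≋ []
    *ₚ-zeroʳ []      = ≋-refl
    *ₚ-zeroʳ (c ∷ p) = ∷-zero refl (*ₚ-zeroʳ p)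

    *ₚ-zeroˡ : ∀ p q → p ≋ [] → p *ₚ q ≋ []
    *ₚ-zeroˡ []      q e = ≋-refl
    *ₚ-zeroˡ (c ∷ p) q e = +ₚ-cong (·-zero q (coeff-≈ e 0)) (∷-zero refl (*ₚ-zeroˡ p q (tail-zero e)))

    *ₚ-congˡ : ∀ p {q q′} → q ≋ q′ → p *ₚ q ≋ p *ₚ q′
    *ₚ-congˡ []      e = ≋-refl
    *ₚ-congˡ (c ∷ p) e = +ₚ-cong (·-cong refl e) (∷-cong refl (*ₚ-congˡ p e))

    *ₚ-congʳ : ∀ {p p′} q → p ≋ p′ → p *ₚ q ≋ p′ *ₚ q
    *ₚ-congʳ {[]}    {p′}     q e = ≋-sym (*ₚ-zeroˡ p′ q (≋-sym e))
    *ₚ-congʳ {c ∷ p} {[]}     q e = *ₚ-zeroˡ (c ∷ p) q e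
    *ₚ-congʳ {c ∷ p} {d ∷ p′} q e = +ₚ-cong (·-cong (coeff-≈ e 0) ≋-refl) (∷-cong refl (*ₚ-congʳ {p} {p′} q (tail-≋ e)))

    *ₚ-distribˡ : ∀ p q r → p *ₚ (q +ₚ r) ≋ p *ₚ q +ₚ p *ₚ r
    *ₚ-distribˡ []      q r = ≋-refl
    *ₚ-distribˡ (c ∷ p) q r =
      ≋-trans (+ₚ-cong (·-distribˡ c q r) (≋-trans (∷-cong refl (*ₚ-distribˡ p q r)) (shift-+ (p *ₚ q) (p *ₚ r))))
              (+ₚ-interchange (c · q) (c · r) (0# ∷ p *ₚ q) (0# ∷ p *ₚ r))

    *ₚ-distribʳ : ∀ r p q → (p +ₚ q) *ₚ r ≋ p *ₚ r +ₚ q *ₚ r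
    *ₚ-distribʳ r []      q       = ≋-refl
    *ₚ-distribʳ r (c ∷ p) []      = ≋-sym (+ₚ-identityʳ ((c ∷ p) *ₚ r))
    *ₚ-distribʳ r (c ∷ p) (d ∷ q) =
      ≋-trans (+ₚ-cong (·-distribʳ c d r) (≋-trans (∷-cong refl (*ₚ-distribʳ r p q)) (shift-+ (p *ₚ r) (q *ₚ r))))
              (+ₚ-interchange (c · r) (d · r) (0# ∷ p *ₚ r) (0# ∷ q *ₚ r))

    ·-*ₚ : ∀ c p q → (c · p) *ₚ q ≋ c · (p *ₚ q)
    ·-*ₚ c []      q = ≋-refl
    ·-*ₚ c (d ∷ p) q =
      ≋-trans (+ₚ-cong (≋-sym (·-assoc c d q)) (∷-cong (sym (zeroʳ c)) (·-*ₚ c p q)))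
              (≋-sym (·-distribˡ c (d · q) (0# ∷ p *ₚ q)))

    shift-*ₚ : ∀ p q → (0# ∷ p) *ₚ q ≋ 0# ∷ p *ₚ q
    shift-*ₚ p q = +ₚ-cong {0# · q} {[]} {0# ∷ p *ₚ q} (·-zero q refl) ≋-refl

    *ₚ-∷ : ∀ p d q → p *ₚ (d ∷ q) ≋ d · p +ₚ (0# ∷ p *ₚ q)
    *ₚ-∷ []      d q = ≋-sym (∷-zero refl ≋-refl)
    *ₚ-∷ (c ∷ p) d q = ∷-cong (+-congʳ (*-comm c d))
      (≋-trans (+ₚ-cong {c · q} ≋-refl (*ₚ-∷ p d q))
      (≋-trans (≋-sym (+ₚ-assoc (c · q) (d · p) (0# ∷ p *ₚ q)))
      (≋-trans (+ₚ-cong (+ₚ-comm (c · q) (d · p)) ≋-refl)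
               (+ₚ-assoc (d · p) (c · q) (0# ∷ p *ₚ q)))))

    *ₚ-comm : ∀ p q → p *ₚ q ≋ q *ₚ p
    *ₚ-comm []      q = ≋-sym (*ₚ-zeroʳ q)
    *ₚ-comm (c ∷ p) q = ≋-trans (+ₚ-cong {c · q} ≋-refl (∷-cong refl (*ₚ-comm p q))) (≋-sym (*ₚ-∷ q c p))

    *ₚ-assoc : ∀ p q r → (p *ₚ q) *ₚ r ≋ p *ₚ (q *ₚ r)
    *ₚ-assoc []      q r = ≋-refl
    *ₚ-assoc (c ∷ p) q r =
      ≋-trans (*ₚ-distribʳ r (c · q) (0# ∷ p *ₚ q))
              (+ₚ-cong (·-*ₚ c q r) (≋-trans (shift-*ₚ (p *ₚ q) r) (∷-cong refl (*ₚ-assoc p q r))))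

    *ₚ-identityˡ : ∀ p → (1# ∷ []) *ₚ p ≋ p
    *ₚ-identityˡ p = ≋-trans (+ₚ-cong (·-identity p) (∷-zero refl ≋-refl)) (+ₚ-identityʳ p)

    *ₚ-const : ∀ c d → (c ∷ []) *ₚ (d ∷ []) ≋ c * d ∷ []
    *ₚ-const c d = ∷-cong (+-identityʳ _) ≋-refl

    const-* : ∀ c p → (c ∷ []) *ₚ p ≋ map (c *_) p
    const-* c p = ≋-trans (+ₚ-cong (≋-refl {c · p}) (∷-zero refl ≋-refl)) (+ₚ-identityʳ (c · p))

    coeff-0-* : ∀ p q → coeff (p *ₚ q) 0 ≈ coeff p 0 * coeff q 0
    coeff-0-* []      q = sym (zeroˡ _)
    coeff-0-* (c ∷ p) q = trans (coeff-+ (c · q) (0# ∷ p *ₚ q) 0) (trans (+-identityʳ _) (coeff-· c q 0))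

    length-* : ∀ {m n} p q → length p ℕ.≤ suc m → length q ℕ.≤ suc n → length (p *ₚ q) ℕ.≤ suc (m ℕ.+ n)
    length-* []          q e f = z≤n
    length-* {zero}  {n} (c ∷ [])    q e f =
      length-+ (c · q) (0# ∷ []) (≡.subst (ℕ._≤ suc n) (≡.sym (length-· c q)) f) (s≤s z≤n)
    length-* {zero}  (c ∷ d ∷ p) q (s≤s ()) f
    length-* {suc m} {n} (c ∷ p) q (s≤s e) f =
      length-+ (c · q) (0# ∷ p *ₚ q)
        (≡.subst (ℕ._≤ suc (suc m ℕ.+ n)) (≡.sym (length-· c q)) (ℕₚ.≤-trans f (s≤s (ℕₚ.m≤n+m n (suc m)))))
        (s≤s (length-* p q e f))

    +ₚ-identityˡ : ∀ p → [] +ₚ p ≋ p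
    +ₚ-identityˡ p = ≋-refl

    +ₚ-const : ∀ c d → (c ∷ []) +ₚ (d ∷ []) ≋ c + d ∷ []
    +ₚ-const c d = ≋-refl

    neg-cong : ∀ {p q} → p ≋ q → -ₚ p ≋ -ₚ q
    neg-cong {p} {q} e = coeffwise λ n →
      trans (coeff-neg p n) (trans (-‿cong (coeff-≈ e n)) (sym (coeff-neg q n)))

    length-neg : ∀ p → length (-ₚ p) ≡ length p
    length-neg p = length-map -_ p

    ∷-sum : ∀ c p → c ∷ p ≋ (c ∷ []) +ₚ (0# ∷ p)
    ∷-sum c p = ∷-cong (sym (+-identityʳ c)) ≋-refl

  polyRing : Ring
  polyRing = record
    { Carrier = Poly ; _≈_ = _≋_ ; _+_ = _+ₚ_ ; _*_ = _*ₚ_ ; -_ = -ₚ_ ; 0# = [] ; 1# = 1# ∷ []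
    ; isCommutativeRing = record
      { isRing = record
        { +-isAbelianGroup = record
          { isGroup = record
            { isMonoid = record
              { isSemigroup = record
                { isMagma = record
                  { isEquivalence = record { refl = ≋-refl ; sym = ≋-sym ; trans = ≋-trans }
                  ; ∙-cong = +ₚ-cong }
                ; assoc = +ₚ-assoc }
              ; identity = +ₚ-identityˡ , +ₚ-identityʳ }
            ; inverse = -ₚ-inverseˡ , λ p → ≋-trans (+ₚ-comm p (-ₚ p)) (-ₚ-inverseˡ p)
            ; ⁻¹-cong = neg-cong }
          ; comm = +ₚ-comm }
        ; *-cong = λ {p} {p′} {q} {q′} e f → ≋-trans (*ₚ-congʳ q e) (*ₚ-congˡ p′ f)
        ; *-assoc = *ₚ-assoc
        ; *-identity = *ₚ-identityˡ , λ p → ≋-trans (*ₚ-comm p (1# ∷ [])) (*ₚ-identityˡ p)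
        ; distrib = *ₚ-distribˡ , *ₚ-distribʳ }
      ; *-comm = *ₚ-comm } }

  X : Poly
  X = 0# ∷ 1# ∷ []

  X-* : ∀ p → X *ₚ p ≋ 0# ∷ p
  X-* p = ≋-trans (shift-*ₚ (1# ∷ []) p) (∷-cong refl (*ₚ-identityˡ p))

  ∷-as-sum : ∀ c p → c ∷ p ≋ (c ∷ []) +ₚ X *ₚ p
  ∷-as-sum c p = ≋-trans (∷-sum c p) (+ₚ-cong ≋-refl (≋-sym (X-* p)))

  const : Hom R polyRing
  const = record
    { ⟦_⟧     = λ c → c ∷ []
    ; ⟦⟧-cong = λ e → ∷-cong e ≋-refl
    ; +-homo  = λ c d → ≋-sym (+ₚ-const c d)
    ; *-homo  = λ c d → ≋-sym (*ₚ-const c d)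
    ; 1-homo  = ≋-refl
    }

  coeff-beyond : ∀ p {n} → length p ℕ.≤ n → coeff p n ≈ 0#
  coeff-beyond []      _       = refl
  coeff-beyond (c ∷ p) (s≤s e) = coeff-beyond p e

  module Evaluation {S : Ring} (φ : Hom R S) (x : CommutativeRing.Carrier S) where
    private
      module S = CommutativeRing S
      module φ = Hom φ
      module IS = IntegerSolver S
    open SetoidReasoning S.setoid

    -- Since coefficients pass through φ, this one Horner scheme serves for values in the field, for
    -- substitution into polynomials, for the two-variable expansion and for reduction to K[ω].
    eval : Poly → S.Carrier
    eval []      = S.0#
    eval (c ∷ p) = φ.⟦ c ⟧ S.+ x S.* eval p

    eval-zero : ∀ p → p ≋ [] → eval p S.≈ S.0#
    eval-zero []      e = S.refl
    eval-zero (c ∷ p) e = S.trans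
      (S.+-cong (S.trans (φ.⟦⟧-cong (coeff-≈ e 0)) φ.0-homo) (S.trans (S.*-congˡ (eval-zero p (tail-zero e))) (S.zeroʳ x)))
      (S.+-identityˡ S.0#)

    eval-cong : ∀ {p q} → p ≋ q → eval p S.≈ eval q
    eval-cong {[]}    {q}     e = S.sym (eval-zero q (≋-sym e))
    eval-cong {c ∷ p} {[]}    e = eval-zero (c ∷ p) e
    eval-cong {c ∷ p} {d ∷ q} e = S.+-cong (φ.⟦⟧-cong (coeff-≈ e 0)) (S.*-congˡ (eval-cong {p} {q} (tail-≋ e)))

    opaque
      unfolding _+ₚ_ _*ₚ_ _·_

      eval-+ : ∀ p q → eval (p +ₚ q) S.≈ eval p S.+ eval q
      eval-+ []      q       = S.sym (S.+-identityˡ _)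
      eval-+ (c ∷ p) []      = S.sym (S.+-identityʳ _)
      eval-+ (c ∷ p) (d ∷ q) = begin
        φ.⟦ c + d ⟧ S.+ x S.* eval (p +ₚ q)
          ≈⟨ S.+-cong (φ.+-homo c d) (S.*-congˡ (eval-+ p q)) ⟩
        (φ.⟦ c ⟧ S.+ φ.⟦ d ⟧) S.+ x S.* (eval p S.+ eval q)
          ≈⟨ IS.solve 5 (λ c d x p q → (c IS.:+ d) IS.:+ x IS.:* (p IS.:+ q) IS.:= (c IS.:+ x IS.:* p) IS.:+ (d IS.:+ x IS.:* q))
               S.refl φ.⟦ c ⟧ φ.⟦ d ⟧ x (eval p) (eval q) ⟩
        (φ.⟦ c ⟧ S.+ x S.* eval p) S.+ (φ.⟦ d ⟧ S.+ x S.* eval q) ∎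

      eval-· : ∀ c p → eval (c · p) S.≈ φ.⟦ c ⟧ S.* eval p
      eval-· c []      = S.sym (S.zeroʳ _)
      eval-· c (d ∷ p) = begin
        φ.⟦ c * d ⟧ S.+ x S.* eval (c · p)
          ≈⟨ S.+-cong (φ.*-homo c d) (S.*-congˡ (eval-· c p)) ⟩
        φ.⟦ c ⟧ S.* φ.⟦ d ⟧ S.+ x S.* (φ.⟦ c ⟧ S.* eval p)
          ≈⟨ IS.solve 4 (λ c d x p → c IS.:* d IS.:+ x IS.:* (c IS.:* p) IS.:= c IS.:* (d IS.:+ x IS.:* p))
               S.refl φ.⟦ c ⟧ φ.⟦ d ⟧ x (eval p) ⟩
        φ.⟦ c ⟧ S.* (φ.⟦ d ⟧ S.+ x S.* eval p) ∎

      eval-* : ∀ p q → eval (p *ₚ q) S.≈ eval p S.* eval q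
      eval-* []      q = S.sym (S.zeroˡ _)
      eval-* (c ∷ p) q = begin
        eval (c · q +ₚ (0# ∷ p *ₚ q))
          ≈⟨ eval-+ (c · q) (0# ∷ p *ₚ q) ⟩
        eval (c · q) S.+ (φ.⟦ 0# ⟧ S.+ x S.* eval (p *ₚ q))
          ≈⟨ S.+-cong (eval-· c q) (S.+-cong φ.0-homo (S.*-congˡ (eval-* p q))) ⟩
        φ.⟦ c ⟧ S.* eval q S.+ (S.0# S.+ x S.* (eval p S.* eval q))
          ≈⟨ IS.solve 4 (λ c x p q → c IS.:* q IS.:+ (IS.num 0 IS.:+ x IS.:* (p IS.:* q)) IS.:= (c IS.:+ x IS.:* p) IS.:* q)
               S.refl φ.⟦ c ⟧ x (eval p) (eval q) ⟩
        (φ.⟦ c ⟧ S.+ x S.* eval p) S.* eval q ∎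

    eval-const : ∀ c → eval (c ∷ []) S.≈ φ.⟦ c ⟧
    eval-const c = S.trans (S.+-congˡ (S.zeroʳ x)) (S.+-identityʳ _)

    eval-X : eval X S.≈ x
    eval-X = begin
      φ.⟦ 0# ⟧ S.+ x S.* eval (1# ∷ [])  ≈⟨ S.+-cong φ.0-homo (S.*-congˡ (S.trans (eval-const 1#) φ.1-homo)) ⟩
      S.0# S.+ x S.* S.1#  ≈⟨ S.trans (S.+-identityˡ _) (S.*-identityʳ x) ⟩
      x ∎

    evalHom : Hom polyRing S
    evalHom = record
      { ⟦_⟧ = eval ; ⟦⟧-cong = eval-cong ; +-homo = eval-+ ; *-homo = eval-*
      ; 1-homo = S.trans (eval-const 1#) φ.1-homo }

  open Evaluation public using (eval; evalHom)

  -- The universal property of R[X]; it identifies composites of substitutions without any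
  -- comparison of coefficients.
  hom-unique : ∀ {S} (f g : Hom polyRing S) →
    (∀ c → CommutativeRing._≈_ S (Hom.⟦_⟧ f (c ∷ [])) (Hom.⟦_⟧ g (c ∷ []))) →
    CommutativeRing._≈_ S (Hom.⟦_⟧ f X) (Hom.⟦_⟧ g X) →
    ∀ r → CommutativeRing._≈_ S (Hom.⟦_⟧ f r) (Hom.⟦_⟧ g r)
  hom-unique {S} f g onConst onX []      = S.trans F.0-homo (S.sym G.0-homo)
    where
    module F = Hom f
    module G = Hom g
    module S = CommutativeRing S
  hom-unique {S} f g onConst onX (c ∷ p) = begin
    F.⟦ c ∷ p ⟧  ≈⟨ F.⟦⟧-cong (∷-as-sum c p) ⟩
    F.⟦ (c ∷ []) +ₚ X *ₚ p ⟧  ≈⟨ F.+-homo _ _ ⟩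
    F.⟦ c ∷ [] ⟧ S.+ F.⟦ X *ₚ p ⟧  ≈⟨ S.+-congˡ (F.*-homo _ _) ⟩
    F.⟦ c ∷ [] ⟧ S.+ F.⟦ X ⟧ S.* F.⟦ p ⟧  ≈⟨ S.+-cong (onConst c) (S.*-cong onX (hom-unique f g onConst onX p)) ⟩
    G.⟦ c ∷ [] ⟧ S.+ G.⟦ X ⟧ S.* G.⟦ p ⟧  ≈⟨ S.+-congˡ (G.*-homo _ _) ⟨
    G.⟦ c ∷ [] ⟧ S.+ G.⟦ X *ₚ p ⟧  ≈⟨ G.+-homo _ _ ⟨
    G.⟦ (c ∷ []) +ₚ X *ₚ p ⟧  ≈⟨ G.⟦⟧-cong (∷-as-sum c p) ⟨
    G.⟦ c ∷ p ⟧  ∎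
    where
    module F = Hom f
    module G = Hom g
    module S = CommutativeRing S
    open SetoidReasoning S.setoid

-- Binomial coefficients and the Frobenius endomorphism

absorption : ∀ n k → suc k ℕ.* (suc n C suc k) ≡ suc n ℕ.* (n C k)
absorption zero zero = ≡.refl
absorption zero (suc k) = ≡.trans (≡.cong (suc (suc k) ℕ.*_) (k>n⇒nCk≡0 {1} {suc (suc k)} (s≤s (s≤s z≤n))))
  (≡.trans (ℕₚ.*-zeroʳ (suc (suc k))) (≡.cong (1 ℕ.*_) (≡.sym (k>n⇒nCk≡0 {0} {suc k} (s≤s z≤n)))))
absorption (suc n) zero = ≡.trans (ℕₚ.*-identityˡ _) (≡.trans (nC1≡n (suc (suc n))) (≡.sym (ℕₚ.*-identityʳ _)))
absorption (suc n) (suc k) = begin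
  suc (suc k) ℕ.* (suc (suc n) C suc (suc k))
    ≡⟨ ≡.cong (suc (suc k) ℕ.*_) (nCk+nC[k+1]≡[n+1]C[k+1] (suc n) (suc k)) ⟨
  suc (suc k) ℕ.* (A ℕ.+ B)
    ≡⟨ solve 3 (λ k a b → (con 2 :+ k) :* (a :+ b) := (a :+ (con 1 :+ k) :* a) :+ (con 2 :+ k) :* b) ≡.refl k A B ⟩
  (A ℕ.+ suc k ℕ.* A) ℕ.+ suc (suc k) ℕ.* B
    ≡⟨ ≡.cong₂ (λ u v → (A ℕ.+ u) ℕ.+ v) (absorption n k) (absorption n (suc k)) ⟩
  (A ℕ.+ suc n ℕ.* (n C k)) ℕ.+ suc n ℕ.* (n C suc k)
    ≡⟨ solve 4 (λ n a b c → (a :+ (con 1 :+ n) :* b) :+ (con 1 :+ n) :* c := a :+ (con 1 :+ n) :* (b :+ c)) ≡.refl n A (n C k) (n C suc k) ⟩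
  A ℕ.+ suc n ℕ.* (n C k ℕ.+ n C suc k)
    ≡⟨ ≡.cong (λ u → A ℕ.+ suc n ℕ.* u) (nCk+nC[k+1]≡[n+1]C[k+1] n k) ⟩
  suc (suc n) ℕ.* A ∎
  where
  open ≡.≡-Reasoning
  open +-*-Solver
  A = suc n C suc k
  B = suc n C suc (suc k)

-- By `absorption` the prime divides `suc k` times the coefficient, and it is larger than `suc k`.
prime∣binomial : ∀ {p k} → Prime (suc p) → k ℕ.< p → suc p ∣ (suc p C suc k)
prime∣binomial {p} {k} pr k<p with euclidsLemma (suc k) (suc p C suc k) pr
                                     (≡.subst (suc p ∣_) (≡.sym (absorption p k)) (m∣m*n (p C k)))
... | inj₁ p∣k = ⊥-elim (ℕₚ.<⇒≱ (s≤s k<p) (∣⇒≤ p∣k))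
... | inj₂ p∣C = p∣C

module Frobenius (R : Ring) where
  open CommutativeRing R hiding (zero)
  open Exp commutativeSemiring
  open Multᵤ semiring using (_×_; ×-congʳ; ×-assocˡ; ×-assoc-*; ×-homo-1)
  open Sum +-commutativeMonoid using (sum; sum-cong-≋; sum-replicate-zero; sum-init-last)
  open SetoidReasoning setoid

  ×-zero : ∀ {p} → p × 1# ≈ 0# → ∀ {m} → p ∣ m → ∀ x → m × x ≈ 0#
  ×-zero {p} char (divides k ≡.refl) x = begin
    (k ℕ.* p) × x  ≡⟨ ≡.cong (_× x) (ℕₚ.*-comm k p) ⟩
    (p ℕ.* k) × x  ≈⟨ ×-assocˡ x p k ⟨
    p × (k × x)  ≈⟨ ×-congʳ p (*-identityˡ (k × x)) ⟨
    p × (1# * (k × x))  ≈⟨ ×-assoc-* p 1# (k × x) ⟨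
    (p × 1#) * (k × x)  ≈⟨ *-congʳ char ⟩
    0# * (k × x)  ≈⟨ zeroˡ _ ⟩
    0#  ∎

  frobenius : ∀ {p} → Prime p → p × 1# ≈ 0# → ∀ x y → (x + y) ^ p ≈ x ^ p + y ^ p
  frobenius {zero} pr char x y = ⊥-elim (ℕ.≢-nonZero⁻¹ 0 ⦃ prime⇒nonZero pr ⦄ ≡.refl)
  frobenius {suc p} pr char x y = begin
    (x + y) ^ suc p  ≈⟨ theorem (suc p) x y ⟩
    term zero + sum (λ k → term (suc k))  ≈⟨ +-cong first (sum-init-last (λ k → term (suc k))) ⟩
    y ^ suc p + (sum (λ k → term (suc (inject₁ k))) + term (suc (fromℕ p)))
      ≈⟨ +-congˡ (+-cong (trans (sum-cong-≋ middle) (sum-replicate-zero p)) final) ⟩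
    y ^ suc p + (0# + x ^ suc p)  ≈⟨ +-congˡ (+-identityˡ _) ⟩
    y ^ suc p + x ^ suc p  ≈⟨ +-comm _ _ ⟩
    x ^ suc p + y ^ suc p  ∎
    where
    open Binomial commutativeSemiring using (theorem; binomialTerm)
    term : Fin (suc (suc p)) → Carrier
    term = binomialTerm x y (suc p)
    first : term zero ≈ y ^ suc p
    first = trans (×-homo-1 _) (*-identityˡ _)
    middle : ∀ k → term (suc (inject₁ k)) ≈ 0#
    middle k = ×-zero char
      (≡.subst (λ j → suc p ∣ (suc p C suc j)) (≡.sym (Finₚ.toℕ-inject₁ k)) (prime∣binomial pr (Finₚ.toℕ<n k))) _
    final : term (suc (fromℕ p)) ≈ x ^ suc p
    final rewrite Finₚ.toℕ-fromℕ p | nCn≡1 (suc p) | ℕₚ.n∸n≡0 p = trans (×-homo-1 _) (*-identityʳ _)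

  frobenius-^ : ∀ {p} → Prime p → p × 1# ≈ 0# → ∀ n x y → (x + y) ^ (p ℕ.^ n) ≈ x ^ (p ℕ.^ n) + y ^ (p ℕ.^ n)
  frobenius-^ pr char zero x y = trans (*-identityʳ _) (sym (+-cong (*-identityʳ x) (*-identityʳ y)))
  frobenius-^ {p} pr char (suc n) x y = begin
    (x + y) ^ (p ℕ.* p ℕ.^ n)  ≈⟨ ^-assocʳ (x + y) p (p ℕ.^ n) ⟨
    ((x + y) ^ p) ^ (p ℕ.^ n)  ≈⟨ ^-congˡ (p ℕ.^ n) (frobenius pr char x y) ⟩
    (x ^ p + y ^ p) ^ (p ℕ.^ n)  ≈⟨ frobenius-^ pr char n (x ^ p) (y ^ p) ⟩
    (x ^ p) ^ (p ℕ.^ n) + (y ^ p) ^ (p ℕ.^ n)  ≈⟨ +-cong (^-assocʳ x p _) (^-assocʳ y p _) ⟩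
    x ^ (p ℕ.* p ℕ.^ n) + y ^ (p ℕ.* p ℕ.^ n)  ∎

open import Data.Bool.Base using (Bool; true; false; _∧_; _xor_; if_then_else_; T; _∨_)
open import Data.Bool.ListAction using (any; all)
open import Data.Bool.Properties using (T-∧; T-∨)
open import Data.Fin.Base as Fin using (Fin; zero; suc; toℕ; _↑ˡ_; _↑ʳ_; splitAt)
open import Data.Fin.Permutation using (Permutation; permutation)
open import Data.List.Base as List using (List; []; _∷_; length; map; filter; upTo; _++_)
open import Data.List.Membership.Propositional using (_∈_; lose)
open import Data.List.Membership.Propositional.Properties using (∈-map⁺; ∈-allFin; ∈-upTo⁺; ∈-∃++; ∈-++⁺ˡ; ∈-++⁺ʳ; ∈-++⁻; ∈-filter⁺; ∈-filter⁻)
open import Data.List.Properties using (length-map; length-tabulate; map-cong; length-++)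
open import Data.List.Relation.Unary.All as All using (All; []; _∷_)
open import Data.List.Relation.Unary.All.Properties using (all-filter; all⁺)
open import Data.List.Relation.Unary.AllPairs using ([]; _∷_)
open import Data.List.Relation.Unary.Any as Any using (any?; here; there)
open import Data.List.Relation.Unary.Any.Properties using (any⁻)
open import Data.List.Relation.Unary.Unique.Propositional using (Unique)
import Data.List.Relation.Unary.Unique.Propositional.Properties as Unique
open import Data.Nat.Base as ℕ using (ℕ; zero; suc; z≤n; s≤s; NonZero; _%_; _/_; _≡ᵇ_; _<ᵇ_)
open import Data.Nat.Coprimality using (Coprime; coprime-Bézout)
open import Data.Nat.DivMod using (m≡m%n+[m/n]*n; %-distribˡ-*; m%n<n; m%n%n≡m%n)
open import Data.Nat.Divisibility using (_∤_; m%n≡0⇒n∣m)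
open import Data.Nat.GCD using (module Bézout)
open import Data.Nat.ListAction using (sum)
open import Data.Nat.Primality using (Prime; prime⇒irreducible; prime⇒nonTrivial; Composite; composite; composite⇒¬prime; prime⇒nonZero; prime?)
open import Data.Product.Base using (∃; _,_; _×_; proj₁; proj₂; ∃₂)
open import Data.Sum.Base using (_⊎_; inj₁; inj₂; [_,_]′)
open import Data.Unit.Base using (⊤; tt)
open import Data.Vec.Functional using (removeAt)
open import Function.Bundles using (Inverse; Equivalence)
open import Relation.Binary.PropositionalEquality as ≡ using (_≡_; _≢_; refl; sym; trans; cong; cong₂; subst; module ≡-Reasoning; _≗_; subst₂)
open import Relation.Nullary using (¬_; yes; no; contradiction; Dec; does; _×-dec_; ¬?; _→-dec_)
open import Relation.Nullary.Decidable using (from-yes; from-no)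

-- Finite fields

module FieldTheory {q : ℕ} (K : FiniteField q) where
  open FiniteField K
  open Inverse enum using (to; from; strictlyInverseˡ; strictlyInverseʳ)

  fieldRing : Ring
  fieldRing = record { isCommutativeRing = isCommutativeRing }

  module 𝔽 = CommutativeRing fieldRing
  module 𝔽S = IntegerSolver fieldRing
  open RingProperties 𝔽.ring public using (-0#≈0#; -‿involutive; -‿injective; +-identityʳ-unique)
  open Exp 𝔽.commutativeSemiring public
  open Multᵤ 𝔽.semiring public using (×1-homo-*; ×-homo-+) renaming (_×_ to _×ᶠ_)
  private
    module Σ = Sum 𝔽.+-commutativeMonoid
    module Π = Sum 𝔽.*-commutativeMonoid

  *-cancelˡ : ∀ {x y z} → x ≢ 0# → x * y ≡ x * z → y ≡ z
  *-cancelˡ {x} {y} {z} x≢0 e = begin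
    y  ≡⟨ undo y ⟨
    x ⁻¹ * (x * y)  ≡⟨ cong (x ⁻¹ *_) e ⟩
    x ⁻¹ * (x * z)  ≡⟨ undo z ⟩
    z  ∎
    where
    open ≡-Reasoning
    undo : ∀ y → x ⁻¹ * (x * y) ≡ y
    undo y = trans (sym (𝔽.*-assoc _ _ _)) (trans (cong (_* y) (trans (𝔽.*-comm _ _) (⁻¹-inverse x x≢0))) (𝔽.*-identityˡ y))

  *-zero⇒ : ∀ {x y} → x * y ≡ 0# → x ≡ 0# ⊎ y ≡ 0#
  *-zero⇒ {x} {y} e with x ≟ 0#
  ... | yes x≡0 = inj₁ x≡0
  ... | no x≢0  = inj₂ (*-cancelˡ x≢0 (trans e (sym (𝔽.zeroʳ x))))

  *-≢0 : ∀ {x y} → x ≢ 0# → y ≢ 0# → x * y ≢ 0#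
  *-≢0 x≢0 y≢0 e with *-zero⇒ e
  ... | inj₁ x≡0 = x≢0 x≡0
  ... | inj₂ y≡0 = y≢0 y≡0

  neg-≢0 : ∀ {x} → x ≢ 0# → - x ≢ 0#
  neg-≢0 x≢0 e = x≢0 (trans (sym (-‿involutive _)) (trans (cong -_ e) -0#≈0#))

  -‿zero⇒≡ : ∀ {x y} → x - y ≡ 0# → x ≡ y
  -‿zero⇒≡ {x} {y} e = trans (𝔽S.solve 2 (λ x y → x 𝔽S.:= (x 𝔽S.:- y) 𝔽S.:+ y) refl x y)
                             (trans (cong (_+ y) e) (𝔽.+-identityˡ y))

  ^-≢0 : ∀ {x} n → x ≢ 0# → x ^ n ≢ 0#
  ^-≢0 zero    x≢0 = 0≢1 ∘ sym
  ^-≢0 (suc n) x≢0 = *-≢0 x≢0 (^-≢0 n x≢0)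

  Square⁺ : Carrier → Set
  Square⁺ x = ∃ λ y → y ≢ 0# × y * y ≡ x

  elements-complete : ∀ x → x ∈ elements
  elements-complete x = subst (_∈ elements) (strictlyInverseˡ x) (∈-map⁺ to (∈-allFin (from x)))

  to-injective : ∀ {i j} → to i ≡ to j → i ≡ j
  to-injective {i} {j} e = trans (sym (strictlyInverseʳ i)) (trans (cong from e) (strictlyInverseʳ j))

  from-injective : ∀ {x y} → from x ≡ from y → x ≡ y
  from-injective {x} {y} e = trans (sym (strictlyInverseˡ x)) (trans (cong to e) (strictlyInverseˡ y))

  elements-unique : Unique elements
  elements-unique = Unique.map⁺ to-injective (Unique.allFin⁺ q)

  length-elements : length elements ≡ q
  length-elements = trans (length-map to (List.allFin q)) (length-tabulate (λ i → i))

  bijection : (f g : Carrier → Carrier) → (∀ x → f (g x) ≡ x) → (∀ x → g (f x) ≡ x) → Permutation q q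
  bijection f g fg gf = permutation (from ∘ f ∘ to) (from ∘ g ∘ to)
    (λ i → trans (cong (from ∘ f) (strictlyInverseˡ _)) (trans (cong from (fg _)) (strictlyInverseʳ i)))
    (λ i → trans (cong (from ∘ g) (strictlyInverseˡ _)) (trans (cong from (gf _)) (strictlyInverseʳ i)))

  -- Adding 1 permutes the field, so the sum of all elements does not change when q copies of 1 are
  -- added to it.
  order-×-1 : q ×ᶠ 1# ≡ 0#
  order-×-1 = +-identityʳ-unique (Σ.sum to) _ (begin
    Σ.sum to + q ×ᶠ 1#  ≡⟨ cong (Σ.sum to +_) (Σ.sum-replicate q) ⟨
    Σ.sum to + Σ.sum {q} (λ _ → 1#)  ≡⟨ Σ.∑-distrib-+ {q} to (λ _ → 1#) ⟨
    Σ.sum {q} (λ i → to i + 1#)  ≡⟨ Σ.sum-cong-≗ {q} (λ i → strictlyInverseˡ _) ⟨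
    Σ.sum {q} (λ i → to (from (to i + 1#))) ≡⟨ Σ.sum-permute to (bijection (_+ 1#) (_- 1#) (λ x → 𝔽S.solve 1 (λ x → (x :- num 1) :+ num 1 := x) refl x) (λ x → 𝔽S.solve 1 (λ x → (x :+ num 1) :- num 1 := x) refl x)) ⟨
    Σ.sum to  ∎)
    where
    open ≡-Reasoning
    open 𝔽S

  private
    -- Agrees with the identity off 0; avoids restricting products to the nonzero elements.
    unit : Carrier → Carrier
    unit x with x ≟ 0#
    ... | yes _ = 1#
    ... | no _  = x

    unit-≢0 : ∀ x → unit x ≢ 0#
    unit-≢0 x with x ≟ 0#
    ... | yes _  = 0≢1 ∘ sym
    ... | no x≢0 = x≢0

    atZero : Carrier → Carrier → Carrier
    atZero a x with x ≟ 0#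
    ... | yes _ = a
    ... | no _  = 1#

    atZero-0 : ∀ a → atZero a 0# ≡ a
    atZero-0 a with 0# ≟ 0#
    ... | yes _   = refl
    ... | no 0≢0  = contradiction refl 0≢0

    atZero-≢0 : ∀ a {x} → x ≢ 0# → atZero a x ≡ 1#
    atZero-≢0 a {x} x≢0 with x ≟ 0#
    ... | yes x≡0 = contradiction x≡0 x≢0
    ... | no _    = refl

    -- The factor `atZero a x` corrects the single argument 0, where `unit` ignores multiplication
    -- by a. Over the whole field the corrections multiply to a, which is why `fermat` yields a^q =
    -- a rather than a^(q-1) = 1.
    unit-* : ∀ a → a ≢ 0# → ∀ x → unit (a * x) * atZero a x ≡ a * unit x
    unit-* a a≢0 x with x ≟ 0# | (a * x) ≟ 0#
    ... | yes _   | yes _    = trans (𝔽.*-identityˡ a) (sym (𝔽.*-identityʳ a))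
    ... | no _    | no _     = 𝔽.*-identityʳ _
    ... | yes x≡0 | no ax≢0  = contradiction (trans (cong (a *_) x≡0) (𝔽.zeroʳ a)) ax≢0
    ... | no x≢0  | yes ax≡0 = contradiction ax≡0 (*-≢0 a≢0 x≢0)

    ∏-≢0 : ∀ {n} (f : Fin n → Carrier) → (∀ i → f i ≢ 0#) → Π.sum f ≢ 0#
    ∏-≢0 {zero}  f f≢0 = 0≢1 ∘ sym
    ∏-≢0 {suc n} f f≢0 = *-≢0 (f≢0 zero) (∏-≢0 (f ∘ suc) (f≢0 ∘ suc))

    ∏-single : ∀ {n} (f : Fin n → Carrier) i → (∀ j → j ≢ i → f j ≡ 1#) → Π.sum f ≡ f i
    ∏-single {suc n} f i f≡1 = trans (Π.sum-remove {i = i} f) (trans (cong (f i *_) rest) (𝔽.*-identityʳ _))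
      where
      rest : Π.sum (removeAt f i) ≡ 1#
      rest = trans (Π.sum-cong-≗ (λ j → f≡1 (Fin.punchIn i j) (Finₚ.punchInᵢ≢i i j))) (Π.sum-replicate-zero n)

  fermat : ∀ x → x ^ q ≡ x
  fermat a with a ≟ 0#
  ... | yes refl = 0^ (from 0#)
    where
    0^ : ∀ {n} → Fin n → 0# ^ n ≡ 0#
    0^ {suc n} _ = 𝔽.zeroˡ _
  ... | no a≢0 = *-cancelˡ (∏-≢0 (unit ∘ to) (unit-≢0 ∘ to)) (begin
    Π.sum (unit ∘ to) * a ^ q  ≡⟨ 𝔽.*-comm _ _ ⟩
    a ^ q * Π.sum (unit ∘ to)  ≡⟨ cong (_* _) (Π.sum-replicate q) ⟨
    Π.sum {q} (λ _ → a) * Π.sum (unit ∘ to)  ≡⟨ Π.∑-distrib-+ {q} (λ _ → a) (unit ∘ to) ⟨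
    Π.sum {q} (λ i → a * unit (to i))  ≡⟨ Π.sum-cong-≗ {q} (λ i → unit-* a a≢0 (to i)) ⟨
    Π.sum {q} (λ i → unit (a * to i) * atZero a (to i))  ≡⟨ Π.∑-distrib-+ {q} (λ i → unit (a * to i)) (atZero a ∘ to) ⟩
    Π.sum {q} (λ i → unit (a * to i)) * Π.sum (atZero a ∘ to)  ≡⟨ cong₂ _*_ shuffle single ⟩
    Π.sum (unit ∘ to) * a  ∎)
    where
    open ≡-Reasoning
    cancel : ∀ {b c} → b * c ≡ 1# → ∀ x → b * (c * x) ≡ x
    cancel e x = trans (sym (𝔽.*-assoc _ _ _)) (trans (cong (_* x) e) (𝔽.*-identityˡ x))
    shuffle : Π.sum {q} (λ i → unit (a * to i)) ≡ Π.sum (unit ∘ to)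
    shuffle = trans (sym (Π.sum-cong-≗ {q} (λ i → cong unit (strictlyInverseˡ _))))
      (sym (Π.sum-permute (unit ∘ to) (bijection (a *_) (a ⁻¹ *_) (cancel (⁻¹-inverse a a≢0))
        (cancel (trans (𝔽.*-comm _ _) (⁻¹-inverse a a≢0))))))
    single : Π.sum (atZero a ∘ to) ≡ a
    single = trans (∏-single (atZero a ∘ to) (from 0#)
        (λ j j≢ → atZero-≢0 a λ e → j≢ (trans (sym (strictlyInverseʳ j)) (cong from e))))
      (trans (cong (atZero a) (strictlyInverseˡ 0#)) (atZero-0 a))

  module Characteristic {p n : ℕ} (prime : Prime p) (q≡pⁿ : q ≡ p ℕ.^ n) where

    -- By `order-×-1` the n-th power of p · 1 vanishes, and a field has no nilpotent elements.
    char : p ×ᶠ 1# ≡ 0#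
    char = power-zero n (trans (sym (^-homo p n)) (trans (cong (_×ᶠ 1#) (sym q≡pⁿ)) order-×-1))
      where
      ^-homo : ∀ p n → (p ℕ.^ n) ×ᶠ 1# ≡ (p ×ᶠ 1#) ^ n
      ^-homo p zero    = 𝔽.+-identityʳ 1#
      ^-homo p (suc n) = trans (×1-homo-* p (p ℕ.^ n)) (cong (_ *_) (^-homo p n))
      power-zero : ∀ {x} n → x ^ n ≡ 0# → x ≡ 0#
      power-zero {x} n e with x ≟ 0#
      ... | yes x≡0 = x≡0
      ... | no x≢0  = contradiction e (^-≢0 n x≢0)

    private
      absurd : ∀ {a b} x y → a ×ᶠ 1# ≡ 0# → b ×ᶠ 1# ≡ 0# → 1 ℕ.+ y ℕ.* b ≢ x ℕ.* a
      absurd {a} {b} x y a≡0 b≡0 eq = 0≢1 (sym (begin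
        1#  ≡⟨ 𝔽.+-identityʳ 1# ⟨
        1# + 0#  ≡⟨ cong (1# +_) (vanish y b≡0) ⟨
        (1 ℕ.+ y ℕ.* b) ×ᶠ 1#  ≡⟨ cong (_×ᶠ 1#) eq ⟩
        (x ℕ.* a) ×ᶠ 1#  ≡⟨ vanish x a≡0 ⟩
        0#  ∎))
        where
        open ≡-Reasoning
        vanish : ∀ {a} x → a ×ᶠ 1# ≡ 0# → (x ℕ.* a) ×ᶠ 1# ≡ 0#
        vanish {a} x e = trans (×1-homo-* x a) (trans (cong (_ *_) e) (𝔽.zeroʳ _))

    -- A Bézout relation between p and m would turn m · 1 = 0 into 1 = 0.
    ×1-≢0 : ∀ {m} → p ∤ m → m ×ᶠ 1# ≢ 0#
    ×1-≢0 {m} p∤m m≡0 with coprime-Bézout coprime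
      where
      coprime : Coprime p m
      coprime (d∣p , d∣m) with prime⇒irreducible prime d∣p
      ... | inj₁ d≡1  = d≡1
      ... | inj₂ refl = contradiction d∣m p∤m
    ... | Bézout.+- x y eq = absurd x y char m≡0 eq
    ... | Bézout.-+ x y eq = absurd y x m≡0 char eq

-- Roots of polynomials over a finite field

module FieldPolynomials {q : ℕ} (K : FiniteField q) where
  open FiniteField K
  open FieldTheory K
  open Polynomials fieldRing public

  module 𝕏 = CommutativeRing polyRing
  module 𝕏S = IntegerSolver polyRing
  module 𝕏R = SetoidReasoning 𝕏.setoid
  open Exp 𝕏.commutativeSemiring public using () renaming
    (_^_ to _^ₚ_; ^-congˡ to ^ₚ-congˡ; ^-homo-* to ^ₚ-homo-*; ^-distrib-* to ^ₚ-distrib-*; ^-assocʳ to ^ₚ-assocʳ)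

  module Value (α : Carrier) = Evaluation {fieldRing} (idₕ {fieldRing}) α

  value : Carrier → Poly → Carrier
  value α = Value.eval α

  infix 4 _≉0 _∣ₚ_
  _≉0 : Poly → Set
  p ≉0 = ¬ p ≋ []

  _∣ₚ_ : Poly → Poly → Set
  d ∣ₚ p = ∃ λ k → p ≋ d *ₚ k

  ≋-minus-zero : ∀ {p r} → p 𝕏.- r ≋ [] → p ≋ r
  ≋-minus-zero {p} {r} e = ≋-trans (𝕏S.solve 2 (λ p r → p 𝕏S.:= (p 𝕏S.:- r) 𝕏S.:+ r) ≋-refl p r) (≋-trans (+ₚ-cong e ≋-refl) (+ₚ-identityˡ r))

  minus-≋-zero : ∀ {p r} → p ≋ r → p 𝕏.- r ≋ []
  minus-≋-zero {p} {r} e = ≋-trans (+ₚ-cong e ≋-refl) (𝕏.-‿inverseʳ r)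

  -- Lists begin with the constant term: factors X are removed from p until this term is nonzero,
  -- after which the coefficients of r are forced to vanish one by one.
  *ₚ-zero⇒ʳ : ∀ p {r} → p ≉0 → p *ₚ r ≋ [] → r ≋ []
  *ₚ-zero⇒ʳ []      p≉0 e = contradiction ≋-refl p≉0
  *ₚ-zero⇒ʳ (c ∷ p) {r} p≉0 e with c ≟ 0#
  ... | yes refl = *ₚ-zero⇒ʳ p (λ p≈0 → p≉0 (∷-zero refl p≈0)) (tail-zero (≋-trans (≋-sym (shift-*ₚ p r)) e))
  ... | no c≢0   = unit-cancel r e
    where
    unit-cancel : ∀ r → (c ∷ p) *ₚ r ≋ [] → r ≋ []
    unit-cancel []      e = ≋-refl
    unit-cancel (y ∷ r) e = ∷-zero y≡0 (unit-cancel r (tail-zero (≋-trans (≋-sym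
        (≋-trans (*ₚ-∷ (c ∷ p) y r) (≋-trans (+ₚ-cong (·-zero (c ∷ p) y≡0) ≋-refl) (+ₚ-identityˡ _)))) e)))
      where
      y≡0 : y ≡ 0#
      y≡0 = *-cancelˡ c≢0 (trans (sym (coeff-0-* (c ∷ p) (y ∷ r))) (trans (coeff-≈ e 0) (sym (𝔽.zeroʳ c))))

  opaque
    *ₚ-cancelˡ : ∀ p {r s} → p ≉0 → p *ₚ r ≋ p *ₚ s → r ≋ s
    *ₚ-cancelˡ p {r} {s} p≉0 e = ≋-minus-zero (*ₚ-zero⇒ʳ p p≉0
      (≋-trans (𝕏S.solve 3 (λ p r s → p 𝕏S.:* (r 𝕏S.:- s) 𝕏S.:= p 𝕏S.:* r 𝕏S.:- p 𝕏S.:* s) ≋-refl p r s) (minus-≋-zero e)))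

    factor-≉0 : ∀ {h} d k → h ≉0 → h ≋ d *ₚ k → k ≉0
    factor-≉0 d k h≉0 e k≈0 = h≉0 (≋-trans e (≋-trans (*ₚ-congˡ d k≈0) (*ₚ-zeroʳ d)))

  lin : Carrier → Poly
  lin α = - α ∷ 1# ∷ []

  lin-≉0 : ∀ α → lin α ≉0
  lin-≉0 α e = 0≢1 (sym (coeff-≈ e 1))

  lin-as-difference : ∀ α → lin α ≋ X 𝕏.- (α ∷ [])
  lin-as-difference α = coeffwise λ n → trans (lemma n) (sym (trans (coeff-+ X (-ₚ (α ∷ [])) n) (cong (coeff X n +_) (coeff-neg (α ∷ []) n))))
    where
    lemma : ∀ n → coeff (lin α) n ≡ coeff X n + - coeff (α ∷ []) n
    lemma zero          = sym (𝔽.+-identityˡ _)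
    lemma (suc zero)    = sym (trans (cong (1# +_) -0#≈0#) (𝔽.+-identityʳ _))
    lemma (suc (suc n)) = sym (𝔽.-‿inverseʳ 0#)

  value-lin : ∀ α β → value β (lin α) ≡ β - α
  value-lin α β = 𝔽S.solve 2 (λ α β → :- α :+ β :* (num 1 :+ β :* num 0) := β :- α) refl α β
    where open 𝔽S

  private
    -- Horner's scheme: `quotient α p` is the quotient of `c ∷ p` by X - α for every c, and the
    -- value at α of `c ∷ p` is the remainder.
    quotient : Carrier → Poly → Poly
    quotient α []      = []
    quotient α (c ∷ p) = value α (c ∷ p) ∷ quotient α p

    length-quotient : ∀ α p → length (quotient α p) ≡ length p
    length-quotient α []      = refl
    length-quotient α (c ∷ p) = cong suc (length-quotient α p)

    synthetic-division : ∀ α c p → c ∷ p ≋ lin α *ₚ quotient α p +ₚ (value α (c ∷ p) ∷ [])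
    synthetic-division α c []      = ≋-trans (∷-cong (sym (trans (cong (c +_) (𝔽.zeroʳ α)) (𝔽.+-identityʳ c))) ≋-refl)
      (≋-trans (≋-sym (+ₚ-identityˡ _)) (+ₚ-cong (≋-sym (*ₚ-zeroʳ (lin α))) ≋-refl))
    synthetic-division α c (c′ ∷ p) = begin
      c ∷ c′ ∷ p  ≈⟨ ∷-as-sum c (c′ ∷ p) ⟩
      C.⟦ c ⟧ +ₚ X *ₚ (c′ ∷ p)  ≈⟨ +ₚ-cong (≋-refl {C.⟦ c ⟧}) (*ₚ-congˡ X (synthetic-division α c′ p)) ⟩
      C.⟦ c ⟧ +ₚ X *ₚ (lin α *ₚ Q +ₚ C.⟦ v ⟧)
        ≈⟨ +ₚ-cong (≋-refl {C.⟦ c ⟧}) (*ₚ-congˡ X (+ₚ-cong (*ₚ-congʳ Q (lin-as-difference α)) ≋-refl)) ⟩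
      C.⟦ c ⟧ +ₚ X *ₚ ((X 𝕏.- C.⟦ α ⟧) *ₚ Q +ₚ C.⟦ v ⟧)
        ≈⟨ solve 5 (λ c X α Q v → c :+ X :* ((X :- α) :* Q :+ v) := (X :- α) :* (v :+ X :* Q) :+ (c :+ α :* v))
             ≋-refl C.⟦ c ⟧ X C.⟦ α ⟧ Q C.⟦ v ⟧ ⟩
      (X 𝕏.- C.⟦ α ⟧) *ₚ (C.⟦ v ⟧ +ₚ X *ₚ Q) +ₚ (C.⟦ c ⟧ +ₚ C.⟦ α ⟧ *ₚ C.⟦ v ⟧)
        ≈⟨ +ₚ-cong (≋-trans (*ₚ-congʳ _ (≋-sym (lin-as-difference α))) (*ₚ-congˡ (lin α) (≋-sym (∷-as-sum v Q))))
                   (≋-trans (+ₚ-cong (≋-refl {C.⟦ c ⟧}) (≋-sym (C.*-homo α v))) (≋-sym (C.+-homo c (α * v)))) ⟩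
      lin α *ₚ (v ∷ Q) +ₚ C.⟦ c + α * v ⟧  ∎
      where
      open 𝕏R
      open 𝕏S
      module C = Hom const
      Q = quotient α p
      v = value α (c′ ∷ p)

  opaque
    root-factor : ∀ {α} p → p ≉0 → value α p ≡ 0# → ∃ λ k → p ≋ lin α *ₚ k × suc (length k) ≡ length p
    root-factor []          p≉0 e = contradiction ≋-refl p≉0
    root-factor {α} (c ∷ p) p≉0 e = quotient α p ,
      ≋-trans (synthetic-division α c p)
        (≋-trans (+ₚ-cong (≋-refl {lin α *ₚ quotient α p}) (∷-zero e ≋-refl)) (+ₚ-identityʳ _)) ,
      cong suc (length-quotient α p)

    value-lin-* : ∀ α β p → value β (lin α *ₚ p) ≡ (β - α) * value β p
    value-lin-* α β p = trans (Value.eval-* β (lin α) p) (cong (_* value β p) (value-lin α β))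

    lin∣⇒root : ∀ {α p} k → p ≋ lin α *ₚ k → value α p ≡ 0#
    lin∣⇒root {α} k e = trans (Value.eval-cong α e) (trans (value-lin-* α α k) (trans (cong (_* value α k) (𝔽.-‿inverseʳ α)) (𝔽.zeroˡ _)))

  ^ₚ-suc-* : ∀ p m w → p ^ₚ suc m *ₚ w ≋ p *ₚ (p ^ₚ m *ₚ w)
  ^ₚ-suc-* p m w = *ₚ-assoc p (p ^ₚ m) w

  ^ₚ-zero-* : ∀ p w → p ^ₚ 0 *ₚ w ≋ w
  ^ₚ-zero-* p w = *ₚ-identityˡ w

  -- The cofactor in a divisibility witness may carry trailing zeros. It is rebuilt by synthetic
  -- division, whose output has a known length.
  strip-roots : ∀ {α} m h → h ≉0 → lin α ^ₚ m ∣ₚ h → ∃ λ k → h ≋ lin α ^ₚ m *ₚ k × length k ℕ.+ m ≡ length h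
  strip-roots {α} zero h h≉0 _ = h , ≋-sym (^ₚ-zero-* (lin α) h) , ℕₚ.+-identityʳ _
  strip-roots {α} (suc m) h h≉0 (w , e)
    with root-factor {α} h h≉0 (lin∣⇒root (lin α ^ₚ m *ₚ w) (≋-trans e (^ₚ-suc-* (lin α) m w)))
  ... | k₁ , h≈ , len
    with strip-roots {α} m k₁ (factor-≉0 (lin α) k₁ h≉0 h≈)
           (w , *ₚ-cancelˡ (lin α) (lin-≉0 α) (≋-trans (≋-sym h≈) (≋-trans e (^ₚ-suc-* (lin α) m w))))
  ... | k , k₁≈ , len′ =
    k , ≋-trans h≈ (≋-trans (*ₚ-congˡ (lin α) k₁≈) (≋-sym (^ₚ-suc-* (lin α) m k))) ,
    trans (ℕₚ.+-suc (length k) m) (trans (cong suc len′) len)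

  private
    -- Peels off one factor X - β at a time: β is a root of (X - α)p but not of X - α.
    coprime-lin : ∀ {α β} m p → α ≢ β → p ≉0 → lin β ^ₚ m ∣ₚ (lin α *ₚ p) → lin β ^ₚ m ∣ₚ p
    coprime-lin {α} {β} zero p _ _ _ = p , ≋-sym (^ₚ-zero-* (lin β) p)
    coprime-lin {α} {β} (suc m) p α≢β p≉0 (w , e)
      with root-factor {β} p p≉0 root
      where
      e′ : lin α *ₚ p ≋ lin β *ₚ (lin β ^ₚ m *ₚ w)
      e′ = ≋-trans e (^ₚ-suc-* (lin β) m w)
      root : value β p ≡ 0#
      root = *-cancelˡ (λ β-α≡0 → α≢β (sym (-‿zero⇒≡ β-α≡0)))
        (trans (trans (sym (value-lin-* α β p)) (lin∣⇒root (lin β ^ₚ m *ₚ w) e′)) (sym (𝔽.zeroʳ _)))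
    ... | p₁ , p≈ , _
      with coprime-lin {α} {β} m p₁ α≢β (factor-≉0 (lin β) p₁ p≉0 p≈)
             (w , *ₚ-cancelˡ (lin β) (lin-≉0 β)
               (≋-trans (𝕏S.solve 3 (λ a b p → b 𝕏S.:* (a 𝕏S.:* p) 𝕏S.:= a 𝕏S.:* (b 𝕏S.:* p)) ≋-refl (lin α) (lin β) p₁)
               (≋-trans (*ₚ-congˡ (lin α) (≋-sym p≈)) (≋-trans e (^ₚ-suc-* (lin β) m w)))))
    ... | w′ , p₁≈ = w′ , ≋-trans p≈ (≋-trans (*ₚ-congˡ (lin β) p₁≈) (≋-sym (^ₚ-suc-* (lin β) m w′)))

    coprime-lin-^ : ∀ {α β} n m p → α ≢ β → p ≉0 → lin β ^ₚ m ∣ₚ (lin α ^ₚ n *ₚ p) → lin β ^ₚ m ∣ₚ p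
    coprime-lin-^ {α} zero m p α≢β p≉0 (w , e) = w , ≋-trans (≋-sym (^ₚ-zero-* (lin α) p)) e
    coprime-lin-^ {α} {β} (suc n) m p α≢β p≉0 (w , e) =
      coprime-lin-^ {α} {β} n m p α≢β p≉0
        (coprime-lin {α} {β} m (lin α ^ₚ n *ₚ p) α≢β (*-≉0 n) (w , ≋-trans (≋-sym (^ₚ-suc-* (lin α) n p)) e))
      where
      *-≉0 : ∀ n → (lin α ^ₚ n *ₚ p) ≉0
      *-≉0 zero    e = p≉0 (≋-trans (≋-sym (^ₚ-zero-* (lin α) p)) e)
      *-≉0 (suc n) e = *-≉0 n (*ₚ-zero⇒ʳ (lin α) (lin-≉0 α) (≋-trans (≋-sym (^ₚ-suc-* (lin α) n p)) e))

  -- Removing all m factors at one point preserves divisibility at the others, since powers of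
  -- distinct linear polynomials are coprime; each removal shortens h by m.
  roots-with-multiplicity : ∀ m h Z → h ≉0 → Unique Z → All (λ α → lin α ^ₚ m ∣ₚ h) Z → length Z ℕ.* m ℕ.< length h
  roots-with-multiplicity m []      []      h≉0 _ _ = contradiction ≋-refl h≉0
  roots-with-multiplicity m (c ∷ h) []      h≉0 _ _ = s≤s z≤n
  roots-with-multiplicity m h (α ∷ Z) h≉0 (α∉Z ∷ uniq) (α-div ∷ divs)
    with strip-roots {α} m h h≉0 α-div
  ... | k , h≈ , len =
    subst (m ℕ.+ length Z ℕ.* m ℕ.<_) (trans (ℕₚ.+-comm m (length k)) len)
      (ℕₚ.+-monoʳ-< m (roots-with-multiplicity m k Z k≉0 uniq (All.zipWith still (α∉Z , divs))))
    where
    k≉0 : k ≉0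
    k≉0 = factor-≉0 (lin α ^ₚ m) k h≉0 h≈
    still : ∀ {β} → α ≢ β × lin β ^ₚ m ∣ₚ h → lin β ^ₚ m ∣ₚ k
    still {β} (α≢β , w , e) = coprime-lin-^ {α} {β} m m k α≢β k≉0 (w , ≋-trans (≋-sym h≈) e)

  root-count : ∀ h Z → h ≉0 → Unique Z → All (λ α → value α h ≡ 0#) Z → length Z ℕ.< length h
  root-count h Z h≉0 uniq roots = subst (ℕ._< length h) (ℕₚ.*-identityʳ _)
    (roots-with-multiplicity 1 h Z h≉0 uniq (All.map simple roots))
    where
    simple : ∀ {α} → value α h ≡ 0# → lin α ^ₚ 1 ∣ₚ h
    simple {α} root = let k , h≈ , _ = root-factor h h≉0 root in
      k , ≋-trans h≈ (*ₚ-congʳ k (≋-sym (𝕏.*-identityʳ (lin α))))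

  X^-suc-* : ∀ n k → X ^ₚ suc n *ₚ k ≋ 0# ∷ X ^ₚ n *ₚ k
  X^-suc-* n k = ≋-trans (*ₚ-assoc X (X ^ₚ n) k) (X-* (X ^ₚ n *ₚ k))

  coeff-X^-* : ∀ n k {i} → i ℕ.< n → coeff (X ^ₚ n *ₚ k) i ≡ 0#
  coeff-X^-* (suc n) k {zero}  _         = coeff-≈ (X^-suc-* n k) 0
  coeff-X^-* (suc n) k {suc i} (s≤s i<n) = trans (coeff-≈ (X^-suc-* n k) (suc i)) (coeff-X^-* n k i<n)

  ≋-mod-X^ : ∀ {n p r} k → length p ℕ.≤ n → length r ℕ.≤ n → p ≋ r +ₚ X ^ₚ n *ₚ k → p ≋ r
  ≋-mod-X^ {n} {p} {r} k p≤ r≤ e = coeffwise λ i → lemma i (i ℕₚ.<? n)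
    where
    lemma : ∀ i → _ → coeff p i ≡ coeff r i
    lemma i (yes i<n) = trans (coeff-≈ e i) (trans (coeff-+ r (X ^ₚ n *ₚ k) i)
      (trans (cong (coeff r i +_) (coeff-X^-* n k i<n)) (𝔽.+-identityʳ _)))
    lemma i (no i≮n) = trans (coeff-beyond p (ℕₚ.≤-trans p≤ (ℕₚ.≮⇒≥ i≮n))) (sym (coeff-beyond r (ℕₚ.≤-trans r≤ (ℕₚ.≮⇒≥ i≮n))))

  X^-*-cancel : ∀ n {k} → X ^ₚ n *ₚ k ≋ [] → k ≋ []
  X^-*-cancel zero    {k} e = ≋-trans (≋-sym (*ₚ-identityˡ k)) e
  X^-*-cancel (suc n) {k} e = X^-*-cancel n (tail-zero (≋-trans (≋-sym (X^-suc-* n k)) e))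

  length-^ : ∀ {d} p n → length p ℕ.≤ suc d → length (p ^ₚ n) ℕ.≤ suc (n ℕ.* d)
  length-^ p zero    _ = s≤s z≤n
  length-^ p (suc n) e = length-* p (p ^ₚ n) e (length-^ p n e)

  module _ {p n : ℕ} (prime : Prime p) (q≡pⁿ : q ≡ p ℕ.^ n) where
    open Characteristic {p} {n} prime q≡pⁿ
    private
      module P× = Multᵤ 𝕏.semiring
      module C = Hom const

      const-× : ∀ m → m P×.× (1# ∷ []) ≋ C.⟦ m ×ᶠ 1# ⟧
      const-× zero    = ≋-sym (∷-zero refl ≋-refl)
      const-× (suc m) = ≋-trans (+ₚ-cong ≋-refl (const-× m)) (+ₚ-const 1# (m ×ᶠ 1#))

    -- For r = c + X r′ the Frobenius map gives r^q = c^q + X^q r′^q, and c^q = c. Consequently x^q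
    -- is constant to order q around every point of K, which is why the auxiliary polynomial is
    -- built in powers of x^q.
    frobenius-mod-X^q : ∀ r → ∃ λ k → r ^ₚ q ≋ (coeff r 0 ∷ []) +ₚ X ^ₚ q *ₚ k
    frobenius-mod-X^q []      = [] , ≋-trans (^ₚ-congˡ q (≋-sym (∷-zero refl ≋-refl)))
        (≋-trans (≋-sym (C.^-homo 0# q)) (≋-trans (∷-cong (fermat 0#) ≋-refl)
        (≋-trans (≋-sym (+ₚ-identityʳ (0# ∷ []))) (+ₚ-cong (≋-refl {0# ∷ []}) (≋-sym (*ₚ-zeroʳ (X ^ₚ q)))))))
    frobenius-mod-X^q (c ∷ r) = r ^ₚ q , (begin
      (c ∷ r) ^ₚ q  ≈⟨ ^ₚ-congˡ q (∷-as-sum c r) ⟩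
      ((c ∷ []) +ₚ X *ₚ r) ^ₚ q  ≈⟨ additive (c ∷ []) (X *ₚ r) ⟩
      (c ∷ []) ^ₚ q +ₚ (X *ₚ r) ^ₚ q  ≈⟨ +ₚ-cong (≋-sym (C.^-homo c q)) (^ₚ-distrib-* X r q) ⟩
      (c ^ q ∷ []) +ₚ X ^ₚ q *ₚ r ^ₚ q  ≈⟨ +ₚ-cong (∷-cong (fermat c) (≋-refl {[]})) ≋-refl ⟩
      (c ∷ []) +ₚ X ^ₚ q *ₚ r ^ₚ q  ∎)
      where
      open 𝕏R
      additive : ∀ a b → (a +ₚ b) ^ₚ q ≋ a ^ₚ q +ₚ b ^ₚ q
      additive a b = subst (λ m → (a +ₚ b) ^ₚ m ≋ a ^ₚ m +ₚ b ^ₚ m) (sym q≡pⁿ)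
        (Frobenius.frobenius-^ polyRing prime (≋-trans (const-× p) (∷-zero char ≋-refl)) n a b)

-- Stepanov's method

module Stepanov {q : ℕ} (K : FiniteField q) {p n : ℕ} (prime : Prime p) (q≡pⁿ : q ≡ p ℕ.^ n)
                (e : ℕ) (q≡1+2e : q ≡ suc (e ℕ.+ e)) where
  open FiniteField K
  open FieldTheory K
  open FieldPolynomials K

  open Inverse enum using (to; from)

  module 𝔹 = Polynomials polyRing
  module 𝔹R = CommutativeRing 𝔹.polyRing
  module 𝔹S = IntegerSolver 𝔹.polyRing
  open Exp 𝔹R.commutativeSemiring using () renaming (_^_ to _^₂_)

  -- Pigeonhole form of: a linear system with more unknowns than equations has a nonzero solution.
  collision : ∀ {m n} → 1 ℕ.< q → m ℕ.< n → (L : (Fin n → Carrier) → Fin m → Carrier) →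
    ∃₂ λ v w → ¬ v ≗ w × L v ≗ L w
  collision {m} {n} 1<q m<n L
    with i , j , i<j , same ← Finₚ.pigeonhole (ℕₚ.^-monoʳ-< q 1<q m<n) (λ i → Fin.funToFin (from ∘ L (to ∘ Fin.finToFun {q} {n} i))) =
    to ∘ Fin.finToFun i , to ∘ Fin.finToFun j ,
    (λ v≗w → ℕₚ.<⇒≢ i<j (cong toℕ (trans (sym (Finₚ.funToFin-finToFin {n} {q} i))
      (trans (funToFin-cong (λ k → to-injective (v≗w k))) (Finₚ.funToFin-finToFin {n} {q} j))))) ,
    λ k → from-injective (trans (sym (Finₚ.finToFun-funToFin (from ∘ L (to ∘ Fin.finToFun i)) k))
      (trans (cong (λ x → Fin.finToFun {q} {m} x k) same) (Finₚ.finToFun-funToFin (from ∘ L (to ∘ Fin.finToFun j)) k)))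
    where
    funToFin-cong : ∀ {m n} {f g : Fin m → Fin n} → f ≗ g → Fin.funToFin f ≡ Fin.funToFin g
    funToFin-cong {zero}  e = refl
    funToFin-cong {suc m} e = cong₂ Fin.combine (e zero) (funToFin-cong (e ∘ suc))

  module Auxiliary (f : Poly) (δ : ℕ) (f≤ : length f ℕ.≤ suc (suc δ)) where

    -- A weighted degree: the coefficient of S^i has degree at most m + iδ. The slope δ is dictated
    -- by `point`, whose coefficients have degrees at most 1 and 1 + δ; under products the offsets m
    -- add up while the slope stays the same.
    Bounded : ℕ → 𝔹.Poly → Set
    Bounded m []      = ⊤
    Bounded m (c ∷ F) = length c ℕ.≤ suc m × Bounded (m ℕ.+ δ) F

    Bounded-mono : ∀ {m n} F → m ℕ.≤ n → Bounded m F → Bounded n F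
    Bounded-mono []      m≤n _       = tt
    Bounded-mono (c ∷ F) m≤n (e , b) = ℕₚ.≤-trans e (s≤s m≤n) , Bounded-mono F (ℕₚ.+-monoˡ-≤ δ m≤n) b

    opaque
      unfolding Polynomials._+ₚ_ Polynomials._*ₚ_ Polynomials._·_

      Bounded-+ : ∀ {m} F G → Bounded m F → Bounded m G → Bounded m (F 𝔹.+ₚ G)
      Bounded-+ []      G       _       b       = b
      Bounded-+ (c ∷ F) []      b       _       = b
      Bounded-+ (c ∷ F) (d ∷ G) (e , b) (e′ , b′) = length-+ c d e e′ , Bounded-+ F G b b′

      Bounded-· : ∀ {m n} c F → length c ℕ.≤ suc m → Bounded n F → Bounded (m ℕ.+ n) (c 𝔹.· F)
      Bounded-· c []      c≤ _ = tt
      Bounded-· {m} {n} c (d ∷ F) c≤ (e , b) = length-* c d c≤ e ,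
        subst (λ k → Bounded k (c 𝔹.· F)) (sym (ℕₚ.+-assoc m n δ)) (Bounded-· c F c≤ b)

      Bounded-* : ∀ {m n} F G → Bounded m F → Bounded n G → Bounded (m ℕ.+ n) (F 𝔹.*ₚ G)
      Bounded-* []      G _ _ = tt
      Bounded-* {m} {n} (c ∷ F) G (e , b) b′ = Bounded-+ (c 𝔹.· G) ([] ∷ F 𝔹.*ₚ G) (Bounded-· c G e b′)
        (z≤n , subst (λ k → Bounded k (F 𝔹.*ₚ G)) shuffle (Bounded-* F G b b′))
        where
        shuffle : m ℕ.+ δ ℕ.+ n ≡ m ℕ.+ n ℕ.+ δ
        shuffle = trans (ℕₚ.+-assoc m δ n) (trans (cong (m ℕ.+_) (ℕₚ.+-comm δ n)) (sym (ℕₚ.+-assoc m n δ)))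

      Bounded-*-[] : ∀ {m} F → Bounded m (F 𝔹.*ₚ [])
      Bounded-*-[] []      = tt
      Bounded-*-[] (c ∷ F) = z≤n , Bounded-*-[] F

    Bounded-^ : ∀ F k → Bounded 0 F → Bounded 0 (F ^₂ k)
    Bounded-^ F zero    b = s≤s z≤n , tt
    Bounded-^ F (suc k) b = Bounded-* F (F ^₂ k) b (Bounded-^ F k b)

    -- a + f(a) S, as a polynomial in S over K[a]; the factor f(a) clears the denominators of the expansion of f^e at a.
    point : 𝔹.Poly
    point = X ∷ f ∷ []

    point-bounded : Bounded 1 point
    point-bounded = ℕₚ.≤-refl , f≤ , tt

    module Φ = Evaluation {𝔹.polyRing} (𝔹.const ∘ₕ const) point

    Φ-bounded : ∀ {m} r → length r ℕ.≤ suc m → Bounded m (Φ.eval r)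
    Φ-bounded []          _       = tt
    Φ-bounded (c ∷ [])    _       = Bounded-+ ((c ∷ []) ∷ []) (point 𝔹.*ₚ []) (s≤s z≤n , tt) (Bounded-*-[] point)
    Φ-bounded {suc m} (c ∷ r@(_ ∷ _)) (s≤s r≤) =
      Bounded-+ ((c ∷ []) ∷ []) (point 𝔹.*ₚ Φ.eval r) (s≤s z≤n , tt)
                (Bounded-* point (Φ.eval r) point-bounded (Φ-bounded r r≤))
    Φ-bounded {zero} (c ∷ _ ∷ _) (s≤s ())

    -- The divided difference (r(a + f(a)S) - r(a)) / (f(a)S). Horner's recursion produces it in
    -- characteristic p, where the factorials of a Taylor formula may vanish.
    taylor : Poly → 𝔹.Poly
    taylor []                = []
    taylor (c ∷ [])          = []
    taylor (c ∷ r@(_ ∷ _))   = (r ∷ []) 𝔹.+ₚ point 𝔹.*ₚ taylor r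

    taylor-bounded : ∀ {m} c r → length r ℕ.≤ suc m → Bounded m (taylor (c ∷ r))
    taylor-bounded c []          _ = tt
    taylor-bounded c r@(_ ∷ []) r≤ = Bounded-+ (r ∷ []) (point 𝔹.*ₚ []) (r≤ , tt) (Bounded-*-[] point)
    taylor-bounded {suc m} c r@(c′ ∷ r′@(_ ∷ _)) (s≤s r≤) =
      Bounded-+ (r ∷ []) (point 𝔹.*ₚ taylor r) (s≤s r≤ , tt)
                (Bounded-* point (taylor r) point-bounded (taylor-bounded c′ r′ r≤))
    taylor-bounded {zero} c (_ ∷ _ ∷ _) (s≤s ())

    𝕗 : 𝔹.Poly
    𝕗 = f ∷ []

    point-as-sum : point 𝔹.≋ (X ∷ []) 𝔹.+ₚ 𝔹.X 𝔹.*ₚ 𝕗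
    point-as-sum = 𝔹.∷-as-sum X 𝕗

    Φ-taylor : ∀ r → Φ.eval r 𝔹.≋ (r ∷ []) 𝔹.+ₚ 𝔹.X 𝔹.*ₚ (𝕗 𝔹.*ₚ taylor r)
    Φ-taylor [] = begin
      []  ≈⟨ 𝔹.∷-zero ≋-refl 𝔹.≋-refl ⟨
      [] ∷ []  ≈⟨ 𝔹S.solve 3 (λ a x f → a :+ x :* (f :* num 0) := a) 𝔹.≋-refl ([] ∷ []) 𝔹.X 𝕗 ⟨
      ([] ∷ []) 𝔹.+ₚ 𝔹.X 𝔹.*ₚ (𝕗 𝔹.*ₚ [])  ∎
      where
      open SetoidReasoning 𝔹R.setoid
      open 𝔹S
    Φ-taylor (c ∷ []) =
      𝔹S.solve 4 (λ c y x f → c :+ y :* num 0 := c :+ x :* (f :* num 0)) 𝔹.≋-refl ((c ∷ []) ∷ []) point 𝔹.X 𝕗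
      where open 𝔹S
    Φ-taylor (c ∷ r@(_ ∷ _)) = begin
      κ (c ∷ []) 𝔹.+ₚ point 𝔹.*ₚ Φ.eval r
        ≈⟨ 𝔹.+ₚ-cong (𝔹.≋-refl {κ (c ∷ [])}) (𝔹R.*-cong point-as-sum (Φ-taylor r)) ⟩
      κ (c ∷ []) 𝔹.+ₚ (κ X 𝔹.+ₚ 𝔹.X 𝔹.*ₚ 𝕗) 𝔹.*ₚ (κ r 𝔹.+ₚ 𝔹.X 𝔹.*ₚ (𝕗 𝔹.*ₚ tᵣ))
        ≈⟨ 𝔹S.solve 6 (λ c a S f r T → c :+ (a :+ S :* f) :* (r :+ S :* (f :* T))
             := (c :+ a :* r) :+ S :* (f :* (r :+ (a :+ S :* f) :* T))) 𝔹.≋-refl (κ (c ∷ [])) (κ X) 𝔹.X 𝕗 (κ r) tᵣ ⟩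
      (κ (c ∷ []) 𝔹.+ₚ κ X 𝔹.*ₚ κ r) 𝔹.+ₚ 𝔹.X 𝔹.*ₚ (𝕗 𝔹.*ₚ (κ r 𝔹.+ₚ (κ X 𝔹.+ₚ 𝔹.X 𝔹.*ₚ 𝕗) 𝔹.*ₚ tᵣ))
        ≈⟨ 𝔹R.+-cong constant-term (𝔹R.*-congˡ (𝔹R.*-congˡ (𝔹R.+-congˡ (𝔹R.*-congʳ point-as-sum)))) ⟨
      κ (c ∷ r) 𝔹.+ₚ 𝔹.X 𝔹.*ₚ (𝕗 𝔹.*ₚ (κ r 𝔹.+ₚ point 𝔹.*ₚ tᵣ)) ∎
      where
      open SetoidReasoning 𝔹R.setoid
      open 𝔹S
      module C = Hom 𝔹.const
      κ = C.⟦_⟧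
      tᵣ = taylor r
      constant-term : κ (c ∷ r) 𝔹.≋ κ (c ∷ []) 𝔹.+ₚ κ X 𝔹.*ₚ κ r
      constant-term = 𝔹.≋-trans (C.⟦⟧-cong (∷-as-sum c r))
        (𝔹.≋-trans (C.+-homo (c ∷ []) (X *ₚ r)) (𝔹R.+-congˡ (C.*-homo X r)))

    -- The cofactor in f(a + f(a)S) = f(a) · `unit`. It has offset 0, so its e-th power has offset 0
    -- as well, however large e is; this is the gain from scaling S by f(a).
    unit : 𝔹.Poly
    unit = 𝔹R.1# 𝔹.+ₚ ([] ∷ taylor f)

    unit-bounded : Bounded 0 unit
    unit-bounded = Bounded-+ 𝔹R.1# ([] ∷ taylor f) (s≤s z≤n , tt) (z≤n , lemma f f≤)
      where
      lemma : ∀ f → length f ℕ.≤ suc (suc δ) → Bounded δ (taylor f)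
      lemma []      _        = tt
      lemma (c ∷ f) (s≤s f≤) = taylor-bounded c f f≤

    Φ-f : Φ.eval f 𝔹.≋ 𝕗 𝔹.*ₚ unit
    Φ-f = begin
      Φ.eval f  ≈⟨ Φ-taylor f ⟩
      𝕗 𝔹.+ₚ 𝔹.X 𝔹.*ₚ (𝕗 𝔹.*ₚ taylor f)  ≈⟨ 𝔹S.solve 3 (λ f S T → f :+ S :* (f :* T) := f :* (num 1 :+ S :* T)) 𝔹.≋-refl 𝕗 𝔹.X (taylor f) ⟩
      𝕗 𝔹.*ₚ (𝔹R.1# 𝔹.+ₚ 𝔹.X 𝔹.*ₚ taylor f)  ≈⟨ 𝔹R.*-congˡ (𝔹R.+-congˡ (𝔹.X-* (taylor f))) ⟩
      𝕗 𝔹.*ₚ unit  ∎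
      where
      open SetoidReasoning 𝔹R.setoid
      open 𝔹S

    -- The expansion of f(x)^e around a point a with f(a)^e = -1.
    𝔾 : 𝔹.Poly
    𝔾 = (- 1# ∷ []) 𝔹.· (unit ^₂ e)

    𝔾-bounded : Bounded 0 𝔾
    𝔾-bounded = Bounded-· (- 1# ∷ []) (unit ^₂ e) (s≤s z≤n) (Bounded-^ unit e unit-bounded)

    -- The image of `auxiliary l` under x = a + f(a)S, modulo S^q and after specialising a to a
    -- point with f(a)^e = -1: there x^q becomes a, which is the factor `X`, and f(x)^e becomes `𝔾`.
    expansion : List (Poly × Poly) → 𝔹.Poly
    expansion []            = []
    expansion ((r , s) ∷ l) = (Φ.eval r 𝔹.+ₚ Φ.eval s 𝔹.*ₚ 𝔾) 𝔹.+ₚ X 𝔹.· expansion l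

    auxiliary : List (Poly × Poly) → Poly
    auxiliary []            = []
    auxiliary ((r , s) ∷ l) = (r +ₚ s *ₚ f ^ₚ e) +ₚ X ^ₚ q *ₚ auxiliary l

    Short : ℕ → List (Poly × Poly) → Set
    Short b = All (λ (r , s) → length r ℕ.≤ suc b × length s ℕ.≤ suc b)

    expansion-bounded : ∀ {b} l → Short b l → Bounded (b ℕ.+ length l) (expansion l)
    expansion-bounded [] [] = tt
    expansion-bounded {b} ((r , s) ∷ l) ((r≤ , s≤) ∷ short) =
      Bounded-+ (Φ.eval r 𝔹.+ₚ Φ.eval s 𝔹.*ₚ 𝔾) (X 𝔹.· expansion l)
        (Bounded-mono (Φ.eval r 𝔹.+ₚ Φ.eval s 𝔹.*ₚ 𝔾) (ℕₚ.m≤m+n b _)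
          (Bounded-+ (Φ.eval r) (Φ.eval s 𝔹.*ₚ 𝔾) (Φ-bounded r r≤)
            (subst (λ k → Bounded k (Φ.eval s 𝔹.*ₚ 𝔾)) (ℕₚ.+-identityʳ b) (Bounded-* (Φ.eval s) 𝔾 (Φ-bounded s s≤) 𝔾-bounded))))
        (subst (λ k → Bounded k (X 𝔹.· expansion l)) (sym (ℕₚ.+-suc b (length l)))
          (Bounded-· X (expansion l) ℕₚ.≤-refl (expansion-bounded l short)))

    length-auxiliary : ∀ {b} x l → q ℕ.≤ b ℕ.+ e ℕ.* suc δ → Short b (x ∷ l) →
      length (auxiliary (x ∷ l)) ℕ.≤ suc (b ℕ.+ e ℕ.* suc δ ℕ.+ q ℕ.* length l)
    length-auxiliary {b} (r , s) l q≤ ((r≤ , s≤) ∷ short) =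
      length-+ (r +ₚ s *ₚ f ^ₚ e) (X ^ₚ q *ₚ auxiliary l)
        (ℕₚ.≤-trans (length-+ r (s *ₚ f ^ₚ e) (ℕₚ.≤-trans r≤ (s≤s (ℕₚ.m≤m+n b _))) (length-* s (f ^ₚ e) s≤ (length-^ f e f≤)))
          (s≤s (ℕₚ.m≤m+n _ (q ℕ.* length l))))
        (rest l short)
      where
      length-X^q : length (X ^ₚ q) ℕ.≤ suc q
      length-X^q = subst (λ k → length (X ^ₚ q) ℕ.≤ suc k) (ℕₚ.*-identityʳ q) (length-^ X q ℕₚ.≤-refl)
      D = b ℕ.+ e ℕ.* suc δ
      rest : ∀ l → Short b l → length (X ^ₚ q *ₚ auxiliary l) ℕ.≤ suc (D ℕ.+ q ℕ.* length l)
      -- Multiplying by the empty list leaves zeros behind, so the length is still only estimated by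
      -- q + 1; the hypothesis `q≤` absorbs this.
      rest []      _     = ℕₚ.≤-trans (length-* {n = 0} (X ^ₚ q) [] length-X^q z≤n)
        (s≤s (ℕₚ.≤-trans (ℕₚ.≤-reflexive (ℕₚ.+-identityʳ q)) (ℕₚ.≤-trans q≤ (ℕₚ.m≤m+n D _))))
      rest (y ∷ l) short = ℕₚ.≤-trans (length-* (X ^ₚ q) (auxiliary (y ∷ l)) length-X^q (length-auxiliary y l q≤ short))
        (ℕₚ.≤-reflexive (cong suc shuffle))
        where
        shuffle : q ℕ.+ (D ℕ.+ q ℕ.* length l) ≡ D ℕ.+ q ℕ.* suc (length l)
        shuffle = trans (sym (ℕₚ.+-assoc q D _)) (trans (cong (ℕ._+ q ℕ.* length l) (ℕₚ.+-comm q D))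
          (trans (ℕₚ.+-assoc D q _) (cong (D ℕ.+_) (sym (ℕₚ.*-suc q (length l))))))

    module At (α : Carrier) (c≢0 : value α f ≢ 0#) (fα^e : value α f ^ e ≡ - 1#) where
      c : Carrier
      c = value α f

      -- σ specialises a to α and renames S to X; τ is the substitution x = α + cX, and τ⁻ is its
      -- inverse.
      module σ = 𝔹.Evaluation {polyRing} (const ∘ₕ Value.evalHom α) X
      module σH = Hom σ.evalHom
      module τ = Evaluation {polyRing} const (α ∷ c ∷ [])
      module τH = Hom τ.evalHom
      module τ⁻ = Evaluation {polyRing} const ((c ⁻¹ ∷ []) *ₚ lin α)
      module τ⁻H = Hom τ⁻.evalHom
      module C = Hom const

      σ-const : ∀ r → σ.eval (r ∷ []) ≋ value α r ∷ []
      σ-const = σ.eval-const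

      σΦ≋τ : ∀ r → σ.eval (Φ.eval r) ≋ τ.eval r
      σΦ≋τ = hom-unique (σ.evalHom ∘ₕ Φ.evalHom) τ.evalHom
        (λ d → ≋-trans (σ.eval-cong (Φ.eval-const d)) (≋-trans (σ-const (d ∷ []))
          (≋-trans (∷-cong (Value.eval-const α d) ≋-refl) (≋-sym (τ.eval-const d)))))
        (≋-trans (σ.eval-cong Φ.eval-X) (≋-trans onPoint (≋-sym τ.eval-X)))
        where
        onPoint : σ.eval point ≋ α ∷ c ∷ []
        onPoint = begin
          σ.eval point  ≈⟨ σ.eval-cong point-as-sum ⟩
          σ.eval ((X ∷ []) 𝔹.+ₚ 𝔹.X 𝔹.*ₚ 𝕗)  ≈⟨ σ.eval-+ (X ∷ []) (𝔹.X 𝔹.*ₚ 𝕗) ⟩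
          σ.eval (X ∷ []) +ₚ σ.eval (𝔹.X 𝔹.*ₚ 𝕗)  ≈⟨ +ₚ-cong (σ-const X) (σ.eval-* 𝔹.X 𝕗) ⟩
          (value α X ∷ []) +ₚ σ.eval 𝔹.X *ₚ σ.eval 𝕗  ≈⟨ +ₚ-cong (∷-cong (Value.eval-X α) ≋-refl) (𝕏.*-cong σ.eval-X (σ-const f)) ⟩
          (α ∷ []) +ₚ X *ₚ (c ∷ [])  ≈⟨ ∷-as-sum α (c ∷ []) ⟨
          α ∷ c ∷ []  ∎
          where open 𝕏R

      -- The hypothesis on α enters here: the factor -1 of `𝔾` equals c^e, and c times the
      -- specialised `unit` is f(α + cX).
      σ𝔾≋τg : σ.eval 𝔾 ≋ τ.eval (f ^ₚ e)
      σ𝔾≋τg = begin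
        σ.eval 𝔾  ≈⟨ σ.eval-· (- 1# ∷ []) (unit ^₂ e) ⟩
        C.⟦ value α (- 1# ∷ []) ⟧ *ₚ σ.eval (unit ^₂ e)  ≈⟨ 𝕏.*-cong (C.⟦⟧-cong (trans (Value.eval-const α (- 1#)) (sym fα^e))) (σH.^-homo unit e) ⟩
        C.⟦ c ^ e ⟧ *ₚ σ.eval unit ^ₚ e  ≈⟨ 𝕏.*-congʳ (C.^-homo c e) ⟩
        C.⟦ c ⟧ ^ₚ e *ₚ σ.eval unit ^ₚ e  ≈⟨ ^ₚ-distrib-* C.⟦ c ⟧ (σ.eval unit) e ⟨
        (C.⟦ c ⟧ *ₚ σ.eval unit) ^ₚ e  ≈⟨ ^ₚ-congˡ e (𝕏.*-congʳ (σ-const f)) ⟨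
        (σ.eval 𝕗 *ₚ σ.eval unit) ^ₚ e  ≈⟨ ^ₚ-congˡ e (σ.eval-* 𝕗 unit) ⟨
        σ.eval (𝕗 𝔹.*ₚ unit) ^ₚ e  ≈⟨ ^ₚ-congˡ e (σ.eval-cong Φ-f) ⟨
        σ.eval (Φ.eval f) ^ₚ e  ≈⟨ ^ₚ-congˡ e (σΦ≋τ f) ⟩
        τ.eval f ^ₚ e  ≈⟨ τH.^-homo f e ⟨
        τ.eval (f ^ₚ e)  ∎
        where open 𝕏R

      τ-auxiliary : ∀ l → ∃ λ k → τ.eval (auxiliary l) ≋ σ.eval (expansion l) +ₚ X ^ₚ q *ₚ k
      τ-auxiliary [] = [] , ≋-sym (≋-trans (+ₚ-identityˡ _) (*ₚ-zeroʳ (X ^ₚ q)))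
      τ-auxiliary ((r , s) ∷ l) with τ-auxiliary l | frobenius-mod-X^q {p} {n} prime q≡pⁿ (α ∷ c ∷ [])
      ... | k , ih | k′ , frob = k′ *ₚ (σ.eval (expansion l) +ₚ X ^ₚ q *ₚ k) +ₚ (α ∷ []) *ₚ k , (begin
        τ.eval ((r +ₚ s *ₚ f ^ₚ e) +ₚ X ^ₚ q *ₚ auxiliary l)
          ≈⟨ τ.eval-+ (r +ₚ s *ₚ f ^ₚ e) (X ^ₚ q *ₚ auxiliary l) ⟩
        τ.eval (r +ₚ s *ₚ f ^ₚ e) +ₚ τ.eval (X ^ₚ q *ₚ auxiliary l)
          ≈⟨ +ₚ-cong (τ.eval-+ r (s *ₚ f ^ₚ e)) (τ.eval-* (X ^ₚ q) (auxiliary l)) ⟩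
        (τ.eval r +ₚ τ.eval (s *ₚ f ^ₚ e)) +ₚ τ.eval (X ^ₚ q) *ₚ τ.eval (auxiliary l)
          ≈⟨ +ₚ-cong (+ₚ-cong (≋-sym (σΦ≋τ r)) (≋-trans (τ.eval-* s (f ^ₚ e)) (𝕏.*-cong (≋-sym (σΦ≋τ s)) (≋-sym σ𝔾≋τg))))
                     (𝕏.*-cong (≋-trans (τH.^-homo X q) (≋-trans (^ₚ-congˡ q τ.eval-X) frob)) ih) ⟩
        (σ.eval (Φ.eval r) +ₚ σ.eval (Φ.eval s) *ₚ σ.eval 𝔾) +ₚ ((α ∷ []) +ₚ X ^ₚ q *ₚ k′) *ₚ (σ.eval (expansion l) +ₚ X ^ₚ q *ₚ k)
          ≈⟨ solve 6 (λ a α Q k′ E k → a :+ (α :+ Q :* k′) :* (E :+ Q :* k) := (a :+ α :* E) :+ Q :* (k′ :* (E :+ Q :* k) :+ α :* k)) ≋-refl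
               (σ.eval (Φ.eval r) +ₚ σ.eval (Φ.eval s) *ₚ σ.eval 𝔾) (α ∷ []) (X ^ₚ q) k′ (σ.eval (expansion l)) k ⟩
        ((σ.eval (Φ.eval r) +ₚ σ.eval (Φ.eval s) *ₚ σ.eval 𝔾) +ₚ (α ∷ []) *ₚ σ.eval (expansion l)) +ₚ X ^ₚ q *ₚ _
          ≈⟨ +ₚ-cong (+ₚ-cong (+ₚ-cong ≋-refl (≋-sym (σ.eval-* (Φ.eval s) 𝔾)))
                      (≋-sym (≋-trans (σ.eval-· X (expansion l)) (𝕏.*-congʳ (C.⟦⟧-cong (Value.eval-X α)))))) ≋-refl ⟩
        ((σ.eval (Φ.eval r) +ₚ σ.eval (Φ.eval s 𝔹.*ₚ 𝔾)) +ₚ σ.eval (X 𝔹.· expansion l)) +ₚ X ^ₚ q *ₚ _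
          ≈⟨ +ₚ-cong (≋-trans (σ.eval-+ _ (X 𝔹.· expansion l)) (+ₚ-cong (σ.eval-+ (Φ.eval r) (Φ.eval s 𝔹.*ₚ 𝔾)) ≋-refl)) ≋-refl ⟨
        σ.eval (expansion ((r , s) ∷ l)) +ₚ X ^ₚ q *ₚ _ ∎)
        where
        open 𝕏R
        open 𝕏S

      τ⁻τ : ∀ r → τ⁻.eval (τ.eval r) ≋ r
      τ⁻τ = hom-unique (τ⁻.evalHom ∘ₕ τ.evalHom) idₕ
        (λ d → ≋-trans (τ⁻.eval-cong (τ.eval-const d)) (τ⁻.eval-const d))
        (≋-trans (τ⁻.eval-cong τ.eval-X) (begin
          τ⁻.eval (α ∷ c ∷ [])  ≈⟨ τ⁻.eval-cong (∷-as-sum α (c ∷ [])) ⟩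
          τ⁻.eval ((α ∷ []) +ₚ X *ₚ (c ∷ []))  ≈⟨ τ⁻.eval-+ (α ∷ []) (X *ₚ (c ∷ [])) ⟩
          τ⁻.eval (α ∷ []) +ₚ τ⁻.eval (X *ₚ (c ∷ []))  ≈⟨ +ₚ-cong (τ⁻.eval-const α) (τ⁻.eval-* X (c ∷ [])) ⟩
          C.⟦ α ⟧ +ₚ τ⁻.eval X *ₚ τ⁻.eval (c ∷ [])  ≈⟨ +ₚ-cong ≋-refl (𝕏.*-cong τ⁻.eval-X (τ⁻.eval-const c)) ⟩
          C.⟦ α ⟧ +ₚ C.⟦ c ⁻¹ ⟧ *ₚ lin α *ₚ C.⟦ c ⟧  ≈⟨ +ₚ-cong ≋-refl (𝕏.*-congʳ (𝕏.*-congˡ (lin-as-difference α))) ⟩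
          C.⟦ α ⟧ +ₚ C.⟦ c ⁻¹ ⟧ *ₚ (X 𝕏.- C.⟦ α ⟧) *ₚ C.⟦ c ⟧
            ≈⟨ solve 4 (λ α d X c → α :+ d :* (X :- α) :* c := α :+ (c :* d) :* (X :- α)) ≋-refl C.⟦ α ⟧ C.⟦ c ⁻¹ ⟧ X C.⟦ c ⟧ ⟩
          C.⟦ α ⟧ +ₚ (C.⟦ c ⟧ *ₚ C.⟦ c ⁻¹ ⟧) *ₚ (X 𝕏.- C.⟦ α ⟧)  ≈⟨ +ₚ-cong ≋-refl (𝕏.*-congʳ (≋-trans (*ₚ-const c (c ⁻¹)) (C.⟦⟧-cong (⁻¹-inverse c c≢0)))) ⟩
          C.⟦ α ⟧ +ₚ 𝕏.1# *ₚ (X 𝕏.- C.⟦ α ⟧)  ≈⟨ solve 2 (λ α X → α :+ num 1 :* (X :- α) := X) ≋-refl C.⟦ α ⟧ X ⟩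
          X  ∎))
        where
        open 𝕏R
        open 𝕏S

      -- Undoing the substitution sends X to (X - α)/c, hence X^m to a multiple of (X - α)^m.
      X^∣τ⇒lin^∣ : ∀ m r → X ^ₚ m ∣ₚ τ.eval r → lin α ^ₚ m ∣ₚ r
      X^∣τ⇒lin^∣ m r (k , div) = C.⟦ c ⁻¹ ⟧ ^ₚ m *ₚ τ⁻.eval k , (begin
        r  ≈⟨ τ⁻τ r ⟨
        τ⁻.eval (τ.eval r)  ≈⟨ τ⁻.eval-cong div ⟩
        τ⁻.eval (X ^ₚ m *ₚ k)  ≈⟨ τ⁻.eval-* (X ^ₚ m) k ⟩
        τ⁻.eval (X ^ₚ m) *ₚ τ⁻.eval k  ≈⟨ 𝕏.*-congʳ (≋-trans (τ⁻H.^-homo X m) (^ₚ-congˡ m τ⁻.eval-X)) ⟩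
        (C.⟦ c ⁻¹ ⟧ *ₚ lin α) ^ₚ m *ₚ τ⁻.eval k  ≈⟨ 𝕏.*-congʳ (^ₚ-distrib-* C.⟦ c ⁻¹ ⟧ (lin α) m) ⟩
        (C.⟦ c ⁻¹ ⟧ ^ₚ m *ₚ lin α ^ₚ m) *ₚ τ⁻.eval k
          ≈⟨ 𝕏S.solve 3 (λ a b k → (a 𝕏S.:* b) 𝕏S.:* k 𝕏S.:= b 𝕏S.:* (a 𝕏S.:* k)) ≋-refl (C.⟦ c ⁻¹ ⟧ ^ₚ m) (lin α ^ₚ m) (τ⁻.eval k) ⟩
        lin α ^ₚ m *ₚ (C.⟦ c ⁻¹ ⟧ ^ₚ m *ₚ τ⁻.eval k)  ∎)
        where open 𝕏R

      -- The congruence modulo S^m specialises at α, and the discrepancy between expansion and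
      -- substitution is a multiple of X^q, harmless because m ≤ q.
      vanishing : ∀ m l l′ E → m ℕ.≤ q → expansion l 𝔹.≋ expansion l′ 𝔹.+ₚ 𝔹.X ^₂ m 𝔹.*ₚ E →
        lin α ^ₚ m ∣ₚ (auxiliary l 𝕏.- auxiliary l′)
      vanishing m l l′ E m≤q same with τ-auxiliary l | τ-auxiliary l′
      ... | k , τl | k′ , τl′ = X^∣τ⇒lin^∣ m (auxiliary l 𝕏.- auxiliary l′) (σ.eval E +ₚ X ^ₚ (q ℕ.∸ m) *ₚ (k 𝕏.- k′) , (begin
        τ.eval (auxiliary l 𝕏.- auxiliary l′)  ≈⟨ τ.eval-+ (auxiliary l) (-ₚ auxiliary l′) ⟩
        τ.eval (auxiliary l) +ₚ τ.eval (-ₚ auxiliary l′)  ≈⟨ +ₚ-cong τl (≋-trans (τH.-‿homo (auxiliary l′)) (𝕏.-‿cong τl′)) ⟩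
        (σ.eval (expansion l) +ₚ X ^ₚ q *ₚ k) 𝕏.- (σ.eval (expansion l′) +ₚ X ^ₚ q *ₚ k′)
          ≈⟨ +ₚ-cong (+ₚ-cong (≋-trans (σ.eval-cong same) (≋-trans (σ.eval-+ (expansion l′) (𝔹.X ^₂ m 𝔹.*ₚ E))
                (+ₚ-cong ≋-refl (≋-trans (σ.eval-* (𝔹.X ^₂ m) E) (𝕏.*-congʳ (≋-trans (σH.^-homo 𝔹.X m) (^ₚ-congˡ m σ.eval-X)))))))
              ≋-refl) ≋-refl ⟩
        ((σ.eval (expansion l′) +ₚ X ^ₚ m *ₚ σ.eval E) +ₚ X ^ₚ q *ₚ k) 𝕏.- (σ.eval (expansion l′) +ₚ X ^ₚ q *ₚ k′)
          ≈⟨ solve 6 (λ A M E Q k k′ → ((A :+ M :* E) :+ Q :* k) :- (A :+ Q :* k′) := M :* E :+ Q :* (k :- k′)) ≋-refl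
               (σ.eval (expansion l′)) (X ^ₚ m) (σ.eval E) (X ^ₚ q) k k′ ⟩
        X ^ₚ m *ₚ σ.eval E +ₚ X ^ₚ q *ₚ (k 𝕏.- k′)
          ≈⟨ +ₚ-cong ≋-refl (𝕏.*-congʳ (≋-trans (𝕏.reflexive (cong (X ^ₚ_) (sym (ℕₚ.m+[n∸m]≡n m≤q)))) (^ₚ-homo-* X m (q ℕ.∸ m)))) ⟩
        X ^ₚ m *ₚ σ.eval E +ₚ (X ^ₚ m *ₚ X ^ₚ (q ℕ.∸ m)) *ₚ (k 𝕏.- k′)
          ≈⟨ solve 4 (λ M E N k → M :* E :+ (M :* N) :* k := M :* (E :+ N :* k)) ≋-refl (X ^ₚ m) (σ.eval E) (X ^ₚ (q ℕ.∸ m)) (k 𝕏.- k′) ⟩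
        X ^ₚ m *ₚ (σ.eval E +ₚ X ^ₚ (q ℕ.∸ m) *ₚ (k 𝕏.- k′)) ∎))
        where
        open 𝕏R
        open 𝕏S

    -- The number of scalars in the coefficients of S^0, ..., S^(M-1) of a polynomial that is
    -- `Bounded m`: i-th summand m + iδ + 1.
    conditions : ℕ → ℕ → ℕ
    conditions zero    m = 0
    conditions (suc M) m = suc m ℕ.+ conditions M (m ℕ.+ δ)

    head₂ : 𝔹.Poly → Poly
    head₂ F = 𝔹.coeff F 0

    tail₂ : 𝔹.Poly → 𝔹.Poly
    tail₂ []      = []
    tail₂ (c ∷ F) = F

    head∷tail : ∀ F → F 𝔹.≋ head₂ F ∷ tail₂ F
    head∷tail []      = 𝔹.≋-sym (𝔹.∷-zero ≋-refl 𝔹.≋-refl)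
    head∷tail (c ∷ F) = 𝔹.≋-refl

    low-coefficients : ∀ M m → 𝔹.Poly → Fin (conditions M m) → Carrier
    low-coefficients (suc M) m F i =
      [ (λ j → coeff (head₂ F) (toℕ j)) , low-coefficients M (m ℕ.+ δ) (tail₂ F) ]′ (splitAt (suc m) i)

    head₂-bounded : ∀ {m} F → Bounded m F → length (head₂ F) ℕ.≤ suc m
    head₂-bounded []      _       = z≤n
    head₂-bounded (c ∷ F) (c≤ , _) = c≤

    tail₂-bounded : ∀ {m} F → Bounded m F → Bounded (m ℕ.+ δ) (tail₂ F)
    tail₂-bounded []      _       = tt
    tail₂-bounded (c ∷ F) (_ , b) = b

    low-coefficients-determine : ∀ M {m} F G → Bounded m F → Bounded m G →
      low-coefficients M m F ≗ low-coefficients M m G → ∃ λ E → F 𝔹.≋ G 𝔹.+ₚ 𝔹.X ^₂ M 𝔹.*ₚ E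
    low-coefficients-determine zero F G _ _ _ = F 𝔹R.- G ,
      𝔹S.solve 2 (λ F G → F :=  G :+ num 1 :* (F :- G)) 𝔹.≋-refl F G
      where open 𝔹S
    low-coefficients-determine (suc M) {m} F G bF bG same
      with low-coefficients-determine M (tail₂ F) (tail₂ G) (tail₂-bounded F bF) (tail₂-bounded G bG)
             (λ i → trans (sym (later F i)) (trans (same (suc m ↑ʳ i)) (later G i)))
      where
      later : ∀ F i → low-coefficients (suc M) m F (suc m ↑ʳ i) ≡ low-coefficients M (m ℕ.+ δ) (tail₂ F) i
      later F i rewrite Finₚ.splitAt-↑ʳ (suc m) (conditions M (m ℕ.+ δ)) i = refl
    ... | E , tails = E , (begin
      F  ≈⟨ head∷tail F ⟩
      head₂ F ∷ tail₂ F  ≈⟨ 𝔹.∷-cong heads tails ⟩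
      head₂ G ∷ (tail₂ G 𝔹.+ₚ 𝔹.X ^₂ M 𝔹.*ₚ E)  ≈⟨ 𝔹.∷-as-sum (head₂ G) _ ⟩
      κ 𝔹.+ₚ 𝔹.X 𝔹.*ₚ (tail₂ G 𝔹.+ₚ 𝔹.X ^₂ M 𝔹.*ₚ E)
        ≈⟨ solve 5 (λ h x T xᴹ E → h :+ x :* (T :+ xᴹ :* E) := (h :+ x :* T) :+ (x :* xᴹ) :* E) 𝔹.≋-refl κ 𝔹.X (tail₂ G) (𝔹.X ^₂ M) E ⟩
      (κ 𝔹.+ₚ 𝔹.X 𝔹.*ₚ tail₂ G) 𝔹.+ₚ 𝔹.X ^₂ suc M 𝔹.*ₚ E  ≈⟨ 𝔹.+ₚ-cong (𝔹.≋-trans (head∷tail G) (𝔹.∷-as-sum (head₂ G) (tail₂ G))) 𝔹.≋-refl ⟨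
      G 𝔹.+ₚ 𝔹.X ^₂ suc M 𝔹.*ₚ E  ∎)
      where
      open SetoidReasoning 𝔹R.setoid
      open 𝔹S
      κ = head₂ G ∷ []
      first : ∀ F j → low-coefficients (suc M) m F (j ↑ˡ _) ≡ coeff (head₂ F) (toℕ j)
      first F j rewrite Finₚ.splitAt-↑ˡ (suc m) j (conditions M (m ℕ.+ δ)) = refl
      heads : head₂ F ≋ head₂ G
      heads = coeffwise λ i → at i (i ℕₚ.<? suc m)
        where
        at : ∀ i → _ → coeff (head₂ F) i ≡ coeff (head₂ G) i
        at i (yes i<) = subst (λ i → coeff (head₂ F) i ≡ coeff (head₂ G) i) (Finₚ.toℕ-fromℕ< i<)
          (trans (sym (first F (Fin.fromℕ< i<))) (trans (same (Fin.fromℕ< i< ↑ˡ _)) (first G (Fin.fromℕ< i<))))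
        at i (no i≮) = trans (coeff-beyond (head₂ F) (ℕₚ.≤-trans (head₂-bounded F bF) (ℕₚ.≮⇒≥ i≮)))
          (sym (coeff-beyond (head₂ G) (ℕₚ.≤-trans (head₂-bounded G bG) (ℕₚ.≮⇒≥ i≮))))

    module Independence (f0≡1 : coeff f 0 ≡ 1#) (nonsquare : ∀ r s → r *ₚ r *ₚ f ≋ s *ₚ s → r ≋ [] × s ≋ [])
                        (b : ℕ) (b-small : b ℕ.+ b ℕ.+ suc δ ℕ.< q) where

      g²f≋f^q : f ^ₚ e *ₚ f ^ₚ e *ₚ f ≋ f ^ₚ q
      g²f≋f^q = ≋-trans (𝕏.*-comm (f ^ₚ e *ₚ f ^ₚ e) f) (≋-trans (𝕏.*-congˡ (≋-sym (^ₚ-homo-* f e e)))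
        (𝕏.reflexive (cong (f ^ₚ_) (sym q≡1+2e))))

      -- Modulo X^q one has r = -s f^e, hence r² f = s² f^(2e+1) = s² f^q = s², the last step
      -- because f(0) = 1. Both sides have degree below q, so the equation is exact and contradicts
      -- `nonsquare` unless r and s vanish.
      lowest-zero : ∀ r s k → length r ℕ.≤ suc b → length s ℕ.≤ suc b →
        (r +ₚ s *ₚ f ^ₚ e) +ₚ X ^ₚ q *ₚ k ≋ [] → r ≋ [] × s ≋ []
      lowest-zero r s k r≤ s≤ zero-sum with frobenius-mod-X^q {p} {n} prime q≡pⁿ f
      ... | k₂ , frob = nonsquare r s (≋-mod-X^ {q} (s *ₚ s *ₚ k₂ 𝕏.- k *ₚ (r 𝕏.- s *ₚ g) *ₚ f)
          (ℕₚ.≤-trans (length-* (r *ₚ r) f (length-* r r r≤ r≤) f≤) b-small)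
          (ℕₚ.≤-trans (length-* s s s≤ s≤) (ℕₚ.≤-trans (s≤s (ℕₚ.m≤m+n (b ℕ.+ b) _)) b-small)) (begin
        r *ₚ r *ₚ f
          ≈⟨ solve 6 (λ r s g f Q k → r :* r :* f := ((r :+ s :* g) :+ Q :* k) :* (r :- s :* g) :* f :+ (s :* s :* (g :* g :* f) :- Q :* (k :* (r :- s :* g) :* f)))
               ≋-refl r s g f Q k ⟩
        ((r +ₚ s *ₚ g) +ₚ Q *ₚ k) *ₚ (r 𝕏.- s *ₚ g) *ₚ f +ₚ (s *ₚ s *ₚ (g *ₚ g *ₚ f) 𝕏.- Q *ₚ (k *ₚ (r 𝕏.- s *ₚ g) *ₚ f))
          ≈⟨ +ₚ-cong (𝕏.*-congʳ (𝕏.*-congʳ zero-sum)) (+ₚ-cong (𝕏.*-congˡ (≋-trans g²f≋f^q (≋-trans frob (+ₚ-cong (∷-cong f0≡1 ≋-refl) ≋-refl)))) ≋-refl) ⟩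
        [] *ₚ (r 𝕏.- s *ₚ g) *ₚ f +ₚ (s *ₚ s *ₚ (𝕏.1# +ₚ Q *ₚ k₂) 𝕏.- Q *ₚ (k *ₚ (r 𝕏.- s *ₚ g) *ₚ f))
          ≈⟨ solve 7 (λ r s g f Q k k₂ → num 0 :* (r :- s :* g) :* f :+ (s :* s :* (num 1 :+ Q :* k₂) :- Q :* (k :* (r :- s :* g) :* f))
               := s :* s :+ Q :* (s :* s :* k₂ :- k :* (r :- s :* g) :* f)) ≋-refl r s g f Q k k₂ ⟩
        s *ₚ s +ₚ Q *ₚ (s *ₚ s *ₚ k₂ 𝕏.- k *ₚ (r 𝕏.- s *ₚ g) *ₚ f) ∎))
        where
        open 𝕏R
        open 𝕏S
        g = f ^ₚ e
        Q = X ^ₚ q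

      unknowns : ℕ → ℕ
      unknowns zero    = 0
      unknowns (suc J) = suc b ℕ.+ (suc b ℕ.+ unknowns J)

      first second : ∀ J → (Fin (unknowns (suc J)) → Carrier) → Fin (suc b) → Carrier
      first  J v i = v (i ↑ˡ (suc b ℕ.+ unknowns J))
      second J v i = v (suc b ↑ʳ (i ↑ˡ unknowns J))

      rest : ∀ J → (Fin (unknowns (suc J)) → Carrier) → Fin (unknowns J) → Carrier
      rest J v i = v (suc b ↑ʳ (suc b ↑ʳ i))

      decode : ∀ J → (Fin (unknowns J) → Carrier) → List (Poly × Poly)
      decode zero    v = []
      decode (suc J) v = (List.tabulate (first J v) , List.tabulate (second J v)) ∷ decode J (rest J v)

      length-decode : ∀ J v → length (decode J v) ≡ J
      length-decode zero    v = refl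
      length-decode (suc J) v = cong suc (length-decode J (rest J v))

      tabulate-≤ : ∀ (h : Fin (suc b) → Carrier) → length (List.tabulate h) ℕ.≤ suc b
      tabulate-≤ h = ℕₚ.≤-reflexive (length-tabulate h)

      decode-short : ∀ J v → Short b (decode J v)
      decode-short zero    v = []
      decode-short (suc J) v = (tabulate-≤ (first J v) , tabulate-≤ (second J v)) ∷ decode-short J (rest J v)

      tabulate-injective : ∀ {m} (g h : Fin m → Carrier) → List.tabulate g ≋ List.tabulate h → g ≗ h
      tabulate-injective g h e zero    = coeff-≈ e 0
      tabulate-injective g h e (suc i) = tabulate-injective (g ∘ suc) (h ∘ suc) (tail-≋ e) i

      private
        components-agree : ∀ J v w → List.tabulate (first J v) ≋ List.tabulate (first J w) →
          List.tabulate (second J v) ≋ List.tabulate (second J w) → rest J v ≗ rest J w → v ≗ w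
        components-agree J v w firsts seconds rests i =
          subst (λ i → v i ≡ w i) (Finₚ.join-splitAt (suc b) (suc b ℕ.+ unknowns J) i) (cases (splitAt (suc b) i))
          where
          cases₂ : ∀ x → v (suc b ↑ʳ Fin.join (suc b) (unknowns J) x) ≡ w (suc b ↑ʳ Fin.join (suc b) (unknowns J) x)
          cases₂ (inj₁ j) = tabulate-injective (second J v) (second J w) seconds j
          cases₂ (inj₂ j) = rests j
          cases : ∀ x → v (Fin.join (suc b) (suc b ℕ.+ unknowns J) x) ≡ w (Fin.join (suc b) (suc b ℕ.+ unknowns J) x)
          cases (inj₁ j) = tabulate-injective (first J v) (first J w) firsts j
          cases (inj₂ j) = subst (λ j → v (suc b ↑ʳ j) ≡ w (suc b ↑ʳ j)) (Finₚ.join-splitAt (suc b) (unknowns J) j)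
                                 (cases₂ (splitAt (suc b) j))

        length-difference : ∀ (g h : Fin (suc b) → Carrier) → length (List.tabulate g 𝕏.- List.tabulate h) ℕ.≤ suc b
        length-difference g h = length-+ (List.tabulate g) (-ₚ List.tabulate h) (tabulate-≤ g)
          (ℕₚ.≤-trans (ℕₚ.≤-reflexive (length-neg (List.tabulate h))) (tabulate-≤ h))

        separate : ∀ r r′ s s′ A A′ → length (r 𝕏.- r′) ℕ.≤ suc b → length (s 𝕏.- s′) ℕ.≤ suc b →
          (r +ₚ s *ₚ f ^ₚ e) +ₚ X ^ₚ q *ₚ A ≋ (r′ +ₚ s′ *ₚ f ^ₚ e) +ₚ X ^ₚ q *ₚ A′ →
          r ≋ r′ × s ≋ s′ × A ≋ A′
        separate r r′ s s′ A A′ r≤ s≤ same = conclude (lowest-zero (r 𝕏.- r′) (s 𝕏.- s′) (A 𝕏.- A′) r≤ s≤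
          (≋-trans (solve 8 (λ r r′ s s′ g Q A A′ → ((r :- r′) :+ (s :- s′) :* g) :+ Q :* (A :- A′)
              := ((r :+ s :* g) :+ Q :* A) :- ((r′ :+ s′ :* g) :+ Q :* A′)) ≋-refl r r′ s s′ (f ^ₚ e) (X ^ₚ q) A A′)
            (minus-≋-zero same)))
          where
          open 𝕏S
          conclude : r 𝕏.- r′ ≋ [] × s 𝕏.- s′ ≋ [] → r ≋ r′ × s ≋ s′ × A ≋ A′
          conclude (r≋ , s≋) = ≋-minus-zero r≋ , ≋-minus-zero s≋ , ≋-minus-zero (X^-*-cancel q (≋-trans
            (solve 4 (λ a Q A A′ → Q :* (A :- A′) := (a :+ Q :* A) :- (a :+ Q :* A′)) ≋-refl (r +ₚ s *ₚ f ^ₚ e) (X ^ₚ q) A A′)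
            (minus-≋-zero (≋-trans same
              (+ₚ-cong (+ₚ-cong (≋-sym (≋-minus-zero r≋)) (𝕏.*-congʳ (≋-sym (≋-minus-zero s≋)))) ≋-refl)))))

      -- `lowest-zero`, applied to differences, identifies the blocks with j = 0; after cancelling
      -- X^q the next block is the lowest one.
      decode-injective : ∀ J v w → auxiliary (decode J v) ≋ auxiliary (decode J w) → v ≗ w
      decode-injective zero    v w same ()
      decode-injective (suc J) v w same = conclude (separate (List.tabulate (first J v)) (List.tabulate (first J w))
          (List.tabulate (second J v)) (List.tabulate (second J w)) (auxiliary (decode J (rest J v))) (auxiliary (decode J (rest J w)))
          (length-difference (first J v) (first J w)) (length-difference (second J v) (second J w)) same)
        where
        conclude : _ → v ≗ w
        conclude (firsts , seconds , rests) =
          components-agree J v w firsts seconds (decode-injective J (rest J v) (rest J w) rests)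

      -- Two distinct coefficient vectors share all low coefficients of their expansions. The
      -- difference h of their auxiliary polynomials is nonzero by independence and vanishes to
      -- order M on Z, so its degree bounds |Z| · M.
      stepanov : ∀ M J → M ℕ.≤ q → 1 ℕ.< q → q ℕ.≤ b ℕ.+ e ℕ.* suc δ →
        conditions M (b ℕ.+ suc J) ℕ.< unknowns (suc J) →
        ∀ Z → Unique Z → All (λ α → value α f ≢ 0# × value α f ^ e ≡ - 1#) Z →
        length Z ℕ.* M ℕ.≤ b ℕ.+ e ℕ.* suc δ ℕ.+ q ℕ.* J
      stepanov M J M≤q 1<q q≤ underdetermined Z uniq nonresidues
        with collision 1<q underdetermined (λ v → low-coefficients M (b ℕ.+ suc J) (expansion (decode (suc J) v)))
      ... | v , w , v≢w , same
        with low-coefficients-determine M (expansion (decode (suc J) v)) (expansion (decode (suc J) w)) (bounded v) (bounded w) same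
        where
        bounded : ∀ v → Bounded (b ℕ.+ suc J) (expansion (decode (suc J) v))
        bounded v = subst (λ k → Bounded (b ℕ.+ k) (expansion (decode (suc J) v))) (length-decode (suc J) v)
                          (expansion-bounded (decode (suc J) v) (decode-short (suc J) v))
      ... | E , congruent = ℕₚ.≤-pred (ℕₚ.≤-trans
          (roots-with-multiplicity M h Z (λ h≋0 → v≢w (decode-injective (suc J) v w (≋-minus-zero h≋0))) uniq
            (All.map (λ {α} (c≢0 , fα^e) → At.vanishing α c≢0 fα^e M (decode (suc J) v) (decode (suc J) w) E M≤q congruent) nonresidues))
          (length-+ (auxiliary (decode (suc J) v)) (-ₚ auxiliary (decode (suc J) w)) (short v)
            (ℕₚ.≤-trans (ℕₚ.≤-reflexive (length-neg (auxiliary (decode (suc J) w)))) (short w))))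
        where
        h : Poly
        h = auxiliary (decode (suc J) v) 𝕏.- auxiliary (decode (suc J) w)
        short : ∀ v → length (auxiliary (decode (suc J) v)) ℕ.≤ suc (b ℕ.+ e ℕ.* suc δ ℕ.+ q ℕ.* J)
        short v = subst (λ j → length (auxiliary (decode (suc J) v)) ℕ.≤ suc (b ℕ.+ e ℕ.* suc δ ℕ.+ q ℕ.* j)) (length-decode J (rest J v))
          (length-auxiliary (List.tabulate (first J v) , List.tabulate (second J v)) (decode J (rest J v)) q≤ (decode-short (suc J) v))

-- Quadratic extensions and the quadratic character

-- K[ω]/(ω² - βω - γ), not necessarily a field; (a , b) stands for a + bω.
module QuadraticExtension {q : ℕ} (K : FiniteField q) (β γ : FiniteField.Carrier K) where
  open FiniteField K
  open FieldTheory K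
  open FieldPolynomials K
  open 𝔽S

  Quad : Set
  Quad = Carrier × Carrier

  infixl 6 _⊕_
  infixl 7 _⊗_
  _⊕_ _⊗_ : Quad → Quad → Quad
  (a , b) ⊕ (c , d) = a + c , b + d
  (a , b) ⊗ (c , d) = a * c + γ * (b * d) , a * d + b * c + β * (b * d)

  quadRing : Ring
  quadRing = record
    { Carrier = Quad ; _≈_ = _≡_ ; _+_ = _⊕_ ; _*_ = _⊗_ ; -_ = λ (a , b) → - a , - b ; 0# = 0# , 0# ; 1# = 1# , 0#
    ; isCommutativeRing = record
      { isRing = record
        { +-isAbelianGroup = record
          { isGroup = record
            { isMonoid = record
              { isSemigroup = record
                { isMagma = record { isEquivalence = ≡.isEquivalence ; ∙-cong = cong₂ _⊕_ }
                ; assoc = λ _ _ _ → cong₂ _,_ (𝔽.+-assoc _ _ _) (𝔽.+-assoc _ _ _) }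
              ; identity = (λ _ → cong₂ _,_ (𝔽.+-identityˡ _) (𝔽.+-identityˡ _)) , λ _ → cong₂ _,_ (𝔽.+-identityʳ _) (𝔽.+-identityʳ _) }
            ; inverse = (λ _ → cong₂ _,_ (𝔽.-‿inverseˡ _) (𝔽.-‿inverseˡ _)) , λ _ → cong₂ _,_ (𝔽.-‿inverseʳ _) (𝔽.-‿inverseʳ _)
            ; ⁻¹-cong = cong (λ (a , b) → - a , - b) }
          ; comm = λ _ _ → cong₂ _,_ (𝔽.+-comm _ _) (𝔽.+-comm _ _) }
        ; *-cong = cong₂ _⊗_
        ; *-assoc = λ (a , b) (c , d) (e , f) → cong₂ _,_
            (solve 8 (λ a b c d e f β γ →
                 (a :* c :+ γ :* (b :* d)) :* e :+ γ :* ((a :* d :+ b :* c :+ β :* (b :* d)) :* f)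
              := a :* (c :* e :+ γ :* (d :* f)) :+ γ :* (b :* (c :* f :+ d :* e :+ β :* (d :* f)))) refl a b c d e f β γ)
            (solve 8 (λ a b c d e f β γ →
                 (a :* c :+ γ :* (b :* d)) :* f :+ (a :* d :+ b :* c :+ β :* (b :* d)) :* e :+ β :* ((a :* d :+ b :* c :+ β :* (b :* d)) :* f)
              := a :* (c :* f :+ d :* e :+ β :* (d :* f)) :+ b :* (c :* e :+ γ :* (d :* f)) :+ β :* (b :* (c :* f :+ d :* e :+ β :* (d :* f))))
              refl a b c d e f β γ)
        ; *-identity = (λ x → one x) , λ x → trans (⊗-comm x _) (one x)
        ; distrib = dist , λ x y z → trans (⊗-comm (y ⊕ z) x) (trans (dist x y z) (cong₂ _⊕_ (⊗-comm x y) (⊗-comm x z))) }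
      ; *-comm = ⊗-comm } }
    where
    ⊗-comm : ∀ x y → x ⊗ y ≡ y ⊗ x
    ⊗-comm (a , b) (c , d) = cong₂ _,_
      (solve 5 (λ a b c d γ → a :* c :+ γ :* (b :* d) := c :* a :+ γ :* (d :* b)) refl a b c d γ)
      (solve 5 (λ a b c d β → a :* d :+ b :* c :+ β :* (b :* d) := c :* b :+ d :* a :+ β :* (d :* b)) refl a b c d β)
    one : ∀ x → (1# , 0#) ⊗ x ≡ x
    one (a , b) = cong₂ _,_
      (solve 3 (λ a b γ → num 1 :* a :+ γ :* (num 0 :* b) := a) refl a b γ)
      (solve 3 (λ a b β → num 1 :* b :+ num 0 :* a :+ β :* (num 0 :* b) := b) refl a b β)
    dist : ∀ x y z → x ⊗ (y ⊕ z) ≡ x ⊗ y ⊕ x ⊗ z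
    dist (a , b) (c , d) (e , f) = cong₂ _,_
      (solve 7 (λ a b c d e f γ → a :* (c :+ e) :+ γ :* (b :* (d :+ f)) := (a :* c :+ γ :* (b :* d)) :+ (a :* e :+ γ :* (b :* f))) refl a b c d e f γ)
      (solve 7 (λ a b c d e f β → a :* (d :+ f) :+ b :* (c :+ e) :+ β :* (b :* (d :+ f))
         := (a :* d :+ b :* c :+ β :* (b :* d)) :+ (a :* f :+ b :* e :+ β :* (b :* f))) refl a b c d e f β)

  module 𝕃 = CommutativeRing quadRing

  inclusion : Hom fieldRing quadRing
  inclusion = record
    { ⟦_⟧ = λ a → a , 0# ; ⟦⟧-cong = cong (_, 0#)
    ; +-homo = λ _ _ → cong (_ ,_) (sym (𝔽.+-identityʳ 0#))
    ; *-homo = λ a b → cong₂ _,_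
        (solve 3 (λ a b γ → a :* b := a :* b :+ γ :* (num 0 :* num 0)) refl a b γ)
        (solve 3 (λ a b β → num 0 := a :* num 0 :+ num 0 :* b :+ β :* (num 0 :* num 0)) refl a b β)
    ; 1-homo = refl }

  ω : Quad
  ω = 0# , 1#

  module Atω = Evaluation {quadRing} inclusion ω

  ω-⊗ : ∀ a b → ω ⊗ (a , b) ≡ (γ * b , a + β * b)
  ω-⊗ a b = cong₂ _,_
    (solve 3 (λ a b γ → num 0 :* a :+ γ :* (num 1 :* b) := γ :* b) refl a b γ)
    (solve 3 (λ a b β → num 0 :* b :+ num 1 :* a :+ β :* (num 1 :* b) := a :+ β :* b) refl a b β)

  atω-∷ : ∀ c p → Atω.eval (c ∷ p) ≡ (c + γ * proj₂ (Atω.eval p) , proj₁ (Atω.eval p) + β * proj₂ (Atω.eval p))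
  atω-∷ c p = trans (cong ((c , 0#) ⊕_) (ω-⊗ (proj₁ (Atω.eval p)) (proj₂ (Atω.eval p)))) (cong (c + γ * proj₂ (Atω.eval p) ,_) (𝔽.+-identityˡ _))

  minimal : Poly
  minimal = - γ ∷ - β ∷ 1# ∷ []

  minimal-as-sum : minimal ≋ X *ₚ X 𝕏.- ((β ∷ []) *ₚ X +ₚ (γ ∷ []))
  minimal-as-sum = ≋-sym (begin
    X *ₚ X 𝕏.- ((β ∷ []) *ₚ X +ₚ (γ ∷ []))
      ≈⟨ 𝕏S.solve 3 (λ X β γ → X 𝕏S.:* X 𝕏S.:- (β 𝕏S.:* X 𝕏S.:+ γ) 𝕏S.:= 𝕏S.:- γ 𝕏S.:+ X 𝕏S.:* (𝕏S.:- β 𝕏S.:+ X 𝕏S.:* 𝕏S.num 1)) ≋-refl X C.⟦ β ⟧ C.⟦ γ ⟧ ⟩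
    -ₚ C.⟦ γ ⟧ +ₚ X *ₚ (-ₚ C.⟦ β ⟧ +ₚ X *ₚ (1# ∷ []))
      ≈⟨ +ₚ-cong (C.-‿homo γ) (*ₚ-congˡ X (+ₚ-cong (C.-‿homo β) ≋-refl)) ⟨
    C.⟦ - γ ⟧ +ₚ X *ₚ (C.⟦ - β ⟧ +ₚ X *ₚ (1# ∷ []))
      ≈⟨ +ₚ-cong ≋-refl (*ₚ-congˡ X (∷-as-sum (- β) (1# ∷ []))) ⟨
    C.⟦ - γ ⟧ +ₚ X *ₚ (- β ∷ 1# ∷ [])
      ≈⟨ ∷-as-sum (- γ) (- β ∷ 1# ∷ []) ⟨
    minimal ∎)
    where
    open 𝕏R
    module C = Hom const

  minimal-≉0 : minimal ≉0
  minimal-≉0 e = 0≢1 (sym (coeff-≈ e 2))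

  division : ∀ p → ∃ λ k → p ≋ minimal *ₚ k +ₚ (proj₁ (Atω.eval p) ∷ proj₂ (Atω.eval p) ∷ []) × length k ≡ length p ℕ.∸ 2
  division [] = [] , ≋-sym (≋-trans (+ₚ-cong (*ₚ-zeroʳ minimal) (∷-zero refl (∷-zero refl ≋-refl))) (+ₚ-identityˡ _)) , refl
  division (c ∷ []) = [] , ≋-sym (≋-trans (+ₚ-cong (*ₚ-zeroʳ minimal) (∷-cong first (∷-zero second ≋-refl))) (+ₚ-identityˡ _)) , refl
    where
    first : proj₁ (Atω.eval (c ∷ [])) ≡ c
    first = trans (cong proj₁ (atω-∷ c [])) (solve 2 (λ c γ → c :+ γ :* num 0 := c) refl c γ)
    second : proj₂ (Atω.eval (c ∷ [])) ≡ 0#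
    second = trans (cong proj₂ (atω-∷ c [])) (solve 1 (λ β → num 0 :+ β :* num 0 := num 0) refl β)
  division (c ∷ d ∷ []) = [] , ≋-sym (≋-trans (+ₚ-cong (*ₚ-zeroʳ minimal)
      (∷-cong (trans (cong proj₁ at-cd) (solve 3 (λ c β γ → c :+ γ :* (num 0 :+ β :* num 0) := c) refl c β γ))
        (∷-cong (trans (cong proj₂ at-cd) (solve 3 (λ d β γ → (d :+ γ :* num 0) :+ β :* (num 0 :+ β :* num 0) := d) refl d β γ)) ≋-refl))) (+ₚ-identityˡ _)) , refl
    where
    at-cd : Atω.eval (c ∷ d ∷ []) ≡ (c + γ * (0# + β * 0#) , (d + γ * 0#) + β * (0# + β * 0#))
    at-cd = trans (atω-∷ c (d ∷ [])) (cong (λ (a , b) → c + γ * b , a + β * b) (atω-∷ d []))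
  division (c ∷ r@(_ ∷ _ ∷ _)) with division r
  ... | k , r≋ , len = b ∷ k , (begin
    c ∷ r  ≈⟨ ∷-as-sum c r ⟩
    C.⟦ c ⟧ +ₚ X *ₚ r  ≈⟨ +ₚ-cong ≋-refl (*ₚ-congˡ X (≋-trans r≋ (+ₚ-cong (*ₚ-congʳ k minimal-as-sum) (linear a b)))) ⟩
    C.⟦ c ⟧ +ₚ X *ₚ ((X *ₚ X 𝕏.- (C.⟦ β ⟧ *ₚ X +ₚ C.⟦ γ ⟧)) *ₚ k +ₚ (C.⟦ a ⟧ +ₚ X *ₚ C.⟦ b ⟧))
      ≈⟨ 𝕏S.solve 7 (λ c X β γ k a b → c 𝕏S.:+ X 𝕏S.:* ((X 𝕏S.:* X 𝕏S.:- (β 𝕏S.:* X 𝕏S.:+ γ)) 𝕏S.:* k 𝕏S.:+ (a 𝕏S.:+ X 𝕏S.:* b))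
           𝕏S.:= (X 𝕏S.:* X 𝕏S.:- (β 𝕏S.:* X 𝕏S.:+ γ)) 𝕏S.:* (b 𝕏S.:+ X 𝕏S.:* k) 𝕏S.:+ ((c 𝕏S.:+ γ 𝕏S.:* b) 𝕏S.:+ X 𝕏S.:* (a 𝕏S.:+ β 𝕏S.:* b)))
           ≋-refl C.⟦ c ⟧ X C.⟦ β ⟧ C.⟦ γ ⟧ k C.⟦ a ⟧ C.⟦ b ⟧ ⟩
    (X *ₚ X 𝕏.- (C.⟦ β ⟧ *ₚ X +ₚ C.⟦ γ ⟧)) *ₚ (C.⟦ b ⟧ +ₚ X *ₚ k) +ₚ ((C.⟦ c ⟧ +ₚ C.⟦ γ ⟧ *ₚ C.⟦ b ⟧) +ₚ X *ₚ (C.⟦ a ⟧ +ₚ C.⟦ β ⟧ *ₚ C.⟦ b ⟧))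
      ≈⟨ +ₚ-cong (𝕏.*-cong minimal-as-sum (∷-as-sum b k))
           (≋-trans (linear (c + γ * b) (a + β * b)) (+ₚ-cong (affine c γ b) (*ₚ-congˡ X (affine a β b)))) ⟨
    minimal *ₚ (b ∷ k) +ₚ (c + γ * b ∷ a + β * b ∷ [])
      ≡⟨ cong (λ (a , b) → minimal *ₚ (proj₂ (Atω.eval r) ∷ k) +ₚ (a ∷ b ∷ [])) (atω-∷ c r) ⟨
    minimal *ₚ (b ∷ k) +ₚ (proj₁ (Atω.eval (c ∷ r)) ∷ proj₂ (Atω.eval (c ∷ r)) ∷ []) ∎) , cong suc len
    where
    open 𝕏R
    module C = Hom const
    a = proj₁ (Atω.eval r)
    b = proj₂ (Atω.eval r)
    linear : ∀ a b → a ∷ b ∷ [] ≋ C.⟦ a ⟧ +ₚ X *ₚ C.⟦ b ⟧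
    linear a b = ∷-as-sum a (b ∷ [])
    affine : ∀ c γ b → C.⟦ c + γ * b ⟧ ≋ C.⟦ c ⟧ +ₚ C.⟦ γ ⟧ *ₚ C.⟦ b ⟧
    affine c γ b = ≋-trans (C.+-homo c (γ * b)) (+ₚ-cong ≋-refl (C.*-homo γ b))

  vanishing⇒minimal∣ : ∀ p → Atω.eval p ≡ 𝕃.0# → ∃ λ k → p ≋ minimal *ₚ k × length k ≡ length p ℕ.∸ 2
  vanishing⇒minimal∣ p e with division p
  ... | k , p≋ , len = k , ≋-trans p≋ (≋-trans (+ₚ-cong ≋-refl (∷-zero (cong proj₁ e) (∷-zero (cong proj₂ e) ≋-refl))) (+ₚ-identityʳ _)) , len

  minimal-at-ω : Atω.eval minimal ≡ 𝕃.0#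
  minimal-at-ω = trans (atω-∷ (- γ) (- β ∷ 1# ∷ [])) (trans (cong (λ (a , b) → - γ + γ * b , a + β * b) step)
    (cong₂ _,_
      (solve 2 (λ β γ → :- γ :+ γ :* ((num 1 :+ γ :* num 0) :+ β :* (num 0 :+ β :* num 0)) := num 0) refl β γ)
      (solve 2 (λ β γ → (:- β :+ γ :* (num 0 :+ β :* num 0)) :+ β :* ((num 1 :+ γ :* num 0) :+ β :* (num 0 :+ β :* num 0)) := num 0) refl β γ)))
    where
    step : Atω.eval (- β ∷ 1# ∷ []) ≡ (- β + γ * (0# + β * 0#) , (1# + γ * 0#) + β * (0# + β * 0#))
    step = trans (atω-∷ (- β) (1# ∷ [])) (cong (λ (a , b) → - β + γ * b , a + β * b) (atω-∷ 1# []))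

  norm : Quad → Carrier
  norm (a , b) = a * a + β * (a * b) - γ * (b * b)

  Regular : Quad → Set
  Regular z = ∀ y → y ⊗ z ≡ 𝕃.0# → y ≡ 𝕃.0#

  -- Multiplying y z = 0 by the conjugate, obtained from ω ↦ β - ω, gives norm z · y = 0.
  norm≢0⇒regular : ∀ z → norm z ≢ 0# → Regular z
  norm≢0⇒regular z@(a , b) N≢0 y@(c , d) yz≡0 = cong₂ _,_ (vanish (trans times-norm₁ (cong proj₁ times-conj)))
      (vanish (trans times-norm₂ (cong proj₂ times-conj)))
    where
    conj : Quad
    conj = a + β * b , - b
    times-conj : (y ⊗ z) ⊗ conj ≡ 𝕃.0#
    times-conj = trans (cong (_⊗ conj) yz≡0) (𝕃.zeroˡ conj)
    times-norm₁ : norm z * c ≡ proj₁ ((y ⊗ z) ⊗ conj)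
    times-norm₁ = solve 6 (λ a b c d β γ → (a :* a :+ β :* (a :* b) :- γ :* (b :* b)) :* c
      := (c :* a :+ γ :* (d :* b)) :* (a :+ β :* b) :+ γ :* ((c :* b :+ d :* a :+ β :* (d :* b)) :* (:- b))) refl a b c d β γ
    times-norm₂ : norm z * d ≡ proj₂ ((y ⊗ z) ⊗ conj)
    times-norm₂ = solve 6 (λ a b c d β γ → (a :* a :+ β :* (a :* b) :- γ :* (b :* b)) :* d
      := (c :* a :+ γ :* (d :* b)) :* (:- b) :+ (c :* b :+ d :* a :+ β :* (d :* b)) :* (a :+ β :* b) :+ β :* ((c :* b :+ d :* a :+ β :* (d :* b)) :* (:- b)))
      refl a b c d β γ
    vanish : ∀ {x} → norm z * x ≡ 0# → x ≡ 0#
    vanish {x} e = *-cancelˡ N≢0 (trans e (sym (𝔽.zeroʳ (norm z))))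

  regular-⊗ : ∀ {z w} → Regular z → Regular w → Regular (z ⊗ w)
  regular-⊗ {z} {w} z-reg w-reg y e = z-reg y (w-reg (y ⊗ z) (trans (𝕃.*-assoc y z w) e))

  module Reduced (discriminant≢0 : β * β + (1# + 1# + 1# + 1#) * γ ≢ 0#) where

    -- K[ω] is reduced when the discriminant is nonzero: the discriminant times b⁴ is a combination
    -- of the two coordinates of z².
    square-zero : ∀ z → z ⊗ z ≡ 𝕃.0# → z ≡ 𝕃.0#
    square-zero (a , b) e = cong₂ _,_ a≡0 b≡0
      where
      e₁ : a * a + γ * (b * b) ≡ 0#
      e₁ = cong proj₁ e
      e₂ : a * b + b * a + β * (b * b) ≡ 0#
      e₂ = cong proj₂ e
      disc-b⁴ : (β * β + (1# + 1# + 1# + 1#) * γ) * (b * b * (b * b)) ≡ 0#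
      disc-b⁴ = trans (solve 4 (λ a b β γ → (β :* β :+ num 4 :* γ) :* (b :* b :* (b :* b))
          := num 4 :* (b :* b) :* (a :* a :+ γ :* (b :* b)) :- (a :* b :+ b :* a :+ β :* (b :* b)) :* (num 2 :* (a :* b) :- β :* (b :* b))) refl a b β γ)
        (trans (cong₂ (λ x y → (1# + 1# + 1# + 1#) * (b * b) * x - y * ((1# + 1#) * (a * b) - β * (b * b))) e₁ e₂)
          (solve 3 (λ a b β → num 4 :* (b :* b) :* num 0 :- num 0 :* (num 2 :* (a :* b) :- β :* (b :* b)) := num 0) refl a b β))
      b≡0 : b ≡ 0#
      b≡0 with b ≟ 0#
      ... | yes b≡0 = b≡0
      ... | no b≢0  = contradiction disc-b⁴ (*-≢0 discriminant≢0 (*-≢0 (*-≢0 b≢0 b≢0) (*-≢0 b≢0 b≢0)))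
      a≡0 : a ≡ 0#
      a≡0 with a ≟ 0#
      ... | yes a≡0 = a≡0
      ... | no a≢0  = contradiction (trans (trans (solve 2 (λ a γ → a :* a := a :* a :+ γ :* (num 0 :* num 0)) refl a γ)
                        (cong (λ x → a * a + γ * (x * x)) (sym b≡0))) e₁) (*-≢0 a≢0 a≢0)

    -- minimal divides s², hence s, hence r² k, hence r; dividing r and s by it yields a smaller solution.
    minimal-*-nonsquare : ∀ k → Regular (Atω.eval k) → ∀ m r s → length s ℕ.≤ m → r *ₚ r *ₚ (minimal *ₚ k) ≋ s *ₚ s → s ≋ []
    minimal-*-nonsquare k k-reg m r [] _ _ = ≋-refl
    minimal-*-nonsquare k k-reg (suc m) r s@(_ ∷ s₀) (s≤s s₀≤m) e = conclude (vanishing⇒minimal∣ s s-at-ω)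
      where
      s-at-ω : Atω.eval s ≡ 𝕃.0#
      s-at-ω = square-zero (Atω.eval s) (begin
        Atω.eval s ⊗ Atω.eval s  ≡⟨ Atω.eval-* s s ⟨
        Atω.eval (s *ₚ s)  ≡⟨ Atω.eval-cong e ⟨
        Atω.eval (r *ₚ r *ₚ (minimal *ₚ k))  ≡⟨ Atω.eval-* (r *ₚ r) (minimal *ₚ k) ⟩
        Atω.eval (r *ₚ r) ⊗ Atω.eval (minimal *ₚ k)  ≡⟨ cong (_ ⊗_) (trans (Atω.eval-* minimal k) (trans (cong (_⊗ Atω.eval k) minimal-at-ω) (𝕃.zeroˡ _))) ⟩
        Atω.eval (r *ₚ r) ⊗ 𝕃.0#  ≡⟨ 𝕃.zeroʳ _ ⟩
        𝕃.0#  ∎)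
        where open ≡-Reasoning
      conclude : (∃ λ s′ → s ≋ minimal *ₚ s′ × length s′ ≡ length s ℕ.∸ 2) → s ≋ []
      conclude (s′ , s≋ , len) = conclude₂ (vanishing⇒minimal∣ r r-at-ω)
        where
        e₁ : r *ₚ r *ₚ k ≋ minimal *ₚ (s′ *ₚ s′)
        e₁ = *ₚ-cancelˡ minimal minimal-≉0 (≋-trans
          (𝕏S.solve 3 (λ m r k → m 𝕏S.:* (r 𝕏S.:* r 𝕏S.:* k) 𝕏S.:= r 𝕏S.:* r 𝕏S.:* (m 𝕏S.:* k)) ≋-refl minimal r k)
          (≋-trans e (≋-trans (𝕏.*-cong s≋ s≋)
            (𝕏S.solve 2 (λ m s → (m 𝕏S.:* s) 𝕏S.:* (m 𝕏S.:* s) 𝕏S.:= m 𝕏S.:* (m 𝕏S.:* (s 𝕏S.:* s))) ≋-refl minimal s′))))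
        r-at-ω : Atω.eval r ≡ 𝕃.0#
        r-at-ω = square-zero (Atω.eval r) (k-reg _ (begin
          (Atω.eval r ⊗ Atω.eval r) ⊗ Atω.eval k  ≡⟨ trans (Atω.eval-* (r *ₚ r) k) (cong (_⊗ Atω.eval k) (Atω.eval-* r r)) ⟨
          Atω.eval (r *ₚ r *ₚ k)  ≡⟨ Atω.eval-cong e₁ ⟩
          Atω.eval (minimal *ₚ (s′ *ₚ s′))  ≡⟨ Atω.eval-* minimal (s′ *ₚ s′) ⟩
          Atω.eval minimal ⊗ Atω.eval (s′ *ₚ s′)  ≡⟨ cong (_⊗ Atω.eval (s′ *ₚ s′)) minimal-at-ω ⟩
          𝕃.0# ⊗ Atω.eval (s′ *ₚ s′)  ≡⟨ 𝕃.zeroˡ _ ⟩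
          𝕃.0#  ∎))
          where open ≡-Reasoning
        conclude₂ : (∃ λ r′ → r ≋ minimal *ₚ r′ × length r′ ≡ length r ℕ.∸ 2) → s ≋ []
        conclude₂ (r′ , r≋ , _) = ≋-trans s≋ (≋-trans (*ₚ-congˡ minimal s′≋[]) (*ₚ-zeroʳ minimal))
          where
          e₂ : r′ *ₚ r′ *ₚ (minimal *ₚ k) ≋ s′ *ₚ s′
          e₂ = *ₚ-cancelˡ minimal minimal-≉0 (≋-trans
            (𝕏S.solve 3 (λ m r k → m 𝕏S.:* (r 𝕏S.:* r 𝕏S.:* (m 𝕏S.:* k)) 𝕏S.:= (m 𝕏S.:* r) 𝕏S.:* (m 𝕏S.:* r) 𝕏S.:* k) ≋-refl minimal r′ k)
            (≋-trans (𝕏.*-congʳ (𝕏.*-cong (≋-sym r≋) (≋-sym r≋))) e₁))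
          s′≋[] : s′ ≋ []
          s′≋[] = minimal-*-nonsquare k k-reg m r′ s′
            (ℕₚ.≤-trans (ℕₚ.≤-reflexive len) (ℕₚ.≤-trans (ℕₚ.m∸n≤m (length s₀) 1) s₀≤m)) e₂

    nonsquare : ∀ {f} k → f ≋ minimal *ₚ k → f ≉0 → Regular (Atω.eval k) →
      ∀ r s → r *ₚ r *ₚ f ≋ s *ₚ s → r ≋ [] × s ≋ []
    nonsquare {f} k f≋ f≉0 k-reg r s e = r≋[] , s≋[]
      where
      s≋[] : s ≋ []
      s≋[] = minimal-*-nonsquare k k-reg (length s) r s ℕₚ.≤-refl (≋-trans (𝕏.*-congˡ (≋-sym f≋)) e)
      r²≋[] : r *ₚ r ≋ []
      r²≋[] = *ₚ-zero⇒ʳ f f≉0 (≋-trans (𝕏.*-comm f (r *ₚ r)) (≋-trans e (≋-trans (*ₚ-congˡ s s≋[]) (*ₚ-zeroʳ s))))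
      r≋[] : r ≋ []
      r≋[] = square-root-zero r r²≋[]
        where
        square-root-zero : ∀ r → r *ₚ r ≋ [] → r ≋ []
        square-root-zero []      _ = ≋-refl
        square-root-zero (c ∷ r) e with c ≟ 0#
        ... | no c≢0   = *ₚ-zero⇒ʳ (c ∷ r) (λ z → c≢0 (coeff-≈ z 0)) e
        ... | yes refl = ∷-zero refl (square-root-zero r (tail-zero (tail-zero
              (≋-trans (≋-sym (≋-trans (shift-*ₚ r (0# ∷ r)) (∷-cong refl (≋-trans (*ₚ-comm r (0# ∷ r)) (shift-*ₚ r r))))) e))))

-- The quadratic character when q ≡ 3 mod 8

module QuadraticCharacter {q : ℕ} (K : FiniteField q) {p n : ℕ} (prime : Prime p) (q≡pⁿ : q ≡ p ℕ.^ n)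
                          (m : ℕ) (q≡3+8m : q ≡ 3 ℕ.+ 8 ℕ.* m) where
  open FiniteField K
  open FieldTheory K
  open Characteristic {p} {n} prime q≡pⁿ
  open 𝔽S

  e : ℕ
  e = 1 ℕ.+ 4 ℕ.* m

  q≡1+2e : q ≡ suc (e ℕ.+ e)
  q≡1+2e = trans q≡3+8m (ℕS.solve 1 (λ m → ℕS.con 3 ℕS.:+ ℕS.con 8 ℕS.:* m
      ℕS.:= ℕS.con 1 ℕS.:+ ((ℕS.con 1 ℕS.:+ ℕS.con 4 ℕS.:* m) ℕS.:+ (ℕS.con 1 ℕS.:+ ℕS.con 4 ℕS.:* m))) refl m)
    where module ℕS = +-*-Solver

  private
    open QuadraticExtension K 0# (- 1#)
    module L^ = Exp 𝕃.commutativeSemiring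
    module L× = Multᵤ 𝕃.semiring
    module I = Hom inclusion
    open L^ using () renaming (_^_ to _^ₗ_)

    rotate : ∀ a b → ω ⊗ (a , b) ≡ (- b , a)
    rotate a b = trans (ω-⊗ a b) (cong₂ _,_
      (solve 1 (λ b → :- num 1 :* b := :- b) refl b) (solve 2 (λ a b → a :+ num 0 :* b := a) refl a b))

    i² : ω ⊗ ω ≡ (- 1# , 0#)
    i² = rotate 0# 1#

    i³ : ω ⊗ (ω ⊗ ω) ≡ (0# , - 1#)
    i³ = trans (cong (ω ⊗_) i²) (trans (rotate (- 1#) 0#) (cong (_, - 1#) -0#≈0#))

    i⁴ : ω ^ₗ 4 ≡ 𝕃.1#
    i⁴ = trans (cong (λ x → ω ⊗ (ω ⊗ (ω ⊗ x))) (𝕃.*-identityʳ ω))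
      (trans (cong (ω ⊗_) i³) (trans (rotate 0# (- 1#)) (cong (_, 0#) (-‿involutive 1#))))

    1^ : ∀ k → 𝕃.1# ^ₗ k ≡ 𝕃.1#
    1^ zero    = refl
    1^ (suc k) = trans (𝕃.*-identityˡ _) (1^ k)

    i^e : ω ^ₗ e ≡ ω
    i^e = trans (cong (ω ⊗_) (trans (sym (L^.^-assocʳ ω 4 m)) (trans (L^.^-congˡ m i⁴) (1^ m)))) (𝕃.*-identityʳ ω)

    ^-q : ∀ x → x ^ₗ q ≡ x ⊗ (x ⊗ x) ^ₗ e
    ^-q x = trans (cong (x ^ₗ_) q≡1+2e) (cong (x ⊗_) (trans (L^.^-homo-* x e e) (sym (L^.^-distrib-* x x e))))

    i^q : ω ^ₗ q ≡ (0# , - 1#)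
    i^q = trans (^-q ω) (trans (cong (ω ⊗_) (trans (L^.^-distrib-* ω ω e) (cong₂ _⊗_ i^e i^e))) i³)

    char-L : p L×.× 𝕃.1# ≡ 𝕃.0#
    char-L = trans (lemma p) (cong (_, 0#) char)
      where
      lemma : ∀ k → k L×.× 𝕃.1# ≡ I.⟦ k ×ᶠ 1# ⟧
      lemma zero    = refl
      lemma (suc k) = trans (cong (𝕃.1# ⊕_) (lemma k)) (sym (I.+-homo 1# (k ×ᶠ 1#)))

    [1+i]^q : (𝕃.1# ⊕ ω) ^ₗ q ≡ 𝕃.1# ⊕ (0# , - 1#)
    [1+i]^q = trans (subst (λ k → (𝕃.1# ⊕ ω) ^ₗ k ≡ 𝕃.1# ^ₗ k ⊕ ω ^ₗ k) (sym q≡pⁿ)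
                      (Frobenius.frobenius-^ quadRing prime char-L n 𝕃.1# ω))
                    (cong₂ _⊕_ (1^ q) i^q)

    [1+i]² : (𝕃.1# ⊕ ω) ⊗ (𝕃.1# ⊕ ω) ≡ I.⟦ 1# + 1# ⟧ ⊗ ω
    [1+i]² = cong₂ _,_
      (solve 0 ((num 1 :+ num 0) :* (num 1 :+ num 0) :+ (:- num 1) :* ((num 0 :+ num 1) :* (num 0 :+ num 1))
             := num 2 :* num 0 :+ (:- num 1) :* (num 0 :* num 1)) refl)
      (solve 0 ((num 1 :+ num 0) :* (num 0 :+ num 1) :+ (num 0 :+ num 1) :* (num 1 :+ num 0) :+ num 0 :* ((num 0 :+ num 1) :* (num 0 :+ num 1))
             := num 2 :* num 1 :+ num 0 :* num 0 :+ num 0 :* (num 0 :* num 1)) refl)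

  -- Comparing (1 + i)^q = 1 - i with (1 + i)(2i)^e in K[i].
  2^e≡-1 : (1# + 1#) ^ e ≡ - 1#
  2^e≡-1 = trans (sym (-‿involutive c)) (cong -_ (sym (begin
    1#  ≡⟨ 𝔽.+-identityʳ 1# ⟨
    proj₁ (𝕃.1# ⊕ (0# , - 1#))  ≡⟨ cong proj₁ [1+i]^q ⟨
    proj₁ ((𝕃.1# ⊕ ω) ^ₗ q)  ≡⟨ cong proj₁ (^-q (𝕃.1# ⊕ ω)) ⟩
    proj₁ ((𝕃.1# ⊕ ω) ⊗ ((𝕃.1# ⊕ ω) ⊗ (𝕃.1# ⊕ ω)) ^ₗ e)
      ≡⟨ cong (λ x → proj₁ ((𝕃.1# ⊕ ω) ⊗ x)) (trans (L^.^-congˡ e [1+i]²) (trans (L^.^-distrib-* I.⟦ 1# + 1# ⟧ ω e)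
           (cong₂ _⊗_ (sym (I.^-homo (1# + 1#) e)) i^e))) ⟩
    proj₁ ((𝕃.1# ⊕ ω) ⊗ (I.⟦ c ⟧ ⊗ ω))
      ≡⟨ solve 1 (λ c → (num 1 :+ num 0) :* (c :* num 0 :+ (:- num 1) :* (num 0 :* num 1))
                        :+ (:- num 1) :* ((num 0 :+ num 1) :* (c :* num 1 :+ num 0 :* num 0 :+ num 0 :* (num 0 :* num 1)))
                   := :- c) refl c ⟩
    - c ∎)))
    where
    open ≡-Reasoning
    c = (1# + 1#) ^ e

  1^-field : ∀ k → 1# ^ k ≡ 1#
  1^-field zero    = refl
  1^-field (suc k) = trans (𝔽.*-identityˡ _) (1^-field k)

  [-1]^e : (- 1#) ^ e ≡ - 1#
  [-1]^e = trans (cong (- 1# *_) (trans (sym (^-assocʳ (- 1#) 4 m)) (trans (^-congˡ m fourth) (1^-field m)))) (𝔽.*-identityʳ _)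
    where
    fourth : (- 1#) ^ 4 ≡ 1#
    fourth = solve 0 ((:- num 1) :^ 4 := num 1) refl

  neg-^e : ∀ x → (- x) ^ e ≡ - (x ^ e)
  neg-^e x = trans (cong (_^ e) (solve 1 (λ x → :- x := :- num 1 :* x) refl x))
    (trans (^-distrib-* (- 1#) x e) (trans (cong (_* x ^ e) [-1]^e) (solve 1 (λ x → :- num 1 :* x := :- x) refl (x ^ e))))

  ^-2e : ∀ {x} → x ≢ 0# → x ^ e * x ^ e ≡ 1#
  ^-2e {x} x≢0 = *-cancelˡ x≢0 (trans (cong (x *_) (sym (^-homo-* x e e)))
    (trans (cong (x ^_) (sym q≡1+2e)) (trans (fermat x) (sym (𝔽.*-identityʳ x)))))

  -- As e is odd, (e + 1)/2 = 1 + 2m is an integer, and the power of x with this exponent squares to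
  -- x · x^e = x.
  ^e≡1⇒square : ∀ {x} → x ^ e ≡ 1# → Square⁺ x
  ^e≡1⇒square {x} x^e≡1 = y , ^-≢0 (1 ℕ.+ 2 ℕ.* m) x≢0 , trans (sym (^-homo-* x (1 ℕ.+ 2 ℕ.* m) (1 ℕ.+ 2 ℕ.* m)))
      (trans (cong (x ^_) exponent) (trans (cong (x *_) x^e≡1) (𝔽.*-identityʳ x)))
    where
    module ℕS = +-*-Solver
    y = x ^ (1 ℕ.+ 2 ℕ.* m)
    x≢0 : x ≢ 0#
    x≢0 refl = 0≢1 (trans (sym (𝔽.zeroˡ _)) x^e≡1)
    exponent : 1 ℕ.+ 2 ℕ.* m ℕ.+ (1 ℕ.+ 2 ℕ.* m) ≡ suc e
    exponent = ℕS.solve 1 (λ m → ℕS.con 1 ℕS.:+ ℕS.con 2 ℕS.:* m ℕS.:+ (ℕS.con 1 ℕS.:+ ℕS.con 2 ℕS.:* m)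
      ℕS.:= ℕS.con 1 ℕS.:+ (ℕS.con 1 ℕS.:+ ℕS.con 4 ℕS.:* m)) refl m

  square⇒^e≡1 : ∀ {x} → Square⁺ x → x ^ e ≡ 1#
  square⇒^e≡1 (y , y≢0 , refl) = trans (^-distrib-* y y e) (^-2e y≢0)

  ^e-dichotomy : ∀ {x} → x ≢ 0# → x ^ e ≡ 1# ⊎ x ^ e ≡ - 1#
  ^e-dichotomy {x} x≢0 with *-zero⇒ {x ^ e - 1#} {x ^ e + 1#}
      (trans (solve 1 (λ y → (y :- num 1) :* (y :+ num 1) := y :* y :- num 1) refl (x ^ e))
             (trans (cong (_- 1#) (^-2e x≢0)) (𝔽.-‿inverseʳ 1#)))
  ... | inj₁ y-1≡0 = inj₁ (-‿zero⇒≡ y-1≡0)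
  ... | inj₂ y+1≡0 = inj₂ (-‿zero⇒≡ (trans (cong (x ^ e +_) (-‿involutive 1#)) y+1≡0))

  square-or-neg : ∀ {x} → x ≢ 0# → Square⁺ x ⊎ Square⁺ (- x)
  square-or-neg {x} x≢0 with ^e-dichotomy x≢0
  ... | inj₁ x^e≡1  = inj₁ (^e≡1⇒square x^e≡1)
  ... | inj₂ x^e≡-1 = inj₂ (^e≡1⇒square (trans (neg-^e x) (trans (cong -_ x^e≡-1) (-‿involutive 1#))))

  square-≢0 : ∀ {x} → Square⁺ x → x ≢ 0#
  square-≢0 (y , y≢0 , refl) = *-≢0 y≢0 y≢0

  square-* : ∀ {x y} → Square⁺ x → Square⁺ y → Square⁺ (x * y)
  square-* (a , a≢0 , refl) (b , b≢0 , refl) = a * b , *-≢0 a≢0 b≢0 ,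
    solve 2 (λ a b → (a :* b) :* (a :* b) := (a :* a) :* (b :* b)) refl a b

  2≢0 : 1# + 1# ≢ 0#
  2≢0 2≡0 = neg-≢0 (0≢1 ∘ sym) (trans (sym 2^e≡-1) (trans (cong (_^ e) 2≡0) (𝔽.zeroˡ _)))

  1≢-1 : 1# ≢ - 1#
  1≢-1 1≡-1 = 2≢0 (trans (cong (1# +_) 1≡-1) (𝔽.-‿inverseʳ 1#))

  ¬square-neg : ∀ {x} → Square⁺ x → ¬ Square⁺ (- x)
  ¬square-neg {x} sq sq′ = 1≢-1 (trans (sym (square⇒^e≡1 sq′)) (trans (neg-^e x) (cong -_ (square⇒^e≡1 sq))))

  square[-2] : Square⁺ (- (1# + 1#))
  square[-2] = ^e≡1⇒square (trans (neg-^e (1# + 1#)) (trans (cong -_ 2^e≡-1) (-‿involutive 1#)))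

-- Products of the four quadratics

𝟙 : Bool → ℕ
𝟙 true  = 1
𝟙 false = 0

module DoubleCounting {A : Set} where

  count : (A → Bool) → List A → ℕ
  count f L = sum (map (λ x → 𝟙 (f x)) L)

  count-filter : ∀ {P : A → Set} (P? : ∀ x → Dec (P x)) L → count (λ x → does (P? x)) L ≡ length (filter P? L)
  count-filter P? []      = refl
  count-filter P? (x ∷ L) with does (P? x)
  ... | true  = cong suc (count-filter P? L)
  ... | false = count-filter P? L

  counts : ∀ {B : Set} → (B → A → Bool) → List B → List A → ℕ
  counts f S L = sum (map (λ s → count (f s) L) S)

  multiplicity : ∀ {B : Set} → (B → A → Bool) → List B → A → ℕ
  multiplicity f S x = sum (map (λ s → 𝟙 (f s x)) S)

  counts-∷ : ∀ {B : Set} (f : B → A → Bool) S x L → counts f S (x ∷ L) ≡ multiplicity f S x ℕ.+ counts f S L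
  counts-∷ f []      x L = refl
  counts-∷ f (s ∷ S) x L = trans (cong (count (f s) (x ∷ L) ℕ.+_) (counts-∷ f S x L))
    (solve 4 (λ a b c d → (a :+ b) :+ (c :+ d) := (a :+ c) :+ (b :+ d)) refl (𝟙 (f s x)) (count (f s) L) (multiplicity f S x) (counts f S L))
    where open +-*-Solver

  counts-[] : ∀ {B : Set} (f : B → A → Bool) S → counts f S [] ≡ 0
  counts-[] f []      = refl
  counts-[] f (s ∷ S) = counts-[] f S

  -- The summand k · 𝟙 (z x) makes the hypothesis automatic at exceptional points, which are paid
  -- for in the total.
  double-count : ∀ {B : Set} (f : B → A → Bool) (z : A → Bool) S k →
    (∀ x → k ℕ.≤ multiplicity f S x ℕ.+ k ℕ.* 𝟙 (z x)) →
    ∀ L → k ℕ.* length L ℕ.≤ counts f S L ℕ.+ k ℕ.* count z L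
  double-count f z S k h []      = ℕₚ.≤-trans (ℕₚ.≤-reflexive (ℕₚ.*-zeroʳ k)) z≤n
  double-count f z S k h (x ∷ L) = begin
    k ℕ.* suc (length L)  ≡⟨ ℕₚ.*-suc k (length L) ⟩
    k ℕ.+ k ℕ.* length L  ≤⟨ ℕₚ.+-mono-≤ (h x) (double-count f z S k h L) ⟩
    (multiplicity f S x ℕ.+ k ℕ.* 𝟙 (z x)) ℕ.+ (counts f S L ℕ.+ k ℕ.* count z L)
      ≡⟨ solve 5 (λ a k b c d → (a :+ k :* b) :+ (c :+ k :* d) := (a :+ c) :+ k :* (b :+ d)) refl
           (multiplicity f S x) k (𝟙 (z x)) (counts f S L) (count z L) ⟩
    (multiplicity f S x ℕ.+ counts f S L) ℕ.+ k ℕ.* count z (x ∷ L) ≡⟨ cong (ℕ._+ _) (counts-∷ f S x L) ⟨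
    counts f S (x ∷ L) ℕ.+ k ℕ.* count z (x ∷ L)  ∎
    where
    open ℕₚ.≤-Reasoning
    open +-*-Solver

Subset : Set
Subset = Bool × Bool × Bool × Bool

nonempty-subsets : List Subset
nonempty-subsets = List.drop 1 (List.cartesianProduct bools (List.cartesianProduct bools (List.cartesianProduct bools bools)))
  where bools = false ∷ true ∷ []

size : Subset → ℕ
size (a , b , c , d) = 𝟙 a ℕ.+ (𝟙 b ℕ.+ (𝟙 c ℕ.+ 𝟙 d))

parity : Subset → Subset → Bool
parity (a , b , c , d) (a′ , b′ , c′ , d′) = (a ∧ a′) xor ((b ∧ b′) xor ((c ∧ c′) xor (d ∧ d′)))

open DoubleCounting

-- For σ ≠ 0 the parity is a nonzero linear form on the sixteen vectors of F₂⁴, so it equals 1 on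
-- half of them, and never on the zero vector.
odd-intersections : ∀ σ → σ ≢ (false , false , false , false) → sum (map (λ S → 𝟙 (parity S σ)) nonempty-subsets) ≡ 8
odd-intersections (false , false , false , false) σ≢ = contradiction refl σ≢
odd-intersections (false , false , false , true ) _ = refl
odd-intersections (false , false , true  , false) _ = refl
odd-intersections (false , false , true  , true ) _ = refl
odd-intersections (false , true  , false , false) _ = refl
odd-intersections (false , true  , false , true ) _ = refl
odd-intersections (false , true  , true  , false) _ = refl
odd-intersections (false , true  , true  , true ) _ = refl
odd-intersections (true  , false , false , false) _ = refl
odd-intersections (true  , false , false , true ) _ = refl
odd-intersections (true  , false , true  , false) _ = refl
odd-intersections (true  , false , true  , true ) _ = refl
odd-intersections (true  , true  , false , false) _ = refl
odd-intersections (true  , true  , false , true ) _ = refl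
odd-intersections (true  , true  , true  , false) _ = refl
odd-intersections (true  , true  , true  , true ) _ = refl

module Admissibility {q : ℕ} (K : FiniteField q) where
  open FiniteField K
  open FieldTheory K

  four : Carrier
  four = 1# + 1# + 1# + 1#

  -- These conditions fix the characters needed in `LowerBound`: 1 + u² is the factor `E` of most of
  -- the quantities there, 1 - 3u² decides x₁ + a, and the last two decide x₃ and x₄.
  Admissible : Carrier → Set
  Admissible u = u ≢ 0# × Square⁺ (1# + u * u) × Square⁺ (1# - three * (u * u))
               × Square⁺ (u * u + four * u + 1#) × Square⁺ (u * u - four * u + 1#)

module SquareProducts {q : ℕ} (K : FiniteField q) {p n : ℕ} (prime : Prime p) (q≡pⁿ : q ≡ p ℕ.^ n)
                  (m : ℕ) (q≡3+8m : q ≡ 3 ℕ.+ 8 ℕ.* m) (3≢0 : FiniteField.three K ≢ FiniteField.0# K) where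
  open FiniteField K
  open FieldTheory K
  open FieldPolynomials K
  open QuadraticCharacter K {p} {n} prime q≡pⁿ m q≡3+8m
  open Admissibility K
  open 𝔽S

  g₁ g₂ g₃ g₄ : Poly
  g₁ = 1# ∷ 0# ∷ 1# ∷ []
  g₂ = 1# ∷ 0# ∷ - three ∷ []
  g₃ = 1# ∷ four ∷ 1# ∷ []
  g₄ = 1# ∷ - four ∷ 1# ∷ []

  pick : Bool → Poly → Poly
  pick true  g = g
  pick false g = 1# ∷ []

  product : Subset → Poly
  product (a , b , c , d) = pick a g₁ *ₚ (pick b g₂ *ₚ (pick c g₃ *ₚ pick d g₄))

  product-0 : ∀ S → coeff (product S) 0 ≡ 1#
  product-0 (a , b , c , d) = trans (coeff-0-* (pick a g₁) _) (ones (pick-0 a refl) (trans (coeff-0-* (pick b g₂) _)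
      (ones (pick-0 b refl) (trans (coeff-0-* (pick c g₃) _) (ones (pick-0 c refl) (pick-0 d refl))))))
    where
    pick-0 : ∀ b {g} → coeff g 0 ≡ 1# → coeff (pick b g) 0 ≡ 1#
    pick-0 true  e = e
    pick-0 false _ = refl
    ones : ∀ {x y} → x ≡ 1# → y ≡ 1# → x * y ≡ 1#
    ones refl refl = 𝔽.*-identityˡ 1#

  product-≉0 : ∀ S → product S ≉0
  product-≉0 S e = 0≢1 (trans (sym (coeff-≈ e 0)) (product-0 S))

  length-product : ∀ S → length (product S) ℕ.≤ suc (2 ℕ.* size S)
  length-product (a , b , c , d) = subst (λ k → length (product (a , b , c , d)) ℕ.≤ suc k)
    (ℕS.solve 4 (λ a b c d → ℕS.con 2 ℕS.:* a ℕS.:+ (ℕS.con 2 ℕS.:* b ℕS.:+ (ℕS.con 2 ℕS.:* c ℕS.:+ ℕS.con 2 ℕS.:* d))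
      ℕS.:= ℕS.con 2 ℕS.:* (a ℕS.:+ (b ℕS.:+ (c ℕS.:+ d)))) refl (𝟙 a) (𝟙 b) (𝟙 c) (𝟙 d))
    (length-* (pick a g₁) _ (length-pick a) (length-* (pick b g₂) _ (length-pick b)
      (length-* (pick c g₃) (pick d g₄) (length-pick c) (length-pick d))))
    where
    module ℕS = +-*-Solver
    length-pick : ∀ b {x y z} → length (pick b (x ∷ y ∷ z ∷ [])) ℕ.≤ suc (2 ℕ.* 𝟙 b)
    length-pick true  = ℕₚ.≤-refl
    length-pick false = ℕₚ.≤-refl

  4≢0 : four ≢ 0#
  4≢0 4≡0 = *-≢0 2≢0 2≢0 (trans (solve 0 (num 2 :* num 2 := num 4) refl) 4≡0)

  private
    module Regularity (β γ : Carrier) where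
      open QuadraticExtension K β γ public

      quadratic-at-ω : ∀ x y z → Atω.eval (x ∷ y ∷ z ∷ []) ≡ (x + γ * z , y + β * z)
      quadratic-at-ω x y z = trans (atω-∷ x (y ∷ z ∷ [])) (trans
        (cong (λ (a , b) → x + γ * b , a + β * b) (trans (atω-∷ y (z ∷ [])) (cong (λ (a , b) → y + γ * b , a + β * b) (atω-∷ z []))))
        (cong₂ _,_ (solve 4 (λ x z β γ → x :+ γ :* ((z :+ γ :* num 0) :+ β :* (num 0 :+ β :* num 0)) := x :+ γ :* z) refl x z β γ)
                   (solve 4 (λ y z β γ → (y :+ γ :* (num 0 :+ β :* num 0)) :+ β :* ((z :+ γ :* num 0) :+ β :* (num 0 :+ β :* num 0)) := y :+ β :* z) refl y z β γ)))

      regular-quadratic : ∀ x y z → norm (x + γ * z , y + β * z) ≢ 0# → Regular (Atω.eval (x ∷ y ∷ z ∷ []))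
      regular-quadratic x y z N≢0 = subst Regular (sym (quadratic-at-ω x y z)) (norm≢0⇒regular _ N≢0)

      regular-1 : Regular (Atω.eval (1# ∷ []))
      regular-1 y e = trans (sym (𝕃.*-identityʳ y)) (trans (cong (y ⊗_) (sym (Hom.1-homo Atω.evalHom))) e)

      regular-pick : ∀ b g → Regular (Atω.eval g) → Regular (Atω.eval (pick b g))
      regular-pick true  g r = r
      regular-pick false g _ = regular-1

      regular-* : ∀ f g → Regular (Atω.eval f) → Regular (Atω.eval g) → Regular (Atω.eval (f *ₚ g))
      regular-* f g r s = subst Regular (sym (Atω.eval-* f g)) (regular-⊗ r s)

  private
    :norm-at-ω : ∀ {n} (β γ x y z : Polynomial n) → Polynomial n
    :norm-at-ω β γ x y z = (x :+ γ :* z) :* (x :+ γ :* z) :+ β :* ((x :+ γ :* z) :* (y :+ β :* z)) :- γ :* ((y :+ β :* z) :* (y :+ β :* z))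

  ≢0-by : ∀ {x y} → x ≡ y → y ≢ 0# → x ≢ 0#
  ≢0-by e y≢0 x≡0 = y≢0 (trans (sym e) x≡0)

  16≢0 : four * four ≢ 0#
  16≢0 = *-≢0 4≢0 4≢0

  -- One quadratic factor is taken as `minimal`, up to a constant. The norm at ω of any other is its
  -- resultant with `minimal`; these are ± powers of 2, and the discriminants -4, 12 and 4/3 involve
  -- only 2 and 3, so nothing vanishes.
  product-nonsquare : ∀ S → size S ≢ 0 → ∀ r s → r *ₚ r *ₚ product S ≋ s *ₚ s → r ≋ [] × s ≋ []
  product-nonsquare S@(true , b , c , d) _ =
    R.Reduced.nonsquare (≢0-by (solve 0 (num 0 :* num 0 :+ num 4 :* (:- num 1) := :- num 4) refl) (neg-≢0 4≢0))
      _ (*ₚ-congʳ _ (∷-cong (sym (-‿involutive 1#)) (∷-cong (sym -0#≈0#) ≋-refl))) (product-≉0 S)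
      (R.regular-* (pick b g₂) _ (R.regular-pick b g₂ reg₂) (R.regular-* (pick c g₃) (pick d g₄)
        (R.regular-pick c g₃ reg₃) (R.regular-pick d g₄ reg₄)))
    where
    module R = Regularity 0# (- 1#)
    reg₂ : R.Regular (R.Atω.eval g₂)
    reg₂ = R.regular-quadratic 1# 0# (- three) (≢0-by (solve 0 (:norm-at-ω (num 0) (:- num 1) (num 1) (num 0) (:- num 3) := num 4 :* num 4) refl) 16≢0)
    reg₃ : R.Regular (R.Atω.eval g₃)
    reg₃ = R.regular-quadratic 1# four 1# (≢0-by (solve 0 (:norm-at-ω (num 0) (:- num 1) (num 1) (num 4) (num 1) := num 4 :* num 4) refl) 16≢0)
    reg₄ : R.Regular (R.Atω.eval g₄)
    reg₄ = R.regular-quadratic 1# (- four) 1# (≢0-by (solve 0 (:norm-at-ω (num 0) (:- num 1) (num 1) (:- num 4) (num 1) := num 4 :* num 4) refl) 16≢0)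
  product-nonsquare S@(false , b , true , d) _ =
    R.Reduced.nonsquare (≢0-by (solve 0 ((:- num 4) :* (:- num 4) :+ num 4 :* (:- num 1) := num 4 :* num 3) refl) (*-≢0 4≢0 3≢0))
      (pick b g₂ *ₚ pick d g₄)
      (≋-trans (*ₚ-identityˡ _) (≋-trans (𝕏S.solve 3 (λ a c d → a 𝕏S.:* (c 𝕏S.:* d) 𝕏S.:= c 𝕏S.:* (a 𝕏S.:* d)) ≋-refl (pick b g₂) g₃ (pick d g₄))
        (*ₚ-congʳ _ (∷-cong (sym (-‿involutive 1#)) (∷-cong (sym (-‿involutive four)) ≋-refl))))) (product-≉0 S)
      (R.regular-* (pick b g₂) (pick d g₄) (R.regular-pick b g₂ reg₂) (R.regular-pick d g₄ reg₄))
    where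
    module R = Regularity (- four) (- 1#)
    reg₂ : R.Regular (R.Atω.eval g₂)
    reg₂ = R.regular-quadratic 1# 0# (- three) (≢0-by (solve 0 (:norm-at-ω (:- num 4) (:- num 1) (num 1) (num 0) (:- num 3) := :- (num 2 :* (num 4 :* num 4))) refl)
        (neg-≢0 (*-≢0 2≢0 16≢0)))
    reg₄ : R.Regular (R.Atω.eval g₄)
    reg₄ = R.regular-quadratic 1# (- four) 1# (≢0-by (solve 0 (:norm-at-ω (:- num 4) (:- num 1) (num 1) (:- num 4) (num 1) := num 4 :* (num 4 :* num 4)) refl)
        (*-≢0 4≢0 16≢0))
  product-nonsquare S@(false , b , false , true) _ =
    R.Reduced.nonsquare (≢0-by (solve 0 (num 4 :* num 4 :+ num 4 :* (:- num 1) := num 4 :* num 3) refl) (*-≢0 4≢0 3≢0))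
      (pick b g₂)
      (≋-trans (*ₚ-identityˡ _) (≋-trans (*ₚ-congˡ (pick b g₂) (*ₚ-identityˡ g₄)) (≋-trans (*ₚ-comm (pick b g₂) g₄)
        (*ₚ-congʳ _ (∷-cong (sym (-‿involutive 1#)) ≋-refl))))) (product-≉0 S)
      (R.regular-pick b g₂ reg₂)
    where
    module R = Regularity four (- 1#)
    reg₂ : R.Regular (R.Atω.eval g₂)
    reg₂ = R.regular-quadratic 1# 0# (- three) (≢0-by (solve 0 (:norm-at-ω (num 4) (:- num 1) (num 1) (num 0) (:- num 3) := :- (num 2 :* (num 4 :* num 4))) refl)
        (neg-≢0 (*-≢0 2≢0 16≢0)))
  -- `g₂` is -3(X² - 1/3), whence ω² = 1/3 and the constant cofactor -3.
  product-nonsquare S@(false , true , false , false) _ =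
    R.Reduced.nonsquare (≢0-by (solve 1 (λ t → num 0 :* num 0 :+ num 4 :* t := num 4 :* t) refl (three ⁻¹)) (*-≢0 4≢0 3⁻¹≢0))
      (- three ∷ []) g₂≋ (product-≉0 S) reg
    where
    module R = Regularity 0# (three ⁻¹)
    3⁻¹≢0 : three ⁻¹ ≢ 0#
    3⁻¹≢0 e = 0≢1 (trans (sym (𝔽.zeroʳ three)) (trans (cong (three *_) (sym e)) (⁻¹-inverse three 3≢0)))
    reg : R.Regular (R.Atω.eval (- three ∷ []))
    reg = subst R.Regular (sym (R.Atω.eval-const (- three))) (R.norm≢0⇒regular (- three , 0#)
      (≢0-by (solve 1 (λ t → (:- num 3) :* (:- num 3) :+ num 0 :* ((:- num 3) :* num 0) :- t :* (num 0 :* num 0) := num 3 :* num 3) refl (three ⁻¹)) (*-≢0 3≢0 3≢0)))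
    g₂≋ : product S ≋ R.minimal *ₚ (- three ∷ [])
    g₂≋ = ≋-trans (*ₚ-identityˡ _) (≋-trans (*ₚ-congˡ g₂ (*ₚ-identityˡ (1# ∷ []))) (≋-trans (*ₚ-comm g₂ (1# ∷ [])) (≋-trans (*ₚ-identityˡ g₂)
      (≋-sym (≋-trans (*ₚ-comm R.minimal (- three ∷ [])) (≋-trans (const-* (- three) R.minimal)
        (∷-cong (trans (solve 1 (λ t → (:- num 3) :* (:- t) := num 3 :* t) refl (three ⁻¹)) (⁻¹-inverse three 3≢0))
          (∷-cong (solve 0 ((:- num 3) :* (:- num 0) := num 0) refl) (∷-cong (𝔽.*-identityʳ _) ≋-refl)))))))))
  product-nonsquare (false , false , false , false) 0≢0 = contradiction refl 0≢0

-- The numbers are those of h = 58. The fifteen subset sizes sum to 32, so the weights `w h S` sum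
-- to 15(2h - 1) + 4 · 32 = 30h + 113 = 1853; further 232 = 4h and 16704 = 232 · 72, with 72 = 8 · 9
-- for at most nine degenerate points.
q-too-large : ∀ q → 13603 ℕ.≤ q → ¬ 232 ℕ.* (8 ℕ.* q) ℕ.≤ q ℕ.* 1853 ℕ.+ 16704
q-too-large q q≥ le = contradiction (ℕₚ.≤-trans (ℕₚ.*-monoˡ-≤ 3 q≥) (ℕₚ.+-cancelˡ-≤ (q ℕ.* 1853) (q ℕ.* 3) 16704
    (ℕₚ.≤-trans (ℕₚ.≤-reflexive split) le))) (from-no (40809 ℕₚ.≤? 16704))
  where
  split : q ℕ.* 1853 ℕ.+ q ℕ.* 3 ≡ 232 ℕ.* (8 ℕ.* q)
  split = trans (sym (ℕₚ.*-distribˡ-+ q 1853 3)) (trans (ℕₚ.*-comm q 1856) (ℕₚ.*-assoc 232 8 q))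

-- Averaging over products of the quadratics

module LargeField {q : ℕ} (K : FiniteField q) {p n : ℕ} (prime : Prime p) (q≡pⁿ : q ≡ p ℕ.^ n)
                  (m : ℕ) (q≡3+8m : q ≡ 3 ℕ.+ 8 ℕ.* m) (3≢0 : FiniteField.three K ≢ FiniteField.0# K) where
  open FiniteField K hiding (δ)
  open FieldTheory K
  open FieldPolynomials K
  open QuadraticCharacter K {p} {n} prime q≡pⁿ m q≡3+8m
  open Admissibility K
  open SquareProducts K {p} {n} prime q≡pⁿ m q≡3+8m 3≢0
  open Stepanov K {p} {n} prime q≡pⁿ e q≡1+2e using (module Auxiliary)
  open +-*-Solver
  open DoubleCounting

  nonresidue? : ∀ S u → Dec (value u (product S) ^ e ≡ - 1#)
  nonresidue? S u = (value u (product S) ^ e) ≟ (- 1#)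

  nonresidues : Subset → List Carrier
  nonresidues S = filter (nonresidue? S) elements

  private
    -- The closed form M(k + 1) + δM(M - 1)/2, doubled and with δM moved across to stay within the
    -- natural numbers.
    closed-conditions : ∀ S δ f≤ M k →
      2 ℕ.* Auxiliary.conditions (product S) δ f≤ M k ℕ.+ δ ℕ.* M ≡ M ℕ.* (2 ℕ.* suc k) ℕ.+ δ ℕ.* (M ℕ.* M)
    closed-conditions S δ f≤ zero    k = refl
    closed-conditions S δ f≤ (suc M) k = begin
      2 ℕ.* (suc k ℕ.+ cs) ℕ.+ δ ℕ.* suc M
        ≡⟨ solve 4 (λ k cs δ M → con 2 :* (con 1 :+ k :+ cs) :+ δ :* (con 1 :+ M) := (con 2 :* cs :+ δ :* M) :+ (con 2 :* (con 1 :+ k) :+ δ)) refl k cs δ M ⟩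
      (2 ℕ.* cs ℕ.+ δ ℕ.* M) ℕ.+ (2 ℕ.* suc k ℕ.+ δ)
        ≡⟨ cong (ℕ._+ (2 ℕ.* suc k ℕ.+ δ)) (closed-conditions S δ f≤ M (k ℕ.+ δ)) ⟩
      (M ℕ.* (2 ℕ.* suc (k ℕ.+ δ)) ℕ.+ δ ℕ.* (M ℕ.* M)) ℕ.+ (2 ℕ.* suc k ℕ.+ δ)
        ≡⟨ solve 3 (λ k δ M → (M :* (con 2 :* (con 1 :+ (k :+ δ))) :+ δ :* (M :* M)) :+ (con 2 :* (con 1 :+ k) :+ δ)
             := (con 1 :+ M) :* (con 2 :* (con 1 :+ k)) :+ δ :* ((con 1 :+ M) :* (con 1 :+ M))) refl k δ M ⟩
      suc M ℕ.* (2 ℕ.* suc k) ℕ.+ δ ℕ.* (suc M ℕ.* suc M) ∎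
      where
      open ≡-Reasoning
      cs = Auxiliary.conditions (product S) δ f≤ M (k ℕ.+ δ)

  -- Stepanov's method for degree 2 + 2c with vanishing order 2h and h + 1 + c blocks of unknowns.
  nonresidue-bound : ∀ h S c b B → 1 ℕ.≤ h → size S ≡ suc c → suc B ≡ 2 ℕ.* (h ℕ.* h) ℕ.+ h ℕ.+ b → e ≡ B ℕ.+ suc c →
    4 ℕ.* h ℕ.* length (nonresidues S) ℕ.≤ q ℕ.* (2 ℕ.* h ℕ.+ 3 ℕ.+ 4 ℕ.* c)
  nonresidue-bound h S c b B 1≤h size≡ B≡ e≡ = begin
    4 ℕ.* h ℕ.* N  ≡⟨ solve 2 (λ h N → con 4 :* h :* N := con 2 :* (N :* (con 2 :* h))) refl h N ⟩
    2 ℕ.* (N ℕ.* M)  ≤⟨ ℕₚ.*-monoʳ-≤ 2 main ⟩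
    2 ℕ.* (B ℕ.+ e ℕ.* suc δ ℕ.+ q ℕ.* J)  ≤⟨ ℕₚ.m≤m+n _ (5 ℕ.+ 4 ℕ.* c) ⟩
    2 ℕ.* (B ℕ.+ e ℕ.* suc δ ℕ.+ q ℕ.* J) ℕ.+ (5 ℕ.+ 4 ℕ.* c)
      ≡⟨ cong₂ (λ e q → 2 ℕ.* (B ℕ.+ e ℕ.* suc δ ℕ.+ q ℕ.* J) ℕ.+ (5 ℕ.+ 4 ℕ.* c)) e≡ q≡ ⟩
    2 ℕ.* (B ℕ.+ E ℕ.* suc δ ℕ.+ suc (E ℕ.+ E) ℕ.* J) ℕ.+ (5 ℕ.+ 4 ℕ.* c)
      ≡⟨ solve 3 (λ h B c → let E = B :+ (con 1 :+ c) in
            con 2 :* (B :+ E :* (con 1 :+ (con 1 :+ con 2 :* c)) :+ (con 1 :+ (E :+ E)) :* (h :+ c)) :+ (con 5 :+ con 4 :* c)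
         := (con 1 :+ (E :+ E)) :* (con 2 :* h :+ con 3 :+ con 4 :* c)) refl h B c ⟩
    suc (E ℕ.+ E) ℕ.* (2 ℕ.* h ℕ.+ 3 ℕ.+ 4 ℕ.* c)  ≡⟨ cong (ℕ._* (2 ℕ.* h ℕ.+ 3 ℕ.+ 4 ℕ.* c)) q≡ ⟨
    q ℕ.* (2 ℕ.* h ℕ.+ 3 ℕ.+ 4 ℕ.* c)  ∎
    where
    open ℕₚ.≤-Reasoning
    N = length (nonresidues S)
    -- B = e - (c + 1) is the largest value allowed by `B-small`. With h + 1 + c blocks, the 2(h + 1
    -- + c)(B + 1) unknowns exceed the dominant part 2h(B + 1) of the conditions by 2(1 + c)(B + 1);
    -- since B + 1 is at least 2h² + h, this pays for the remaining conditions.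
    δ J E M : ℕ
    δ = 1 ℕ.+ 2 ℕ.* c
    J = h ℕ.+ c
    E = B ℕ.+ suc c
    M = 2 ℕ.* h
    q≡ : q ≡ suc (E ℕ.+ E)
    q≡ = trans q≡1+2e (cong (λ e → suc (e ℕ.+ e)) e≡)
    f≤ : length (product S) ℕ.≤ suc (suc δ)
    f≤ = ℕₚ.≤-trans (length-product S) (ℕₚ.≤-reflexive (trans (cong (λ k → suc (2 ℕ.* k)) size≡)
      (solve 1 (λ c → con 1 :+ con 2 :* (con 1 :+ c) := con 1 :+ (con 1 :+ (con 1 :+ con 2 :* c))) refl c)))
    module A = Auxiliary (product S) δ f≤
    size≢0 : size S ≢ 0
    size≢0 z = contradiction (trans (sym size≡) z) λ ()
    B-small : B ℕ.+ B ℕ.+ suc δ ℕ.< q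
    B-small = ℕₚ.≤-reflexive (trans (cong suc (solve 2 (λ B c →
      B :+ B :+ (con 1 :+ (con 1 :+ con 2 :* c)) := (B :+ (con 1 :+ c)) :+ (B :+ (con 1 :+ c))) refl B c)) (sym q≡))
    module I = A.Independence (product-0 S) (product-nonsquare S size≢0) B B-small
    2h≤B : 2 ℕ.* h ℕ.≤ B
    2h≤B = ℕₚ.≤-pred (begin
      suc (2 ℕ.* h)  ≡⟨ ℕₚ.+-comm 1 (2 ℕ.* h) ⟩
      2 ℕ.* h ℕ.+ 1  ≤⟨ ℕₚ.+-mono-≤ (ℕₚ.*-monoʳ-≤ 2 (ℕₚ.≤-trans (ℕₚ.≤-reflexive (sym (ℕₚ.*-identityʳ h))) (ℕₚ.*-monoʳ-≤ h 1≤h))) 1≤h ⟩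
      2 ℕ.* (h ℕ.* h) ℕ.+ h  ≤⟨ ℕₚ.m≤m+n _ b ⟩
      2 ℕ.* (h ℕ.* h) ℕ.+ h ℕ.+ b  ≡⟨ B≡ ⟨
      suc B  ∎)
    1≤B : 1 ℕ.≤ B
    1≤B = ℕₚ.≤-trans (ℕₚ.≤-trans 1≤h (ℕₚ.m≤m+n h _)) 2h≤B
    B≤q : B ℕ.≤ q
    B≤q = ℕₚ.≤-trans (ℕₚ.m≤m+n B B) (ℕₚ.≤-trans (ℕₚ.m≤m+n (B ℕ.+ B) (suc δ)) (ℕₚ.<⇒≤ B-small))
    1<q : 1 ℕ.< q
    1<q = ℕₚ.≤-<-trans 1≤B (ℕₚ.≤-<-trans (ℕₚ.≤-trans (ℕₚ.m≤m+n B B) (ℕₚ.m≤m+n (B ℕ.+ B) (suc δ))) B-small)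
    q≤ : q ℕ.≤ B ℕ.+ e ℕ.* suc δ
    q≤ = begin
      q  ≡⟨ q≡ ⟩
      1 ℕ.+ (E ℕ.+ E)  ≤⟨ ℕₚ.+-mono-≤ 1≤B (ℕₚ.m≤m+n (E ℕ.+ E) (E ℕ.* (2 ℕ.* c))) ⟩
      B ℕ.+ (E ℕ.+ E ℕ.+ E ℕ.* (2 ℕ.* c))  ≡⟨ cong (B ℕ.+_) (solve 2 (λ c E → E :+ E :+ E :* (con 2 :* c) := E :* (con 1 :+ (con 1 :+ con 2 :* c))) refl c E) ⟩
      B ℕ.+ E ℕ.* suc δ  ≡⟨ cong (λ e → B ℕ.+ e ℕ.* suc δ) e≡ ⟨
      B ℕ.+ e ℕ.* suc δ  ∎
    unknowns-closed : ∀ J → I.unknowns J ≡ J ℕ.* (2 ℕ.* suc B)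
    unknowns-closed zero    = refl
    unknowns-closed (suc J) = trans (cong (λ u → suc B ℕ.+ (suc B ℕ.+ u)) (unknowns-closed J))
      (solve 2 (λ J B → (con 1 :+ B) :+ ((con 1 :+ B) :+ J :* (con 2 :* (con 1 :+ B))) := (con 1 :+ J) :* (con 2 :* (con 1 :+ B))) refl J B)
    -- Exactly twice the excess of unknowns over conditions; it is positive because h is.
    slack : ℕ
    slack = 2 ℕ.* h ℕ.+ (4 ℕ.* (c ℕ.* h) ℕ.+ 4 ℕ.* (suc c ℕ.* b))
    underdetermined : A.conditions M (B ℕ.+ suc J) ℕ.< I.unknowns (suc J)
    underdetermined = ℕₚ.*-cancelˡ-< 2 _ _ (ℕₚ.+-cancelʳ-< (δ ℕ.* M) _ _ (begin-strict
      2 ℕ.* A.conditions M (B ℕ.+ suc J) ℕ.+ δ ℕ.* M  ≡⟨ closed-conditions S δ f≤ M (B ℕ.+ suc J) ⟩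
      M ℕ.* (2 ℕ.* suc (B ℕ.+ suc J)) ℕ.+ δ ℕ.* (M ℕ.* M)  ≡⟨ ℕₚ.+-identityʳ _ ⟨
      M ℕ.* (2 ℕ.* suc (B ℕ.+ suc J)) ℕ.+ δ ℕ.* (M ℕ.* M) ℕ.+ 0  <⟨ ℕₚ.+-monoʳ-< (M ℕ.* (2 ℕ.* suc (B ℕ.+ suc J)) ℕ.+ δ ℕ.* (M ℕ.* M))
                                                                     (ℕₚ.≤-trans 1≤h (ℕₚ.≤-trans (ℕₚ.m≤m+n h _) (ℕₚ.m≤m+n M _))) ⟩
      M ℕ.* (2 ℕ.* suc (B ℕ.+ suc J)) ℕ.+ δ ℕ.* (M ℕ.* M) ℕ.+ slack
        ≡⟨ cong (λ B′ → M ℕ.* (2 ℕ.* B′) ℕ.+ δ ℕ.* (M ℕ.* M) ℕ.+ slack) (cong (ℕ._+ suc J) B≡) ⟩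
      M ℕ.* (2 ℕ.* (2 ℕ.* (h ℕ.* h) ℕ.+ h ℕ.+ b ℕ.+ suc J)) ℕ.+ δ ℕ.* (M ℕ.* M) ℕ.+ slack
        ≡⟨ solve 3 (λ h b c → let B = con 2 :* (h :* h) :+ h :+ b; J = h :+ c; δ = con 1 :+ con 2 :* c; M = con 2 :* h in
             M :* (con 2 :* (B :+ (con 1 :+ J))) :+ δ :* (M :* M) :+ (con 2 :* h :+ (con 4 :* (c :* h) :+ con 4 :* ((con 1 :+ c) :* b)))
          := con 2 :* ((con 1 :+ J) :* (con 2 :* B)) :+ δ :* M) refl h b c ⟩
      2 ℕ.* (suc J ℕ.* (2 ℕ.* (2 ℕ.* (h ℕ.* h) ℕ.+ h ℕ.+ b))) ℕ.+ δ ℕ.* M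
        ≡⟨ cong (λ B′ → 2 ℕ.* (suc J ℕ.* (2 ℕ.* B′)) ℕ.+ δ ℕ.* M) B≡ ⟨
      2 ℕ.* (suc J ℕ.* (2 ℕ.* suc B)) ℕ.+ δ ℕ.* M  ≡⟨ cong (λ u → 2 ℕ.* u ℕ.+ δ ℕ.* M) (unknowns-closed (suc J)) ⟨
      2 ℕ.* I.unknowns (suc J) ℕ.+ δ ℕ.* M  ∎))
    main : N ℕ.* M ℕ.≤ B ℕ.+ e ℕ.* suc δ ℕ.+ q ℕ.* J
    main = I.stepanov M J (ℕₚ.≤-trans 2h≤B B≤q) 1<q q≤ underdetermined (nonresidues S) (Unique.filter⁺ (nonresidue? S) elements-unique)
      (All.map (λ {α} x^e≡-1 → nonzero α x^e≡-1 , x^e≡-1) (all-filter (nonresidue? S) elements))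
      where
      nonzero : ∀ α → value α (product S) ^ e ≡ - 1# → value α (product S) ≢ 0#
      nonzero α x^e≡-1 x≡0 = neg-≢0 (0≢1 ∘ sym) (trans (sym x^e≡-1) (trans (cong (_^ e) x≡0) (𝔽.zeroˡ _)))

  private
    w : ℕ → Subset → ℕ
    w h S = 2 ℕ.* h ℕ.+ 3 ℕ.+ 4 ℕ.* ℕ.pred (size S)

    bound : ∀ h → 1 ℕ.≤ h → 2 ℕ.* (h ℕ.* h) ℕ.+ h ℕ.+ 4 ℕ.≤ suc e → ∀ S → 1 ℕ.≤ size S × size S ℕ.≤ 4 →
      4 ℕ.* h ℕ.* length (nonresidues S) ℕ.≤ q ℕ.* w h S
    bound h 1≤h h-small S (1≤size , size≤4) =
      nonresidue-bound h S c (proj₁ rest) B 1≤h size≡ (sym (proj₂ rest)) (sym (ℕₚ.m∸n+n≡m size≤e))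
      where
      c : ℕ
      c = ℕ.pred (size S)
      size≡ : size S ≡ suc c
      size≡ = sym (ℕₚ.suc-pred (size S) ⦃ ℕ.>-nonZero 1≤size ⦄)
      c<4 : suc c ℕ.≤ 4
      c<4 = subst (ℕ._≤ 4) size≡ size≤4
      open ℕₚ.≤-Reasoning
      size≤e : suc c ℕ.≤ e
      size≤e = ℕₚ.≤-pred (begin
        suc (suc c)  ≤⟨ s≤s c<4 ⟩
        1 ℕ.+ 4  ≤⟨ ℕₚ.+-monoˡ-≤ 4 (ℕₚ.≤-trans 1≤h (ℕₚ.m≤n+m h _)) ⟩
        2 ℕ.* (h ℕ.* h) ℕ.+ h ℕ.+ 4  ≤⟨ h-small ⟩
        suc e  ∎)
      B : ℕ
      B = e ℕ.∸ suc c
      rest : ∃ λ b → 2 ℕ.* (h ℕ.* h) ℕ.+ h ℕ.+ b ≡ suc B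
      rest = ℕₚ.m≤n⇒∃[o]m+o≡n (ℕₚ.+-cancelʳ-≤ 4 _ _ (begin
        2 ℕ.* (h ℕ.* h) ℕ.+ h ℕ.+ 4  ≤⟨ h-small ⟩
        suc e  ≡⟨ cong suc (ℕₚ.m∸n+n≡m size≤e) ⟨
        suc B ℕ.+ suc c  ≤⟨ ℕₚ.+-monoʳ-≤ (suc B) c<4 ⟩
        suc B ℕ.+ 4  ∎))

    sum-bounds : ∀ {A : Set} k q (f g : A → ℕ) L → All (λ x → k ℕ.* f x ℕ.≤ q ℕ.* g x) L → k ℕ.* sum (map f L) ℕ.≤ q ℕ.* sum (map g L)
    sum-bounds k q f g []      []       = ℕₚ.≤-trans (ℕₚ.≤-reflexive (ℕₚ.*-zeroʳ k)) z≤n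
    sum-bounds k q f g (x ∷ L) (b ∷ bs) = begin
      k ℕ.* (f x ℕ.+ sum (map f L))  ≡⟨ ℕₚ.*-distribˡ-+ k (f x) _ ⟩
      k ℕ.* f x ℕ.+ k ℕ.* sum (map f L)  ≤⟨ ℕₚ.+-mono-≤ b (sum-bounds k q f g L bs) ⟩
      q ℕ.* g x ℕ.+ q ℕ.* sum (map g L)  ≡⟨ ℕₚ.*-distribˡ-+ q (g x) _ ⟨
      q ℕ.* (g x ℕ.+ sum (map g L))  ∎
      where open ℕₚ.≤-Reasoning

    sizes : All (λ S → 1 ℕ.≤ size S × size S ℕ.≤ 4) nonempty-subsets
    sizes = from-yes (All.all? (λ S → (1 ℕₚ.≤? size S) ×-dec (size S ℕₚ.≤? 4)) nonempty-subsets)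

    total-bound : ∀ h → 1 ℕ.≤ h → 2 ℕ.* (h ℕ.* h) ℕ.+ h ℕ.+ 4 ℕ.≤ suc e →
      4 ℕ.* h ℕ.* sum (map (λ S → length (nonresidues S)) nonempty-subsets) ℕ.≤ q ℕ.* sum (map (w h) nonempty-subsets)
    total-bound h 1≤h h-small = sum-bounds (4 ℕ.* h) q (λ S → length (nonresidues S)) (w h) nonempty-subsets (All.map (λ {S} → bound h 1≤h h-small S) sizes)

    -- The factor X records the requirement u ≠ 0; with it the degree is at most 1 + 8 = 9.
    degenerate : Poly
    degenerate = X *ₚ product (true , true , true , true)

    degenerate? : ∀ u → Dec (value u degenerate ≡ 0#)
    degenerate? u = value u degenerate ≟ 0#

    few-degenerate : length (filter degenerate? elements) ℕ.≤ 9
    few-degenerate = ℕₚ.≤-pred (ℕₚ.≤-trans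
      (root-count degenerate _ degenerate-≉0 (Unique.filter⁺ degenerate? elements-unique) (all-filter degenerate? elements))
      (length-* X (product (true , true , true , true)) ℕₚ.≤-refl (length-product (true , true , true , true))))
      where
      degenerate-≉0 : degenerate ≉0
      degenerate-≉0 = product-≉0 (true , true , true , true) ∘ *ₚ-zero⇒ʳ X (λ X≋0 → 0≢1 (sym (coeff-≈ X≋0 1)))

    sgn : Bool → Carrier
    sgn true  = - 1#
    sgn false = 1#

    sgn-xor : ∀ a b → sgn a * sgn b ≡ sgn (a xor b)
    sgn-xor true  true  = 𝔽S.solve 0 ((𝔽S.:- 𝔽S.num 1) 𝔽S.:* (𝔽S.:- 𝔽S.num 1) 𝔽S.:= 𝔽S.num 1) refl
    sgn-xor true  false = 𝔽.*-identityʳ _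
    sgn-xor false b     = 𝔽.*-identityˡ _

    does-sgn : ∀ a → does (sgn a ≟ (- 1#)) ≡ a
    does-sgn true with (- 1#) ≟ (- 1#)
    ... | yes _ = refl
    ... | no -1≢-1 = contradiction refl -1≢-1
    does-sgn false with 1# ≟ (- 1#)
    ... | yes 1≡-1 = contradiction 1≡-1 1≢-1
    ... | no _ = refl

    value-pick : ∀ u a {g σ} → value u g ^ e ≡ sgn σ → value u (pick a g) ^ e ≡ sgn (a ∧ σ)
    value-pick u true  h = h
    value-pick u false h = trans (cong (_^ e) (Value.eval-const u 1#)) (1^-field e)

    value-*-^e : ∀ u f g {a b} → value u f ^ e ≡ sgn a → value u g ^ e ≡ sgn b → value u (f *ₚ g) ^ e ≡ sgn (a xor b)
    value-*-^e u f g {a} {b} ha hb = trans (cong (_^ e) (Value.eval-* u f g)) (trans (^-distrib-* (value u f) (value u g) e)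
      (trans (cong₂ _*_ ha hb) (sgn-xor a b)))

    sign : ∀ {x} → x ≢ 0# → ∃ λ a → x ^ e ≡ sgn a
    sign x≢0 with ^e-dichotomy x≢0
    ... | inj₁ x^e≡1  = false , x^e≡1
    ... | inj₂ x^e≡-1 = true , x^e≡-1

    value-*-≢0 : ∀ u f g → value u (f *ₚ g) ≢ 0# → value u f ≢ 0# × value u g ≢ 0#
    value-*-≢0 u f g fg≢0 =
      (λ f≡0 → fg≢0 (trans (Value.eval-* u f g) (trans (cong (_* value u g) f≡0) (𝔽.zeroˡ _)))) ,
      (λ g≡0 → fg≢0 (trans (Value.eval-* u f g) (trans (cong (value u f *_) g≡0) (𝔽.zeroʳ _))))

    Good : Carrier → Set
    Good u = u ≢ 0# × value u g₁ ^ e ≡ 1# × value u g₂ ^ e ≡ 1# × value u g₃ ^ e ≡ 1# × value u g₄ ^ e ≡ 1#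

    good? : ∀ u → Dec (Good u)
    good? u = ¬? (u ≟ 0#) ×-dec ((value u g₁ ^ e) ≟ 1#) ×-dec ((value u g₂ ^ e) ≟ 1#) ×-dec ((value u g₃ ^ e) ≟ 1#) ×-dec ((value u g₄ ^ e) ≟ 1#)

    -- The power e is multiplicative, so the sign of a product at u is the parity of the chosen
    -- negative signs. Since u is not good, the sign vector is nonzero.
    half-nonresidue : ∀ u → ¬ Good u → value u degenerate ≢ 0# → multiplicity (λ S u → does (nonresidue? S u)) nonempty-subsets u ≡ 8
    half-nonresidue u bad nondeg
      with value-*-≢0 u X (product (true , true , true , true)) nondeg
    ... | uX≢0 , rest with value-*-≢0 u g₁ (g₂ *ₚ (g₃ *ₚ g₄)) rest
    ... | v₁≢0 , rest with value-*-≢0 u g₂ (g₃ *ₚ g₄) rest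
    ... | v₂≢0 , rest with value-*-≢0 u g₃ g₄ rest
    ... | v₃≢0 , v₄≢0 with sign v₁≢0 | sign v₂≢0 | sign v₃≢0 | sign v₄≢0
    ... | a , v₁ | b , v₂ | c , v₃ | d , v₄ = trans (cong sum (map-cong pointwise nonempty-subsets)) (odd-intersections (a , b , c , d) not-all-squares)
      where
      pointwise : ∀ S → 𝟙 (does (nonresidue? S u)) ≡ 𝟙 (parity S (a , b , c , d))
      pointwise S@(a′ , b′ , c′ , d′) = cong 𝟙 (trans (cong (λ x → does (x ≟ (- 1#)))
        (value-*-^e u (pick a′ g₁) _ {a′ ∧ a} {(b′ ∧ b) xor ((c′ ∧ c) xor (d′ ∧ d))} (value-pick u a′ {g₁} {a} v₁)
          (value-*-^e u (pick b′ g₂) _ {b′ ∧ b} {(c′ ∧ c) xor (d′ ∧ d)} (value-pick u b′ {g₂} {b} v₂)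
            (value-*-^e u (pick c′ g₃) (pick d′ g₄) {c′ ∧ c} {d′ ∧ d} (value-pick u c′ {g₃} {c} v₃) (value-pick u d′ {g₄} {d} v₄)))))
        (does-sgn (parity S (a , b , c , d))))
      not-all-squares : (a , b , c , d) ≢ (false , false , false , false)
      not-all-squares refl = bad ((λ u≡0 → uX≢0 (trans (Value.eval-X u) u≡0)) , v₁ , v₂ , v₃ , v₄)

    no-good⇒q-small : (∀ u → ¬ Good u) → ∀ h → 1 ℕ.≤ h → 2 ℕ.* (h ℕ.* h) ℕ.+ h ℕ.+ 4 ℕ.≤ suc e →
      4 ℕ.* h ℕ.* (8 ℕ.* q) ℕ.≤ q ℕ.* sum (map (w h) nonempty-subsets) ℕ.+ 4 ℕ.* h ℕ.* 72
    no-good⇒q-small none h 1≤h h-small = begin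
      4 ℕ.* h ℕ.* (8 ℕ.* q)  ≡⟨ cong (λ k → 4 ℕ.* h ℕ.* (8 ℕ.* k)) length-elements ⟨
      4 ℕ.* h ℕ.* (8 ℕ.* length elements)
        ≤⟨ ℕₚ.*-monoʳ-≤ (4 ℕ.* h) (double-count (λ S u → does (nonresidue? S u)) (λ u → does (degenerate? u)) nonempty-subsets 8 pointwise elements) ⟩
      4 ℕ.* h ℕ.* (counts (λ S u → does (nonresidue? S u)) nonempty-subsets elements ℕ.+ 8 ℕ.* count (λ u → does (degenerate? u)) elements)
        ≡⟨ cong₂ (λ x y → 4 ℕ.* h ℕ.* (x ℕ.+ 8 ℕ.* y)) (cong sum (map-cong (λ S → count-filter (nonresidue? S) elements) nonempty-subsets))
             (count-filter degenerate? elements) ⟩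
      4 ℕ.* h ℕ.* (sum (map (λ S → length (nonresidues S)) nonempty-subsets) ℕ.+ 8 ℕ.* length (filter degenerate? elements))
        ≤⟨ ℕₚ.*-monoʳ-≤ (4 ℕ.* h) (ℕₚ.+-monoʳ-≤ _ (ℕₚ.*-monoʳ-≤ 8 few-degenerate)) ⟩
      4 ℕ.* h ℕ.* (sum (map (λ S → length (nonresidues S)) nonempty-subsets) ℕ.+ 72)
        ≡⟨ ℕₚ.*-distribˡ-+ (4 ℕ.* h) (sum (map (λ S → length (nonresidues S)) nonempty-subsets)) 72 ⟩
      4 ℕ.* h ℕ.* sum (map (λ S → length (nonresidues S)) nonempty-subsets) ℕ.+ 4 ℕ.* h ℕ.* 72
        ≤⟨ ℕₚ.+-monoˡ-≤ (4 ℕ.* h ℕ.* 72) (total-bound h 1≤h h-small) ⟩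
      q ℕ.* sum (map (w h) nonempty-subsets) ℕ.+ 4 ℕ.* h ℕ.* 72  ∎
      where
      open ℕₚ.≤-Reasoning
      pointwise : ∀ u → 8 ℕ.≤ multiplicity (λ S u → does (nonresidue? S u)) nonempty-subsets u ℕ.+ 8 ℕ.* 𝟙 (does (degenerate? u))
      pointwise u with degenerate? u
      ... | yes _     = ℕₚ.m≤n+m 8 _
      ... | no nondeg = ℕₚ.≤-trans (ℕₚ.≤-reflexive (sym (half-nonresidue u (none u) nondeg))) (ℕₚ.m≤m+n _ 0)

    good⇒admissible : ∀ u → Good u → Admissible u
    good⇒admissible u (u≢0 , v₁ , v₂ , v₃ , v₄) = u≢0
      , subst Square⁺ (F.solve 1 (λ u → N 1 F.:+ u F.:* (N 0 F.:+ u F.:* (N 1 F.:+ u F.:* N 0)) F.:= N 1 F.:+ u F.:* u) refl u) (^e≡1⇒square v₁)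
      , subst Square⁺ (F.solve 1 (λ u → N 1 F.:+ u F.:* (N 0 F.:+ u F.:* (F.:- N 3 F.:+ u F.:* N 0)) F.:= N 1 F.:- N 3 F.:* (u F.:* u)) refl u) (^e≡1⇒square v₂)
      , subst Square⁺ (F.solve 1 (λ u → N 1 F.:+ u F.:* (N 4 F.:+ u F.:* (N 1 F.:+ u F.:* N 0)) F.:= u F.:* u F.:+ N 4 F.:* u F.:+ N 1) refl u) (^e≡1⇒square v₃)
      , subst Square⁺ (F.solve 1 (λ u → N 1 F.:+ u F.:* (F.:- N 4 F.:+ u F.:* (N 1 F.:+ u F.:* N 0)) F.:= u F.:* u F.:- N 4 F.:* u F.:+ N 1) refl u) (^e≡1⇒square v₄)
      where
      module F = 𝔽S
      N : ∀ {n} → ℕ → F.Polynomial n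
      N = F.num

  -- For h = 58 the fifteen bounds add up to 1853 q, which is less than 8 · 4h q = 1856 q.
  admissible-exists : 1700 ℕ.≤ m → ∃ Admissible
  admissible-exists m≥1700 with any? good? elements
  ... | yes some = let u , good = Any.satisfied some in u , good⇒admissible u good
  -- The inequality 30h + 113 < 32h needs h at least 57. For h = 57 the margin is a single q against
  -- 4h · 72 = 16416, whereas h = 58 gives 3q against 16704. The remaining requirement 2h² + h + 4 ≤
  -- e + 1 reads 6789 ≤ e, and e is at least 1 + 4 · 1700.
  ... | no none  = contradiction (no-good⇒q-small (λ u good → none (lose (elements-complete u) good)) 58 (s≤s z≤n)
                     (s≤s (ℕₚ.≤-trans (from-yes (6789 ℕₚ.≤? 6801)) (s≤s (ℕₚ.*-monoʳ-≤ 4 m≥1700)))))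
                     (q-too-large q (subst (13603 ℕ.≤_) (sym q≡3+8m) (ℕₚ.+-monoʳ-≤ 3 (ℕₚ.*-monoʳ-≤ 8 m≥1700))))

-- Small fields

module ModularSearch (p : ℕ) .⦃ _ : NonZero p ⦄ where

  -- Used only to guess roots and inverses, which are then checked; the first argument bounds the number of binary digits.
  opaque
    power : ℕ → ℕ → ℕ → ℕ
    power zero    b k = 1
    power (suc f) b k = if k % 2 ≡ᵇ 0 then power f ((b ℕ.* b) % p) (k / 2) else (b ℕ.* power f ((b ℕ.* b) % p) (k / 2)) % p

  isUnit : ℕ → Bool
  isUnit u = (u ℕ.* power 14 u (p ℕ.∸ 2)) % p ≡ᵇ 1

  isRoot : ℕ → ℕ → Bool
  isRoot v r = ((r ℕ.* r) % p ≡ᵇ v % p) ∧ isUnit r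

  -- When p ≡ 3 mod 4 is prime, a square v has the root v^((p+1)/4). All moduli searched lie below
  -- 2^14, so 14 binary digits cover the exponents.
  isSquare : ℕ → Bool
  isSquare v = isRoot v (power 14 v ((p ℕ.+ 1) / 4))

  isAdmissible : ℕ → Bool
  isAdmissible u = isSquare (1 ℕ.+ u ℕ.* u) ∧ isSquare (1 ℕ.+ (p ℕ.∸ 3) ℕ.* (u ℕ.* u))
    ∧ isSquare (u ℕ.* u ℕ.+ 4 ℕ.* u ℕ.+ 1) ∧ isSquare (u ℕ.* u ℕ.+ (p ℕ.∸ 4) ℕ.* u ℕ.+ 1) ∧ isUnit u

  hasDivisorIn : List ℕ → Bool
  hasDivisorIn = any (λ d → (2 ℕ.+ d <ᵇ p) ∧ (p % (2 ℕ.+ d) ≡ᵇ 0))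

  -- A modulus with a proper divisor is settled because p is prime by hypothesis; this allows one
  -- computation over a whole arithmetic progression.
  settled : List ℕ → List ℕ → Bool
  settled D L = hasDivisorIn D ∨ any isAdmissible L

module NaturalsInField {q : ℕ} (K : FiniteField q) {p n : ℕ} (prime : Prime p) (q≡pⁿ : q ≡ p ℕ.^ n) .⦃ _ : NonZero p ⦄ where
  open FiniteField K
  open FieldTheory K
  open Characteristic {p} {n} prime q≡pⁿ
  open 𝔽S

  nat : ℕ → Carrier
  nat k = k ×ᶠ 1#

  nat-+ : ∀ a b → nat (a ℕ.+ b) ≡ nat a + nat b
  nat-+ a b = ×-homo-+ 1# a b

  nat-* : ∀ a b → nat (a ℕ.* b) ≡ nat a * nat b
  nat-* a b = ×1-homo-* a b

  nat-1 : nat 1 ≡ 1#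
  nat-1 = 𝔽.+-identityʳ 1#

  nat-% : ∀ a → nat (a % p) ≡ nat a
  nat-% a = sym (begin
    nat a  ≡⟨ cong nat (m≡m%n+[m/n]*n a p) ⟩
    nat (a % p ℕ.+ a / p ℕ.* p)  ≡⟨ nat-+ (a % p) (a / p ℕ.* p) ⟩
    nat (a % p) + nat (a / p ℕ.* p)  ≡⟨ cong (nat (a % p) +_) (trans (nat-* (a / p) p) (trans (cong (nat (a / p) *_) char) (𝔽.zeroʳ _))) ⟩
    nat (a % p) + 0#  ≡⟨ 𝔽.+-identityʳ _ ⟩
    nat (a % p)  ∎)
    where open ≡-Reasoning

  nat-cong-% : ∀ a b → a % p ≡ b % p → nat a ≡ nat b
  nat-cong-% a b e = trans (sym (nat-% a)) (trans (cong nat e) (nat-% b))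

  nat-∸ : ∀ {k} → k ℕ.≤ p → nat (p ℕ.∸ k) ≡ - nat k
  nat-∸ {k} k≤p = -‿zero⇒≡ (trans (cong (nat (p ℕ.∸ k) +_) (-‿involutive (nat k)))
    (trans (sym (nat-+ (p ℕ.∸ k) k)) (trans (cong nat (ℕₚ.m∸n+n≡m k≤p)) char)))

  nat-3 : nat 3 ≡ three
  nat-3 = solve 0 (num 1 :+ (num 1 :+ (num 1 :+ num 0)) := num 3) refl

  open Admissibility K

  nat-4 : nat 4 ≡ four
  nat-4 = solve 0 (num 1 :+ (num 1 :+ (num 1 :+ (num 1 :+ num 0))) := num 4) refl

  open ModularSearch p

  isUnit-sound : ∀ u → T (isUnit u) → nat u ≢ 0#
  isUnit-sound u t u≡0 = 0≢1 (begin
    0#  ≡⟨ 𝔽.zeroˡ (nat i) ⟨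
    0# * nat i  ≡⟨ cong (_* nat i) u≡0 ⟨
    nat u * nat i  ≡⟨ nat-* u i ⟨
    nat (u ℕ.* i)  ≡⟨ nat-% (u ℕ.* i) ⟨
    nat ((u ℕ.* i) % p)  ≡⟨ cong nat (ℕₚ.≡ᵇ⇒≡ ((u ℕ.* i) % p) 1 t) ⟩
    nat 1  ≡⟨ nat-1 ⟩
    1#  ∎)
    where
    open ≡-Reasoning
    i = power 14 u (p ℕ.∸ 2)

  isSquare-sound : ∀ v → T (isSquare v) → Square⁺ (nat v)
  isSquare-sound v t = nat r , isUnit-sound r (proj₂ both) ,
      trans (sym (nat-* r r)) (nat-cong-% (r ℕ.* r) v (ℕₚ.≡ᵇ⇒≡ ((r ℕ.* r) % p) (v % p) (proj₁ both)))
    where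
    r = power 14 v ((p ℕ.+ 1) / 4)
    both : T ((r ℕ.* r) % p ≡ᵇ v % p) × T (isUnit r)
    both = Equivalence.to (T-∧ {(r ℕ.* r) % p ≡ᵇ v % p}) t

  isAdmissible-sound : 4 ℕ.≤ p → ∀ u → T (isAdmissible u) → Admissible (nat u)
  isAdmissible-sound 4≤p u t with Equivalence.to (T-∧ {isSquare (1 ℕ.+ u ℕ.* u)}) t
  ... | s₁ , t with Equivalence.to (T-∧ {isSquare (1 ℕ.+ (p ℕ.∸ 3) ℕ.* (u ℕ.* u))}) t
  ... | s₂ , t with Equivalence.to (T-∧ {isSquare (u ℕ.* u ℕ.+ 4 ℕ.* u ℕ.+ 1)}) t
  ... | s₃ , t with Equivalence.to (T-∧ {isSquare (u ℕ.* u ℕ.+ (p ℕ.∸ 4) ℕ.* u ℕ.+ 1)}) t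
  ... | s₄ , s₅ = isUnit-sound u s₅
    , subst Square⁺ (trans (nat-+ 1 (u ℕ.* u)) (cong₂ _+_ nat-1 (nat-* u u))) (isSquare-sound (1 ℕ.+ u ℕ.* u) s₁)
    , subst Square⁺ (trans (nat-+ 1 ((p ℕ.∸ 3) ℕ.* (u ℕ.* u))) (trans (cong₂ _+_ nat-1 (trans (nat-* (p ℕ.∸ 3) (u ℕ.* u))
        (cong₂ _*_ (trans (nat-∸ (ℕₚ.<⇒≤ 4≤p)) (cong -_ nat-3)) (nat-* u u))))
        (solve 1 (λ u → num 1 :+ :- num 3 :* (u :* u) := num 1 :- num 3 :* (u :* u)) refl (nat u)))) (isSquare-sound (1 ℕ.+ (p ℕ.∸ 3) ℕ.* (u ℕ.* u)) s₂)
    , subst Square⁺ (trans (nat-+ (u ℕ.* u ℕ.+ 4 ℕ.* u) 1) (cong₂ _+_ (trans (nat-+ (u ℕ.* u) (4 ℕ.* u))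
        (cong₂ _+_ (nat-* u u) (trans (nat-* 4 u) (cong (_* nat u) nat-4)))) nat-1)) (isSquare-sound (u ℕ.* u ℕ.+ 4 ℕ.* u ℕ.+ 1) s₃)
    , subst Square⁺ (trans (nat-+ (u ℕ.* u ℕ.+ (p ℕ.∸ 4) ℕ.* u) 1) (trans (cong₂ _+_ (trans (nat-+ (u ℕ.* u) ((p ℕ.∸ 4) ℕ.* u))
        (cong₂ _+_ (nat-* u u) (trans (nat-* (p ℕ.∸ 4) u) (cong (_* nat u) (trans (nat-∸ 4≤p) (cong -_ nat-4)))))) nat-1)
        (solve 1 (λ u → u :* u :+ :- num 4 :* u :+ num 1 := u :* u :- num 4 :* u :+ num 1) refl (nat u)))) (isSquare-sound (u ℕ.* u ℕ.+ (p ℕ.∸ 4) ℕ.* u ℕ.+ 1) s₄)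

  settled-sound : 4 ℕ.≤ p → ∀ D L → T (settled D L) → ∃ Admissible
  settled-sound 4≤p D L t with Equivalence.to (T-∨ {hasDivisorIn D}) t
  ... | inj₂ found = let u , adm = Any.satisfied (any⁻ isAdmissible L found) in nat u , isAdmissible-sound 4≤p u adm
  ... | inj₁ divisor = contradiction prime (composite⇒¬prime (composite′ (Any.satisfied (any⁻ _ D divisor))))
    where
    composite′ : (∃ λ d → T ((2 ℕ.+ d <ᵇ p) ∧ (p % (2 ℕ.+ d) ≡ᵇ 0))) → Composite p
    composite′ (d , t) with Equivalence.to (T-∧ {2 ℕ.+ d <ᵇ p}) t
    ... | d<p , p%d≡0 = composite (ℕₚ.<ᵇ⇒< (2 ℕ.+ d) p d<p) (m%n≡0⇒n∣m p (2 ℕ.+ d) (ℕₚ.≡ᵇ⇒≡ (p % (2 ℕ.+ d)) 0 p%d≡0))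

-- Explicit cubic extensions for 11³ and 19³

module CubicModel (p c₀ c₁ c₂ : ℕ) .⦃ _ : NonZero p ⦄ where

  Triple : Set
  Triple = ℕ × ℕ × ℕ

  -- Multiplication by x modulo x³ = c₀ + c₁ x + c₂ x².
  step : Triple → Triple
  step (a , b , c) = (c ℕ.* c₀) % p , (a ℕ.+ c ℕ.* c₁) % p , (b ℕ.+ c ℕ.* c₂) % p

  x^ : ℕ → Triple
  x^ zero                = 1 , 0 , 0
  x^ (suc zero)          = 0 , 1 , 0
  x^ (suc (suc zero))    = 0 , 0 , 1
  x^ (suc (suc (suc k))) = step (x^ (suc (suc k)))

  _≡³ᵇ_ : Triple → Triple → Bool
  (a , b , c) ≡³ᵇ (a′ , b′ , c′) = (a ≡ᵇ a′) ∧ (b ≡ᵇ b′) ∧ (c ≡ᵇ c′)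

  ≡³ᵇ⇒≡ : ∀ s t → T (s ≡³ᵇ t) → s ≡ t
  ≡³ᵇ⇒≡ (a , b , c) (a′ , b′ , c′) e with Equivalence.to (T-∧ {a ≡ᵇ a′}) e
  ... | e₁ , e with Equivalence.to (T-∧ {b ≡ᵇ b′}) e
  ... | e₂ , e₃ = cong₂ _,_ (ℕₚ.≡ᵇ⇒≡ a a′ e₁) (cong₂ _,_ (ℕₚ.≡ᵇ⇒≡ b b′ e₂) (ℕₚ.≡ᵇ⇒≡ c c′ e₃))

  -- x^q = x modulo the cubic forces a root of it in every field with q elements; the even powers of
  -- x then exhibit the four quadratics at that root as squares.
  certificate : ℕ → ℕ → ℕ → ℕ → ℕ → Bool
  certificate q n₁ n₂ n₃ n₄ = (x^ q ≡³ᵇ (0 , 1 , 0)) ∧ (x^ (n₁ ℕ.+ n₁) ≡³ᵇ (1 , 0 , 1)) ∧ (x^ (n₂ ℕ.+ n₂) ≡³ᵇ (1 , 0 , p ℕ.∸ 3))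
    ∧ (x^ (n₃ ℕ.+ n₃) ≡³ᵇ (1 , 4 , 1)) ∧ (x^ (n₄ ℕ.+ n₄) ≡³ᵇ (1 , p ℕ.∸ 4 , 1))

module CubicField {q : ℕ} (K : FiniteField q) {p n : ℕ} (prime : Prime p) (q≡pⁿ : q ≡ p ℕ.^ n) .⦃ _ : NonZero p ⦄
                  (4≤p : 4 ℕ.≤ p) (c₀ c₁ c₂ : ℕ) where
  open FiniteField K
  open FieldTheory K
  open FieldPolynomials K
  open NaturalsInField K {p} {n} prime q≡pⁿ
  open Admissibility K
  open CubicModel p c₀ c₁ c₂
  open 𝔽S

  cubic : Poly
  cubic = - nat c₀ ∷ - nat c₁ ∷ - nat c₂ ∷ 1# ∷ []

  ⟪_⟫ : Triple → Poly
  ⟪ a , b , c ⟫ = nat a ∷ nat b ∷ nat c ∷ []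

  ⟪step⟫ : ∀ a b c → 0# ∷ ⟪ a , b , c ⟫ ≋ ⟪ step (a , b , c) ⟫ +ₚ (nat c ∷ []) *ₚ cubic
  ⟪step⟫ a b c = ≋-sym (≋-trans (+ₚ-cong ≋-refl (const-* (nat c) cubic)) (coeffwise λ i →
      trans (coeff-+ ⟪ step (a , b , c) ⟫ (map (nat c *_) cubic) i) (at i)))
    where
    at : ∀ i → coeff ⟪ step (a , b , c) ⟫ i + coeff (map (nat c *_) cubic) i ≡ coeff (0# ∷ ⟪ a , b , c ⟫) i
    at 0 = trans (cong (_+ nat c * - nat c₀) (trans (nat-% (c ℕ.* c₀)) (nat-* c c₀)))
      (solve 2 (λ x y → x :* y :+ x :* (:- y) := num 0) refl (nat c) (nat c₀))
    at 1 = trans (cong (_+ nat c * - nat c₁) (trans (nat-% (a ℕ.+ c ℕ.* c₁)) (trans (nat-+ a _) (cong (nat a +_) (nat-* c c₁)))))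
      (solve 3 (λ a x y → (a :+ x :* y) :+ x :* (:- y) := a) refl (nat a) (nat c) (nat c₁))
    at 2 = trans (cong (_+ nat c * - nat c₂) (trans (nat-% (b ℕ.+ c ℕ.* c₂)) (trans (nat-+ b _) (cong (nat b +_) (nat-* c c₂)))))
      (solve 3 (λ a x y → (a :+ x :* y) :+ x :* (:- y) := a) refl (nat b) (nat c) (nat c₂))
    at 3 = solve 1 (λ x → num 0 :+ x :* num 1 := x) refl (nat c)
    at (suc (suc (suc (suc i)))) = 𝔽.+-identityˡ 0#

  -- The length of the cofactor is tracked because `cubic-root` weighs it against q roots. The
  -- induction starts at X², the last power that `x^` does not obtain from `step`.
  X^-mod-cubic : ∀ k → ∃ λ w → X ^ₚ (2 ℕ.+ k) ≋ ⟪ x^ (2 ℕ.+ k) ⟫ +ₚ cubic *ₚ w × length w ≡ k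
  X^-mod-cubic zero = [] , (begin
    X *ₚ (X *ₚ (1# ∷ []))  ≈⟨ ≋-trans (*ₚ-congˡ X (X-* (1# ∷ []))) (X-* (0# ∷ 1# ∷ [])) ⟩
    0# ∷ 0# ∷ 1# ∷ []  ≈⟨ ∷-cong refl (∷-cong refl (∷-cong (sym nat-1) ≋-refl)) ⟩
    ⟪ 0 , 0 , 1 ⟫  ≈⟨ +ₚ-identityʳ _ ⟨
    ⟪ 0 , 0 , 1 ⟫ +ₚ []  ≈⟨ +ₚ-cong ≋-refl (*ₚ-zeroʳ cubic) ⟨
    ⟪ 0 , 0 , 1 ⟫ +ₚ cubic *ₚ []  ∎) , refl
    where open 𝕏R
  X^-mod-cubic (suc k) with x^ (2 ℕ.+ k) | X^-mod-cubic k
  ... | a , b , c | w , e , len = nat c ∷ w , (begin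
    X *ₚ X ^ₚ (2 ℕ.+ k)  ≈⟨ *ₚ-congˡ X e ⟩
    X *ₚ (⟪ a , b , c ⟫ +ₚ cubic *ₚ w)  ≈⟨ *ₚ-distribˡ X ⟪ a , b , c ⟫ (cubic *ₚ w) ⟩
    X *ₚ ⟪ a , b , c ⟫ +ₚ X *ₚ (cubic *ₚ w)  ≈⟨ +ₚ-cong (≋-trans (X-* ⟪ a , b , c ⟫) (⟪step⟫ a b c)) ≋-refl ⟩
    (⟪ step (a , b , c) ⟫ +ₚ (nat c ∷ []) *ₚ cubic) +ₚ X *ₚ (cubic *ₚ w)
      ≈⟨ 𝕏S.solve 5 (λ t c m X w → (t 𝕏S.:+ c 𝕏S.:* m) 𝕏S.:+ X 𝕏S.:* (m 𝕏S.:* w) 𝕏S.:= t 𝕏S.:+ m 𝕏S.:* (c 𝕏S.:+ X 𝕏S.:* w)) ≋-refl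
           ⟪ step (a , b , c) ⟫ (nat c ∷ []) cubic X w ⟩
    ⟪ step (a , b , c) ⟫ +ₚ cubic *ₚ ((nat c ∷ []) +ₚ X *ₚ w)  ≈⟨ +ₚ-cong ≋-refl (*ₚ-congˡ cubic (∷-as-sum (nat c) w)) ⟨
    ⟪ step (a , b , c) ⟫ +ₚ cubic *ₚ (nat c ∷ w)  ∎) , cong suc len
    where open 𝕏R

  value-X^ : ∀ α k → value α (X ^ₚ k) ≡ α ^ k
  value-X^ α k = trans (Hom.^-homo (Value.evalHom α) X k) (^-congˡ k (Value.eval-X α))

  -- X^q - X is a multiple of the cubic with cofactor of degree less than q, so the cubic has a root.
  cubic-root : ∀ k → q ≡ 2 ℕ.+ k → x^ q ≡ (0 , 1 , 0) → ∃ λ α → value α cubic ≡ 0#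
  cubic-root k q≡ x^q with any? (λ α → value α cubic ≟ 0#) elements
  ... | yes some = Any.satisfied some
  ... | no none  = contradiction
      (root-count w elements w≉0 elements-unique (All.tabulate λ {α} _ → root α))
      (ℕₚ.≤⇒≯ (ℕₚ.≤-trans (ℕₚ.≤-reflexive (proj₂ (proj₂ division))) (ℕₚ.≤-trans (ℕₚ.m≤n+m k 2) (ℕₚ.≤-reflexive (trans (sym q≡) (sym length-elements))))))
    where
    division = X^-mod-cubic k
    w = proj₁ division
    X^q≋ : X ^ₚ q ≋ X +ₚ cubic *ₚ w
    X^q≋ = ≋-trans (𝕏.reflexive (cong (X ^ₚ_) q≡)) (≋-trans (proj₁ (proj₂ division)) (+ₚ-cong
      (≋-trans (𝕏.reflexive (cong ⟪_⟫ (trans (cong x^ (sym q≡)) x^q))) (∷-cong refl (∷-cong nat-1 (∷-zero refl ≋-refl)))) ≋-refl))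
    w≉0 : w ≉0
    w≉0 w≋0 = 0≢1 (trans (sym (coeff-X^-* q (1# ∷ []) {1} (subst (2 ℕ.≤_) (sym q≡) (ℕₚ.m≤m+n 2 k))))
      (coeff-≈ (≋-trans (𝕏.*-identityʳ (X ^ₚ q)) (≋-trans X^q≋ (≋-trans (+ₚ-cong ≋-refl (≋-trans (*ₚ-congˡ cubic w≋0) (*ₚ-zeroʳ cubic))) (+ₚ-identityʳ X)))) 1))
    root : ∀ α → value α w ≡ 0#
    root α = *-cancelˡ (λ z → none (lose (elements-complete α) z)) (trans product≡0 (sym (𝔽.zeroʳ _)))
      where
      product≡0 : value α cubic * value α w ≡ 0#
      product≡0 = +-identityʳ-unique α _ (begin
        α + value α cubic * value α w  ≡⟨ cong₂ _+_ (Value.eval-X α) (Value.eval-* α cubic w) ⟨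
        value α X + value α (cubic *ₚ w)  ≡⟨ Value.eval-+ α X (cubic *ₚ w) ⟨
        value α (X +ₚ cubic *ₚ w)  ≡⟨ Value.eval-cong α X^q≋ ⟨
        value α (X ^ₚ q)  ≡⟨ value-X^ α q ⟩
        α ^ q  ≡⟨ fermat α ⟩
        α  ∎)
        where open ≡-Reasoning

  module Root (α : Carrier) (root : value α cubic ≡ 0#) where

    power-of-root : ∀ k {t} → x^ (suc k ℕ.+ suc k) ≡ t → α ^ suc k * α ^ suc k ≡ value α ⟪ t ⟫
    power-of-root k refl = begin
      α ^ suc k * α ^ suc k  ≡⟨ ^-homo-* α (suc k) (suc k) ⟨
      α ^ (suc k ℕ.+ suc k)  ≡⟨ cong (α ^_) even ⟩
      α ^ (2 ℕ.+ (k ℕ.+ k))  ≡⟨ value-X^ α (2 ℕ.+ (k ℕ.+ k)) ⟨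
      value α (X ^ₚ (2 ℕ.+ (k ℕ.+ k)))  ≡⟨ Value.eval-cong α (proj₁ (proj₂ division)) ⟩
      value α (⟪ x^ (2 ℕ.+ (k ℕ.+ k)) ⟫ +ₚ cubic *ₚ w)  ≡⟨ Value.eval-+ α ⟪ x^ (2 ℕ.+ (k ℕ.+ k)) ⟫ (cubic *ₚ w) ⟩
      value α ⟪ x^ (2 ℕ.+ (k ℕ.+ k)) ⟫ + value α (cubic *ₚ w)
        ≡⟨ cong (_ +_) (trans (Value.eval-* α cubic w) (trans (cong (_* value α w) root) (𝔽.zeroˡ _))) ⟩
      value α ⟪ x^ (2 ℕ.+ (k ℕ.+ k)) ⟫ + 0#  ≡⟨ 𝔽.+-identityʳ _ ⟩
      value α ⟪ x^ (2 ℕ.+ (k ℕ.+ k)) ⟫  ≡⟨ cong (λ j → value α ⟪ x^ j ⟫) even ⟨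
      value α ⟪ x^ (suc k ℕ.+ suc k) ⟫  ∎
      where
      open ≡-Reasoning
      division = X^-mod-cubic (k ℕ.+ k)
      w = proj₁ division
      even : suc k ℕ.+ suc k ≡ 2 ℕ.+ (k ℕ.+ k)
      even = cong suc (ℕₚ.+-suc k k)

    value-⟪⟫ : ∀ a b c {x y z} → nat a ≡ x → nat b ≡ y → nat c ≡ z → value α ⟪ a , b , c ⟫ ≡ x + y * α + z * (α * α)
    value-⟪⟫ a b c refl refl refl =
      solve 4 (λ α a b c → a :+ α :* (b :+ α :* (c :+ α :* num 0)) := a :+ b :* α :+ c :* (α :* α)) refl α (nat a) (nat b) (nat c)

    admissible : ∀ n₁ n₂ n₃ n₄ → x^ (suc n₁ ℕ.+ suc n₁) ≡ (1 , 0 , 1) → x^ (suc n₂ ℕ.+ suc n₂) ≡ (1 , 0 , p ℕ.∸ 3) →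
      x^ (suc n₃ ℕ.+ suc n₃) ≡ (1 , 4 , 1) → x^ (suc n₄ ℕ.+ suc n₄) ≡ (1 , p ℕ.∸ 4 , 1) → Admissible α
    admissible n₁ n₂ n₃ n₄ e₁ e₂ e₃ e₄ = α≢0
      , (α ^ suc n₁ , ^-≢0 (suc n₁) α≢0 , v₁)
      , (α ^ suc n₂ , ^-≢0 (suc n₂) α≢0 , trans (power-of-root n₂ e₂) (trans (value-⟪⟫ 1 0 (p ℕ.∸ 3) nat-1 refl (trans (nat-∸ (ℕₚ.<⇒≤ 4≤p)) (cong -_ nat-3)))
          (solve 1 (λ u → num 1 :+ num 0 :* u :+ :- num 3 :* (u :* u) := num 1 :- num 3 :* (u :* u)) refl α)))
      , (α ^ suc n₃ , ^-≢0 (suc n₃) α≢0 , trans (power-of-root n₃ e₃) (trans (value-⟪⟫ 1 4 1 nat-1 nat-4 nat-1)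
          (solve 1 (λ u → num 1 :+ num 4 :* u :+ num 1 :* (u :* u) := u :* u :+ num 4 :* u :+ num 1) refl α)))
      , (α ^ suc n₄ , ^-≢0 (suc n₄) α≢0 , trans (power-of-root n₄ e₄) (trans (value-⟪⟫ 1 (p ℕ.∸ 4) 1 nat-1 (trans (nat-∸ 4≤p) (cong -_ nat-4)) nat-1)
          (solve 1 (λ u → num 1 :+ :- num 4 :* u :+ num 1 :* (u :* u) := u :* u :- num 4 :* u :+ num 1) refl α)))
      where
      v₁ : α ^ suc n₁ * α ^ suc n₁ ≡ 1# + α * α
      v₁ = trans (power-of-root n₁ e₁) (trans (value-⟪⟫ 1 0 1 nat-1 refl nat-1)
        (solve 1 (λ u → num 1 :+ num 0 :* u :+ num 1 :* (u :* u) := num 1 :+ u :* u) refl α))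
      -- At α = 0 the first certified equation would read 0 = 1.
      α≢0 : α ≢ 0#
      α≢0 α≡0 = 0≢1 (begin
        0#  ≡⟨ 𝔽.zeroˡ _ ⟨
        0# * (α ^ n₁ * α ^ suc n₁)  ≡⟨ cong (_* (α ^ n₁ * α ^ suc n₁)) α≡0 ⟨
        α * (α ^ n₁ * α ^ suc n₁)  ≡⟨ 𝔽.*-assoc _ _ _ ⟨
        α ^ suc n₁ * α ^ suc n₁  ≡⟨ v₁ ⟩
        1# + α * α  ≡⟨ cong (λ x → 1# + x * α) α≡0 ⟩
        1# + 0# * α  ≡⟨ trans (cong (1# +_) (𝔽.zeroˡ α)) (𝔽.+-identityʳ 1#) ⟩
        1#  ∎)
        where open ≡-Reasoning

  certified : ∀ k n₁ n₂ n₃ n₄ → q ≡ 2 ℕ.+ k → T (certificate (2 ℕ.+ k) (suc n₁) (suc n₂) (suc n₃) (suc n₄)) → ∃ Admissible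
  certified k n₁ n₂ n₃ n₄ q≡ t with Equivalence.to (T-∧ {x^ (2 ℕ.+ k) ≡³ᵇ (0 , 1 , 0)}) t
  ... | t₀ , t with Equivalence.to (T-∧ {x^ (suc n₁ ℕ.+ suc n₁) ≡³ᵇ (1 , 0 , 1)}) t
  ... | t₁ , t with Equivalence.to (T-∧ {x^ (suc n₂ ℕ.+ suc n₂) ≡³ᵇ (1 , 0 , p ℕ.∸ 3)}) t
  ... | t₂ , t with Equivalence.to (T-∧ {x^ (suc n₃ ℕ.+ suc n₃) ≡³ᵇ (1 , 4 , 1)}) t
  ... | t₃ , t₄ =
    let α , root = cubic-root k q≡ (trans (cong x^ q≡) (≡³ᵇ⇒≡ (x^ (2 ℕ.+ k)) _ t₀))
    in α , Root.admissible α root n₁ n₂ n₃ n₄ (≡³ᵇ⇒≡ (x^ (suc n₁ ℕ.+ suc n₁)) _ t₁) (≡³ᵇ⇒≡ (x^ (suc n₂ ℕ.+ suc n₂)) _ t₂)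
             (≡³ᵇ⇒≡ (x^ (suc n₃ ℕ.+ suc n₃)) _ t₃) (≡³ᵇ⇒≡ (x^ (suc n₄ ℕ.+ suc n₄)) _ t₄)

-- The exponents are half the discrete logarithms of the four quadratics to the base x.
certificate-11³ : T (CubicModel.certificate 11 2 3 5 1331 59 288 390 313)
certificate-11³ = tt

certificate-19³ : T (CubicModel.certificate 19 2 3 3 6859 293 1914 1947 346)
certificate-19³ = tt

-- Squares modulo 8 are 0, 1 and 4, so x² must be 1. With a = 1 this excludes even n, and with a = p
-- it gives p ≡ 3 mod 8 for odd n.
residue-3-mod-8 : ∀ a x → (a ℕ.* (x ℕ.* x)) % 8 ≡ 3 → a % 8 ≡ 3
residue-3-mod-8 a x e = trans (sym (Finₚ.toℕ-fromℕ< (m%n<n a 8))) (table (Fin.fromℕ< (m%n<n a 8)) (Fin.fromℕ< (m%n<n x 8))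
  (subst₂ (λ a x → (a ℕ.* (x ℕ.* x)) % 8 ≡ 3) (sym (Finₚ.toℕ-fromℕ< (m%n<n a 8))) (sym (Finₚ.toℕ-fromℕ< (m%n<n x 8))) (trans reduce e)))
  where
  table : ∀ (i j : Fin 8) → (toℕ i ℕ.* (toℕ j ℕ.* toℕ j)) % 8 ≡ 3 → toℕ i ≡ 3
  table = from-yes (Finₚ.all? {8} λ i → Finₚ.all? {8} λ j → ((toℕ i ℕ.* (toℕ j ℕ.* toℕ j)) % 8 ℕₚ.≟ 3) →-dec (toℕ i ℕₚ.≟ 3))
  open ≡-Reasoning
  reduce : (a % 8 ℕ.* (x % 8 ℕ.* (x % 8))) % 8 ≡ (a ℕ.* (x ℕ.* x)) % 8
  reduce = begin
    (a % 8 ℕ.* (x % 8 ℕ.* (x % 8))) % 8  ≡⟨ %-distribˡ-* (a % 8) (x % 8 ℕ.* (x % 8)) 8 ⟩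
    (a % 8 % 8 ℕ.* ((x % 8 ℕ.* (x % 8)) % 8)) % 8  ≡⟨ cong₂ (λ u v → (u ℕ.* v) % 8) (m%n%n≡m%n a 8) (sym (%-distribˡ-* x x 8)) ⟩
    (a % 8 ℕ.* ((x ℕ.* x) % 8)) % 8  ≡⟨ %-distribˡ-* a (x ℕ.* x) 8 ⟨
    (a ℕ.* (x ℕ.* x)) % 8  ∎

≡3-mod-8⇒ : ∀ q → q % 8 ≡ 3 → q ≡ 3 ℕ.+ 8 ℕ.* (q / 8)
≡3-mod-8⇒ q e = trans (m≡m%n+[m/n]*n q 8) (cong₂ ℕ._+_ e (ℕₚ.*-comm (q / 8) 8))

even-or-odd : ∀ n → ∃ λ k → n ≡ k ℕ.+ k ⊎ n ≡ suc (k ℕ.+ k)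
even-or-odd zero = 0 , inj₁ refl
even-or-odd (suc n) with even-or-odd n
... | k , inj₁ e = k , inj₂ (cong suc e)
... | k , inj₂ e = suc k , inj₁ (trans (cong suc e) (sym (cong suc (ℕₚ.+-suc k k))))

odd-prime∤3 : ∀ {p} → Prime p → p ≢ 3 → p ∤ 3
odd-prime∤3 {p} p-prime p≢3 p∣3 with prime⇒irreducible (from-yes (prime? 3)) p∣3
... | inj₁ refl = ℕ.nonTrivial⇒≢1 ⦃ prime⇒nonTrivial p-prime ⦄ refl
... | inj₂ p≡3  = p≢3 p≡3

-- 51 is the first number above 43 that is 3 modulo 8, and 1694 steps of 8 reach 13603. The trial
-- divisors 2, ..., 117 go beyond the square root of every number in that range; the bound 110 on
-- the candidates u is found by computation.
settled-51+8* : ℕ → Bool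
settled-51+8* k = ModularSearch.settled (51 ℕ.+ 8 ℕ.* k) (upTo 116) (upTo 110)

opaque
  unfolding ModularSearch.power

  all-settled : T (all settled-51+8* (upTo 1694))
  all-settled = _

settled-at : ∀ k → k ℕ.< 1694 → T (settled-51+8* k)
settled-at k k< = All.lookup (all⁺ settled-51+8* (upTo 1694) all-settled) (∈-upTo⁺ k<)

module Existence {q : ℕ} (K : FiniteField q) where
  open Admissibility K

  module _ {p n : ℕ} (p-prime : Prime p) (q≡pⁿ : q ≡ p ℕ.^ n) where
    private instance
      p-nonZero : NonZero p
      p-nonZero = prime⇒nonZero p-prime

    prime-field : ∀ k → k ℕ.< 1694 → p ≡ 51 ℕ.+ 8 ℕ.* k → ∃ Admissible
    prime-field k k< refl =
      NaturalsInField.settled-sound K {p} {n} p-prime q≡pⁿ (ℕₚ.m≤m+n 4 _) (upTo 116) (upTo 110) (settled-at k k<)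

    cubic-field-11 : p ≡ 11 → n ≡ 3 → ∃ Admissible
    cubic-field-11 refl refl = CubicField.certified K {11} {3} p-prime q≡pⁿ (ℕₚ.m≤m+n 4 _) 2 3 5 1329 58 287 389 312 q≡pⁿ certificate-11³

    cubic-field-19 : p ≡ 19 → n ≡ 3 → ∃ Admissible
    cubic-field-19 refl refl = CubicField.certified K {19} {3} p-prime q≡pⁿ (ℕₚ.m≤m+n 4 _) 2 3 3 6857 292 1913 1946 345 q≡pⁿ certificate-19³

    -- The candidates for p are 11, 19 and numbers from 27 on. Since 27³ = 19683 and 11⁵ = 161051
    -- exceed 13603, only n = 1 and the cubes of 11 and 19 remain.
    small-field : ∀ m → p % 8 ≡ 3 → p ≢ 3 → q ≡ 3 ℕ.+ 8 ℕ.* m → m ℕ.< 1700 → 43 ℕ.< q → ∀ k → n ≡ suc (k ℕ.+ k) → ∃ Admissible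
    small-field m p%8 p≢3 q≡ m< q> zero refl = prime-field (m ℕ.∸ 6) (ℕₚ.+-cancelˡ-< 6 _ _ (subst (ℕ._< 1700) (sym (ℕₚ.m+[n∸m]≡n 6≤m)) m<))
        (trans (sym (trans q≡pⁿ (ℕₚ.*-identityʳ p))) (trans q≡ (trans (cong (λ m → 3 ℕ.+ 8 ℕ.* m) (sym (ℕₚ.m+[n∸m]≡n 6≤m)))
          (cong (3 ℕ.+_) (ℕₚ.*-distribˡ-+ 8 6 (m ℕ.∸ 6))))))
      where
      6≤m : 6 ℕ.≤ m
      -- 43 = 3 + 8 · 5, so q > 43 forces m > 5.
      6≤m = ℕₚ.*-cancelˡ-< 8 5 m (ℕₚ.+-cancelˡ-< 3 40 (8 ℕ.* m) (subst (43 ℕ.<_) q≡ q>))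
    small-field m p%8 p≢3 q≡ m< q> (suc zero) refl = by-size (p / 8) (≡3-mod-8⇒ p p%8)
      where
      by-size : ∀ j → p ≡ 3 ℕ.+ 8 ℕ.* j → ∃ Admissible
      by-size 0 p≡3 = contradiction p≡3 p≢3
      by-size 1 p≡11 = cubic-field-11 p≡11 refl
      by-size 2 p≡19 = cubic-field-19 p≡19 refl
      by-size (suc (suc (suc j))) p≡ = contradiction
        (ℕₚ.≤-trans (ℕₚ.^-monoˡ-≤ 3 27≤p) (ℕₚ.≤-trans (ℕₚ.≤-reflexive (trans (sym q≡pⁿ) q≡)) (ℕₚ.+-monoʳ-≤ 3 (ℕₚ.*-monoʳ-≤ 8 (ℕₚ.<⇒≤ m<)))))
        (from-no (19683 ℕₚ.≤? 13603))
        where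
        27≤p : 27 ℕ.≤ p
        27≤p = subst (27 ℕ.≤_) (sym p≡) (ℕₚ.+-monoʳ-≤ 3 (ℕₚ.*-monoʳ-≤ 8 {3} (s≤s (s≤s (s≤s z≤n)))))
    small-field m p%8 p≢3 q≡ m< q> (suc (suc k)) refl = contradiction
        (ℕₚ.≤-trans (ℕₚ.^-monoˡ-≤ 5 11≤p) (ℕₚ.≤-trans (ℕₚ.^-monoʳ-≤ p (s≤s (subst (4 ℕ.≤_) (sym k+k) (ℕₚ.m≤m+n 4 _))))
          (ℕₚ.≤-trans (ℕₚ.≤-reflexive (trans (sym q≡pⁿ) q≡)) (ℕₚ.+-monoʳ-≤ 3 (ℕₚ.*-monoʳ-≤ 8 (ℕₚ.<⇒≤ m<))))))
        (from-no (161051 ℕₚ.≤? 13603))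
      where
      k+k : suc (suc k) ℕ.+ suc (suc k) ≡ 4 ℕ.+ (k ℕ.+ k)
      k+k = cong (2 ℕ.+_) (trans (ℕₚ.+-suc k (suc k)) (cong suc (ℕₚ.+-suc k k)))
      by-size : ∀ j → p ≡ 3 ℕ.+ 8 ℕ.* j → 11 ℕ.≤ p
      by-size zero p≡3 = contradiction p≡3 p≢3
      by-size (suc j) p≡ = subst (11 ℕ.≤_) (sym p≡) (ℕₚ.+-monoʳ-≤ 3 (ℕₚ.*-monoʳ-≤ 8 {1} (s≤s z≤n)))
      11≤p : 11 ℕ.≤ p
      11≤p = by-size (p / 8) (≡3-mod-8⇒ p p%8)

  three≢0 : ∀ {p n} → Prime p → p ≢ 3 → q ≡ p ℕ.^ n → FiniteField.three K ≢ FiniteField.0# K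
  three≢0 {p} {n} p-prime p≢3 q≡pⁿ 3≡0 = FieldTheory.Characteristic.×1-≢0 K {p} {n} p-prime q≡pⁿ (odd-prime∤3 p-prime p≢3)
    (trans (NaturalsInField.nat-3 K {p} {n} p-prime q≡pⁿ ⦃ prime⇒nonZero p-prime ⦄) 3≡0)

  exists-admissible : ∀ {p n} → Prime p → p ≢ 3 → q ≡ p ℕ.^ n → q % 8 ≡ 3 → 43 ℕ.< q → ∃ Admissible
  exists-admissible {p} {n} p-prime p≢3 q≡pⁿ q%8 q> with 1700 ℕₚ.≤? q / 8
  ... | yes large = LargeField.admissible-exists K {p} {n} p-prime q≡pⁿ (q / 8) (≡3-mod-8⇒ q q%8) (three≢0 {p} {n} p-prime p≢3 q≡pⁿ) large
  ... | no small with even-or-odd n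
  ...   | k , inj₁ refl = contradiction
          (residue-3-mod-8 1 (p ℕ.^ k) (trans (cong (_% 8) (trans (ℕₚ.*-identityˡ _) (trans (sym (ℕₚ.^-distribˡ-+-* p k k)) (sym q≡pⁿ)))) q%8)) λ ()
  ...   | k , inj₂ refl = small-field p-prime q≡pⁿ (q / 8)
          (residue-3-mod-8 p (p ℕ.^ k) (trans (cong (_% 8) (trans (cong (p ℕ.*_) (sym (ℕₚ.^-distribˡ-+-* p k k))) (sym q≡pⁿ))) q%8))
          p≢3 (≡3-mod-8⇒ q q%8) (ℕₚ.≰⇒> small) q> k refl

-- Solutions of the difference equation

unique-⊆-length : ∀ {A : Set} {L M : List A} → Unique L → (∀ {x} → x ∈ L → x ∈ M) → length L ℕ.≤ length M
unique-⊆-length {L = []}    _            _   = z≤n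
unique-⊆-length {A} {L = x ∷ L} (x∉L ∷ uniq) L⊆M with ∈-∃++ (L⊆M (here refl))
... | ys , zs , refl = ℕₚ.≤-trans (s≤s (unique-⊆-length uniq L⊆rest)) (ℕₚ.≤-reflexive lengths)
  where
  L⊆rest : ∀ {y} → y ∈ L → y ∈ ys ++ zs
  L⊆rest y∈L with ∈-++⁻ ys (L⊆M (there y∈L))
  ... | inj₁ y∈ys         = ∈-++⁺ˡ y∈ys
  ... | inj₂ (here refl)  = contradiction refl (All.lookup x∉L y∈L)
  ... | inj₂ (there y∈zs) = ∈-++⁺ʳ ys y∈zs
  lengths : suc (length (ys ++ zs)) ≡ length (ys ++ x ∷ zs)
  lengths = trans (cong suc (length-++ ys)) (trans (sym (ℕₚ.+-suc (length ys) (length zs))) (sym (length-++ ys)))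

module Uniformity {q : ℕ} (K : FiniteField q) {p n : ℕ} (prime : Prime p) (q≡pⁿ : q ≡ p ℕ.^ n)
                  (m : ℕ) (q≡3+8m : q ≡ 3 ℕ.+ 8 ℕ.* m) (3≢0 : FiniteField.three K ≢ FiniteField.0# K) where
  open FiniteField K
  open FieldTheory K
  open QuadraticCharacter K {p} {n} prime q≡pⁿ m q≡3+8m
  open Admissibility K
  open 𝔽S

  two : Carrier
  two = 1# + 1#

  4≢0 : four ≢ 0#
  4≢0 = subst (_≢ 0#) (solve 0 (num 2 :* num 2 := num 4) refl) (*-≢0 2≢0 2≢0)

  -- As -1 is a non-square, `N` certifies a non-square x by a root of -x; both nonzero cases thus
  -- carry witnesses that can be multiplied.
  data Sign (x : Carrier) : Set where
    P : Square⁺ x → Sign x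
    N : Square⁺ (- x) → Sign x
    Z : x ≡ 0# → Sign x

  sign : ∀ x → Sign x
  sign x with x ≟ 0#
  ... | yes x≡0 = Z x≡0
  ... | no x≢0 with square-or-neg x≢0
  ...   | inj₁ sq  = P sq
  ...   | inj₂ -sq = N -sq

  η-P : ∀ {x} → Square⁺ x → η x ≡ 1#
  η-P {x} sq@(y , _ , y²≡x) with x ≟ 0#
  ... | yes x≡0 = contradiction x≡0 (square-≢0 sq)
  ... | no _ with isSquare? x
  ...   | yes _  = refl
  ...   | no ¬sq = contradiction (y , y²≡x) ¬sq

  neg-square-≢0 : ∀ {x} → Square⁺ (- x) → x ≢ 0#
  neg-square-≢0 -sq x≡0 = square-≢0 -sq (trans (cong -_ x≡0) -0#≈0#)

  η-N : ∀ {x} → Square⁺ (- x) → η x ≡ - 1#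
  η-N {x} -sq with x ≟ 0#
  ... | yes x≡0 = contradiction x≡0 (neg-square-≢0 -sq)
  ... | no x≢0 with isSquare? x
  ...   | no _           = refl
  ...   | yes (y , y²≡x) = contradiction -sq (¬square-neg (y , y≢0 , y²≡x))
    where
    y≢0 : y ≢ 0#
    y≢0 y≡0 = x≢0 (trans (sym y²≡x) (trans (cong (_* y) y≡0) (𝔽.zeroˡ y)))

  -- F is (4/3)x² on nonzero squares and (2/3)x² on non-squares; κ = 2/3 is the common factor.
  κ : Carrier
  κ = two * three ⁻¹

  κ≢0 : κ ≢ 0#
  κ≢0 = *-≢0 2≢0 (λ t≡0 → 0≢1 (trans (sym (𝔽.zeroʳ three)) (trans (cong (three *_) (sym t≡0)) (⁻¹-inverse three 3≢0))))

  F-P : ∀ {x} → Square⁺ x → F₂,⅓ x ≡ κ * (two * (x * x))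
  F-P {x} sq = begin
    x * x * (1# + t * η x)  ≡⟨ cong (λ y → x * x * (1# + t * y)) (η-P sq) ⟩
    x * x * (1# + t * 1#)  ≡⟨ cong (λ y → x * x * (y + t * 1#)) (⁻¹-inverse three 3≢0) ⟨
    x * x * (three * t + t * 1#)  ≡⟨ solve 2 (λ x t → x :* x :* (num 3 :* t :+ t :* num 1) := num 2 :* t :* (num 2 :* (x :* x))) refl x t ⟩
    κ * (two * (x * x))  ∎
    where
    open ≡-Reasoning
    t = three ⁻¹

  F-N : ∀ {x} → Square⁺ (- x) → F₂,⅓ x ≡ κ * (x * x)
  F-N {x} -sq = begin
    x * x * (1# + t * η x)  ≡⟨ cong (λ y → x * x * (1# + t * y)) (η-N -sq) ⟩
    x * x * (1# + t * - 1#)  ≡⟨ cong (λ y → x * x * (y + t * - 1#)) (⁻¹-inverse three 3≢0) ⟨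
    x * x * (three * t + t * - 1#)  ≡⟨ solve 2 (λ x t → x :* x :* (num 3 :* t :+ t :* (:- num 1)) := num 2 :* t :* (x :* x)) refl x t ⟩
    κ * (x * x)  ∎
    where
    open ≡-Reasoning
    t = three ⁻¹

  F-Z : ∀ {x} → x ≡ 0# → F₂,⅓ x ≡ κ * 0#
  F-Z refl = trans (cong (_* (1# + three ⁻¹ * η 0#)) (𝔽.zeroˡ 0#)) (trans (𝔽.zeroˡ _) (sym (𝔽.zeroʳ κ)))

  difference : ∀ {x y X Y} → F₂,⅓ x ≡ κ * X → F₂,⅓ y ≡ κ * Y → F₂,⅓ x - F₂,⅓ y ≡ κ * (X - Y)
  difference {X = X} {Y} ex ey = trans (cong₂ _-_ ex ey) (solve 3 (λ k X Y → k :* X :- k :* Y := k :* (X :- Y)) refl κ X Y)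

  square-scaled : ∀ c {x} → c ≢ 0# → Square⁺ x → Square⁺ (c * c * x)
  square-scaled c c≢0 sq = square-* (c , c≢0 , refl) sq

  square⁺? : ∀ x → Dec (Square⁺ x)
  square⁺? x with sign x
  ... | P sq  = yes sq
  ... | N -sq = no λ sq → ¬square-neg sq -sq
  ... | Z x≡0 = no λ sq → square-≢0 sq x≡0

  ±-roots : ∀ {x y} → x * x ≡ y * y → x ≡ y ⊎ x ≡ - y
  ±-roots {x} {y} e with *-zero⇒ {x - y} {x + y} (trans (solve 2 (λ x y → (x :- y) :* (x :+ y) := x :* x :- y :* y) refl x y)
                                                    (trans (cong (_- y * y) e) (𝔽.-‿inverseʳ _)))
  ... | inj₁ e′ = inj₁ (-‿zero⇒≡ e′)
  ... | inj₂ e′ = inj₂ (-‿zero⇒≡ (trans (cong (x +_) (-‿involutive y)) e′))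

  -- At most four solutions when a is a square

  module UpperBound (a : Carrier) (a-sq : Square⁺ a) (B : Carrier) where
    a≢0 : a ≢ 0#
    a≢0 = square-≢0 a-sq

    -- The right-hand sides after completing the square in the two mixed cases: (x + 2a)² = v and (x
    -- - a)² = w. In the case `PP` one has 4a(x + a) = v and 4ax = -w, so the same two characters
    -- control it.
    v w : Carrier
    v = B + two * (a * a)
    w = two * (a * a) - B

    data Solution (x : Carrier) : Set where
      PP : Square⁺ (x + a) → Square⁺ x → two * ((x + a) * (x + a)) - two * (x * x) ≡ B → Solution x
      NN : Square⁺ (- (x + a)) → Square⁺ (- x) → (x + a) * (x + a) - x * x ≡ B → Solution x
      PN : Square⁺ (x + a) → Square⁺ (- x) → (x + two * a) * (x + two * a) ≡ v → Solution x
      NP : Square⁺ (- (x + a)) → Square⁺ x → (x - a) * (x - a) ≡ w → Solution x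
      Z₀ : x ≡ 0# → w ≡ 0# → Solution x
      Z₁ : x ≡ - a → B ≡ - (a * a) → Solution x

    solution : ∀ x → F₂,⅓ (x + a) - F₂,⅓ x ≡ κ * B → Solution x
    solution x e with sign (x + a) | sign x
    ... | P sq₁ | P sq₂ = PP sq₁ sq₂ (*-cancelˡ κ≢0 (trans (sym (difference (F-P sq₁) (F-P sq₂))) e))
    ... | N sq₁ | N sq₂ = NN sq₁ sq₂ (*-cancelˡ κ≢0 (trans (sym (difference (F-N sq₁) (F-N sq₂))) e))
    ... | P sq₁ | N sq₂ = PN sq₁ sq₂ (trans (solve 2 (λ x a → (x :+ num 2 :* a) :* (x :+ num 2 :* a)
          := (num 2 :* ((x :+ a) :* (x :+ a)) :- x :* x) :+ num 2 :* (a :* a)) refl x a)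
          (cong (_+ two * (a * a)) (*-cancelˡ κ≢0 (trans (sym (difference (F-P sq₁) (F-N sq₂))) e))))
    ... | N sq₁ | P sq₂ = NP sq₁ sq₂ (trans (solve 2 (λ x a → (x :- a) :* (x :- a)
          := num 2 :* (a :* a) :- ((x :+ a) :* (x :+ a) :- num 2 :* (x :* x))) refl x a)
          (cong (λ y → two * (a * a) - y) (*-cancelˡ κ≢0 (trans (sym (difference (F-N sq₁) (F-P sq₂))) e))))
    ... | Z x+a≡0 | _ = Z₁ x≡-a (trans (sym (*-cancelˡ κ≢0 (trans (sym (difference (F-Z x+a≡0) (F-N -sq))) e)))
          (trans (cong (λ y → 0# - y * y) x≡-a) (solve 1 (λ a → num 0 :- (:- a) :* (:- a) := :- (a :* a)) refl a)))
      where
      x≡-a : x ≡ - a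
      x≡-a = -‿zero⇒≡ (trans (cong (x +_) (-‿involutive a)) x+a≡0)
      -sq : Square⁺ (- x)
      -sq = subst Square⁺ (sym (trans (cong -_ x≡-a) (-‿involutive a))) a-sq
    ... | P sq₁ | Z x≡0 = Z₀ x≡0 (trans (cong (λ y → two * (a * a) - y) (sym (*-cancelˡ κ≢0 (trans (sym (difference (F-P sq₁) (F-Z x≡0))) e))))
          (trans (cong (λ y → two * (a * a) - (two * ((y + a) * (y + a)) - 0#)) x≡0)
            (solve 1 (λ a → num 2 :* (a :* a) :- (num 2 :* ((num 0 :+ a) :* (num 0 :+ a)) :- num 0) := num 0) refl a)))
    ... | N sq₁ | Z x≡0 = contradiction (subst (Square⁺ ∘ -_) (trans (cong (_+ a) x≡0) (𝔽.+-identityˡ a)) sq₁) (¬square-neg a-sq)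

    xPP xNN : Carrier
    xPP = (four * a) ⁻¹ * (- w)
    xNN = (two * a) ⁻¹ * (B - a * a)

    solve-linear : ∀ c {x d} → c ≢ 0# → c * x ≡ d → x ≡ c ⁻¹ * d
    solve-linear c {x} {d} c≢0 e = *-cancelˡ c≢0 (trans e (trans (sym (𝔽.*-identityˡ d))
      (trans (cong (_* d) (sym (⁻¹-inverse c c≢0))) (𝔽.*-assoc c (c ⁻¹) d))))

    4-sq : ∀ {y} → Square⁺ y → Square⁺ (four * y)
    4-sq {y} sq = subst Square⁺ (cong (_* y) (solve 0 (num 2 :* num 2 := num 4) refl)) (square-scaled two 2≢0 sq)

    PP-root : ∀ {x} → two * ((x + a) * (x + a)) - two * (x * x) ≡ B → four * a * x ≡ - w
    PP-root {x} refl = solve 2 (λ x a → num 4 :* a :* x := :- (num 2 :* (a :* a) :- (num 2 :* ((x :+ a) :* (x :+ a)) :- num 2 :* (x :* x)))) refl x a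

    PP-x : ∀ {x} → two * ((x + a) * (x + a)) - two * (x * x) ≡ B → x ≡ xPP
    PP-x e = solve-linear (four * a) (*-≢0 4≢0 a≢0) (PP-root e)

    PP-w : ∀ {x} → Square⁺ x → two * ((x + a) * (x + a)) - two * (x * x) ≡ B → Square⁺ (- w)
    PP-w {x} sq e = subst Square⁺ (trans (sym (𝔽.*-assoc four a x)) (PP-root e)) (4-sq (square-* a-sq sq))

    PP-v : ∀ {x} → Square⁺ (x + a) → two * ((x + a) * (x + a)) - two * (x * x) ≡ B → Square⁺ v
    PP-v {x} sq refl = subst Square⁺ (solve 2 (λ x a → num 4 :* (a :* (x :+ a))
      := (num 2 :* ((x :+ a) :* (x :+ a)) :- num 2 :* (x :* x)) :+ num 2 :* (a :* a)) refl x a) (4-sq (square-* a-sq sq))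

    NN-x : ∀ {x} → (x + a) * (x + a) - x * x ≡ B → x ≡ xNN
    NN-x {x} refl = solve-linear (two * a) (*-≢0 2≢0 a≢0)
      (solve 2 (λ x a → num 2 :* a :* x := ((x :+ a) :* (x :+ a) :- x :* x) :- a :* a) refl x a)

    -- From 2a(x + a) = B + a², where -2, a and -(x + a) are all squares.
    NN-B : ∀ {x} → Square⁺ (- (x + a)) → (x + a) * (x + a) - x * x ≡ B → Square⁺ (B + a * a)
    NN-B {x} sq refl = subst Square⁺ (solve 2 (λ x a → (:- num 2) :* (a :* (:- (x :+ a)))
      := ((x :+ a) :* (x :+ a) :- x :* x) :+ a :* a) refl x a) (square-* square[-2] (square-* a-sq sq))

    sum-of-square : ∀ {y z} → y * y ≡ z → z ≢ 0# → Square⁺ z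
    sum-of-square {y} refl z≢0 = y , (λ y≡0 → z≢0 (trans (cong (_* y) y≡0) (𝔽.zeroˡ y))) , refl

    roots : ∀ c z → ∃ λ l → length l ℕ.≤ 2 × (∀ {x} → (x + c) * (x + c) ≡ z → x ∈ l)
    roots c z with isSquare? z
    ... | no ¬sq = [] , z≤n , λ {x} e → contradiction (x + c , e) ¬sq
    ... | yes (s , s²≡z) = s - c ∷ - s - c ∷ [] , ℕₚ.≤-refl , λ {x} e → case x (±-roots (trans e (sym s²≡z)))
      where
      move : ∀ x {y} → x + c ≡ y → x ≡ y - c
      move x refl = solve 2 (λ x c → x := (x :+ c) :- c) refl x c
      case : ∀ x → x + c ≡ s ⊎ x + c ≡ - s → x ∈ s - c ∷ - s - c ∷ []
      case x (inj₁ e) = here (move x e)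
      case x (inj₂ e) = there (here (move x e))

    Cover : Set
    Cover = ∃ λ l → length l ℕ.≤ 4 × (∀ {x} → Solution x → x ∈ l)

    v-if-w≡0 : w ≡ 0# → Square⁺ v
    v-if-w≡0 w≡0 = subst Square⁺ (trans (solve 2 (λ a B → num 4 :* (a :* a) := (B :+ num 2 :* (a :* a)) :+ (num 2 :* (a :* a) :- B)) refl a B)
      (trans (cong (v +_) w≡0) (𝔽.+-identityʳ v))) (4-sq (a , a≢0 , refl))

    v-if-B≡-a² : B ≡ - (a * a) → v ≡ a * a
    v-if-B≡-a² B≡ = trans (cong (_+ two * (a * a)) B≡) (solve 1 (λ a → :- (a :* a) :+ num 2 :* (a :* a) := a :* a) refl a)

    B+a²-if : B ≡ - (a * a) → ¬ Square⁺ (B + a * a)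
    B+a²-if B≡ sq = square-≢0 sq (trans (cong (_+ a * a) B≡) (𝔽.-‿inverseˡ (a * a)))

    NP-list : ∃ λ l → length l ℕ.≤ 2 × (∀ {x} → (x - a) * (x - a) ≡ w → x ∈ l)
    NP-list = roots (- a) w

    PN-list : ∃ λ l → length l ℕ.≤ 2 × (∀ {x} → (x + two * a) * (x + two * a) ≡ v → x ∈ l)
    PN-list = roots (two * a) v

    length-++-≤ : ∀ {j k} (l l′ : List Carrier) → length l ℕ.≤ j → length l′ ℕ.≤ k → length (l ++ l′) ℕ.≤ j ℕ.+ k
    length-++-≤ l l′ b b′ = ℕₚ.≤-trans (ℕₚ.≤-reflexive (length-++ l)) (ℕₚ.+-mono-≤ b b′)

    cover-v-N : Square⁺ (- v) → Cover
    cover-v-N -v with NP-list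
    ... | l , l≤ , np = l ++ xNN ∷ [] , ℕₚ.≤-trans (length-++-≤ l (xNN ∷ []) l≤ ℕₚ.≤-refl) (ℕₚ.m≤m+n 3 1) , λ
      { (PP sq _ e) → contradiction -v (¬square-neg (PP-v sq e))
      ; (NN _ _ e)  → ∈-++⁺ʳ l (here (NN-x e))
      ; (PN _ _ e)  → contradiction -v (¬square-neg (sum-of-square e (neg-square-≢0 -v)))
      ; (NP _ _ e)  → ∈-++⁺ˡ (np e)
      ; (Z₀ _ w≡0)  → contradiction -v (¬square-neg (v-if-w≡0 w≡0))
      ; (Z₁ _ B≡)   → contradiction -v (¬square-neg (subst Square⁺ (sym (v-if-B≡-a² B≡)) (a , a≢0 , refl))) }

    cover-v-Z : v ≡ 0# → Cover
    cover-v-Z v≡0 with NP-list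
    ... | l , l≤ , np = l ++ xNN ∷ - (two * a) ∷ [] , length-++-≤ l (xNN ∷ - (two * a) ∷ []) l≤ ℕₚ.≤-refl , λ
      { (PP sq _ e)     → contradiction v≡0 (square-≢0 (PP-v sq e))
      ; (NN _ _ e)      → ∈-++⁺ʳ l (here (NN-x e))
      ; {x} (PN _ _ e)  → ∈-++⁺ʳ l (there (here (double-root (trans e v≡0))))
      ; (NP _ _ e)      → ∈-++⁺ˡ (np e)
      ; (Z₀ _ w≡0)      → contradiction v≡0 (square-≢0 (v-if-w≡0 w≡0))
      ; (Z₁ _ B≡)       → contradiction (trans (sym (v-if-B≡-a² B≡)) v≡0) (*-≢0 a≢0 a≢0) }
      where
      double-root : ∀ {x} → (x + two * a) * (x + two * a) ≡ 0# → x ≡ - (two * a)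
      double-root {x} e with *-zero⇒ e
      ... | inj₁ e′ = -‿zero⇒≡ (trans (cong (x +_) (-‿involutive _)) e′)
      ... | inj₂ e′ = -‿zero⇒≡ (trans (cong (x +_) (-‿involutive _)) e′)

    -- Case `NP` is impossible, which leaves two roots from `PN` and one from `PP`. The split on B
    -- is needed for the last place: `Z₁` requires B + a² = 0, whereas `NN` requires it to be a
    -- nonzero square.
    cover-w-N : Square⁺ (- w) → Cover
    cover-w-N -w with PN-list | B ≟ (- (a * a))
    ... | l , l≤ , pn | yes B≡ = l ++ xPP ∷ - a ∷ [] , length-++-≤ l (xPP ∷ - a ∷ []) l≤ ℕₚ.≤-refl , λ
      { (PP _ _ e)  → ∈-++⁺ʳ l (here (PP-x e))
      ; (NN sq _ e) → contradiction (NN-B sq e) (B+a²-if B≡)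
      ; (PN _ _ e)  → ∈-++⁺ˡ (pn e)
      ; (NP _ _ e)  → contradiction -w (¬square-neg (sum-of-square e (neg-square-≢0 -w)))
      ; (Z₀ _ w≡0)  → contradiction w≡0 (neg-square-≢0 -w)
      ; (Z₁ x≡ _)   → ∈-++⁺ʳ l (there (here x≡)) }
    ... | l , l≤ , pn | no B≢ = l ++ xPP ∷ xNN ∷ [] , length-++-≤ l (xPP ∷ xNN ∷ []) l≤ ℕₚ.≤-refl , λ
      { (PP _ _ e)  → ∈-++⁺ʳ l (here (PP-x e))
      ; (NN _ _ e)  → ∈-++⁺ʳ l (there (here (NN-x e)))
      ; (PN _ _ e)  → ∈-++⁺ˡ (pn e)
      ; (NP _ _ e)  → contradiction -w (¬square-neg (sum-of-square e (neg-square-≢0 -w)))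
      ; (Z₀ _ w≡0)  → contradiction w≡0 (neg-square-≢0 -w)
      ; (Z₁ _ B≡)   → contradiction B≡ B≢ }

    -- w = 0 means v = 4a², so the `PN` equation has roots 0 and -4a, and 0 is not a non-square; it
    -- reappears once, as `Z₀`.
    cover-w-Z : w ≡ 0# → Cover
    cover-w-Z w≡0 = a ∷ - (four * a) ∷ xNN ∷ 0# ∷ [] , ℕₚ.≤-refl , λ
      { (PP _ sq e)  → contradiction w≡0 (neg-square-≢0 (PP-w sq e))
      ; (NN _ _ e)   → there (there (here (NN-x e)))
      ; (PN _ sq e)  → there (here (other-root sq (trans e v≡)))
      ; (NP _ _ e)   → here (double-root (trans e w≡0))
      ; (Z₀ x≡0 _)   → there (there (there (here x≡0)))
      ; (Z₁ _ B≡)    → contradiction (trans (solve 1 (λ a → num 3 :* (a :* a) := num 2 :* (a :* a) :- (:- (a :* a))) refl a)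
                         (trans (cong (λ y → two * (a * a) - y) (sym B≡)) w≡0)) (*-≢0 3≢0 (*-≢0 a≢0 a≢0)) }
      where
      v≡ : v ≡ (two * a) * (two * a)
      v≡ = trans (sym (𝔽.+-identityʳ v)) (trans (cong (v +_) (sym w≡0))
        (solve 2 (λ a B → (B :+ num 2 :* (a :* a)) :+ (num 2 :* (a :* a) :- B) := (num 2 :* a) :* (num 2 :* a)) refl a B))
      other-root : ∀ {x} → Square⁺ (- x) → (x + two * a) * (x + two * a) ≡ (two * a) * (two * a) → x ≡ - (four * a)
      other-root {x} sq e with ±-roots e
      ... | inj₁ e′ = contradiction (trans (solve 2 (λ x c → x := (x :+ c) :- c) refl x (two * a)) (trans (cong (_- two * a) e′) (𝔽.-‿inverseʳ _))) (neg-square-≢0 sq)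
      ... | inj₂ e′ = trans (solve 2 (λ x c → x := (x :+ c) :- c) refl x (two * a)) (trans (cong (_- two * a) e′)
                        (solve 1 (λ a → :- (num 2 :* a) :- num 2 :* a := :- (num 4 :* a)) refl a))
      double-root : ∀ {x} → (x - a) * (x - a) ≡ 0# → x ≡ a
      double-root e with *-zero⇒ e
      ... | inj₁ e′ = -‿zero⇒≡ e′
      ... | inj₂ e′ = -‿zero⇒≡ e′

    -- The case with five candidates: two from `NP`, two from `PN` and one from `NN`. If the `NN`
    -- root occurs, B + a² is a square and one `PN` root drops out. If B = -a², the `PN` root -a is
    -- not of that type and counts only as `Z₁`.
    cover-w-P : Square⁺ v → Square⁺ w → Cover
    cover-w-P (s , _ , s²≡v) w-sq with NP-list | B ≟ (- (a * a))
    ... | l , l≤ , np | yes B≡ = l ++ - (three * a) ∷ - a ∷ [] , length-++-≤ l (- (three * a) ∷ - a ∷ []) l≤ ℕₚ.≤-refl , λ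
      { (PP _ sq e)  → contradiction (PP-w sq e) (¬square-neg w-sq)
      ; (NN sq _ e)  → contradiction (NN-B sq e) (B+a²-if B≡)
      ; (PN sq _ e)  → ∈-++⁺ʳ l (here (other-root sq (trans e (v-if-B≡-a² B≡))))
      ; (NP _ _ e)   → ∈-++⁺ˡ (np e)
      ; (Z₀ _ w≡0)   → contradiction w≡0 (square-≢0 w-sq)
      ; (Z₁ x≡ _)    → ∈-++⁺ʳ l (there (here x≡)) }
      where
      other-root : ∀ {x} → Square⁺ (x + a) → (x + two * a) * (x + two * a) ≡ a * a → x ≡ - (three * a)
      other-root {x} sq e with ±-roots e
      ... | inj₁ e′ = contradiction (trans (solve 2 (λ x a → x :+ a := (x :+ num 2 :* a) :- a) refl x a) (trans (cong (_- a) e′) (𝔽.-‿inverseʳ a))) (square-≢0 sq)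
      ... | inj₂ e′ = trans (solve 2 (λ x a → x := (x :+ num 2 :* a) :- num 2 :* a) refl x a) (trans (cong (_- two * a) e′)
                        (solve 1 (λ a → :- a :- num 2 :* a := :- (num 3 :* a)) refl a))
    ... | l , l≤ , np | no B≢ with square⁺? (B + a * a)
    ...   | no ¬sq = let l′ , l′≤ , pn = PN-list in l ++ l′ , length-++-≤ l l′ l≤ l′≤ , λ
      { (PP _ sq e)  → contradiction (PP-w sq e) (¬square-neg w-sq)
      ; (NN sq _ e)  → contradiction (NN-B sq e) ¬sq
      ; (PN _ _ e)   → ∈-++⁺ʳ l (pn e)
      ; (NP _ _ e)   → ∈-++⁺ˡ (np e)
      ; (Z₀ _ w≡0)   → contradiction w≡0 (square-≢0 w-sq)
      ; (Z₁ _ B≡)    → contradiction B≡ B≢ }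
    ...   | yes B+a²-sq = l ++ y ∷ xNN ∷ [] , length-++-≤ l (y ∷ xNN ∷ []) l≤ ℕₚ.≤-refl , λ
      { (PP _ sq e)  → contradiction (PP-w sq e) (¬square-neg w-sq)
      ; (NN _ _ e)   → ∈-++⁺ʳ l (there (here (NN-x e)))
      ; (PN sq _ e)  → ∈-++⁺ʳ l (here (proj₂ chosen sq e))
      ; (NP _ _ e)   → ∈-++⁺ˡ (np e)
      ; (Z₀ _ w≡0)   → contradiction w≡0 (square-≢0 w-sq)
      ; (Z₁ _ B≡)    → contradiction B≡ B≢ }
      where
      move : ∀ x {y} → x + two * a ≡ y → x ≡ y - two * a
      move x refl = solve 2 (λ x c → x := (x :+ c) :- c) refl x (two * a)
      shift : ∀ x {y} → x + two * a ≡ y → x + a ≡ y - a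
      shift x refl = solve 2 (λ x a → x :+ a := (x :+ num 2 :* a) :- a) refl x a
      -- (s - a)(-s - a) = -(B + a²) is not a square, so s - a and -s - a are not both squares.
      not-both : Square⁺ (s - a) → ¬ Square⁺ (- s - a)
      not-both sq₁ sq₂ = ¬square-neg B+a²-sq (subst Square⁺ (trans (solve 2 (λ s a → (s :- a) :* (:- s :- a) := a :* a :- s :* s) refl s a)
        (trans (cong (λ y → a * a - y) s²≡v) (solve 2 (λ a B → a :* a :- (B :+ num 2 :* (a :* a)) := :- (B :+ a :* a)) refl a B))) (square-* sq₁ sq₂))
      chosen : ∃ λ y → ∀ {x} → Square⁺ (x + a) → (x + two * a) * (x + two * a) ≡ v → x ≡ y
      chosen with square⁺? (s - a)
      ... | yes sq₁ = s - two * a , λ {x} sq e → first x sq (±-roots (trans e (sym s²≡v)))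
        where
        first : ∀ x → Square⁺ (x + a) → x + two * a ≡ s ⊎ x + two * a ≡ - s → x ≡ s - two * a
        first x sq (inj₁ e) = move x e
        first x sq (inj₂ e) = contradiction (subst Square⁺ (shift x e) sq) (not-both sq₁)
      ... | no ¬sq₁ = - s - two * a , λ {x} sq e → second x sq (±-roots (trans e (sym s²≡v)))
        where
        second : ∀ x → Square⁺ (x + a) → x + two * a ≡ s ⊎ x + two * a ≡ - s → x ≡ - s - two * a
        second x sq (inj₁ e) = contradiction (subst Square⁺ (shift x e) sq) ¬sq₁
        second x sq (inj₂ e) = move x e
      y = proj₁ chosen

    cover : Cover
    cover with sign v
    ... | N -v  = cover-v-N -v
    ... | Z v≡0 = cover-v-Z v≡0
    ... | P v-sq with sign w
    ...   | N -w   = cover-w-N -w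
    ...   | Z w≡0  = cover-w-Z w≡0
    ...   | P w-sq = cover-w-P v-sq w-sq

  solutions : Carrier → Carrier → List Carrier
  solutions a b = filter (λ x → (F₂,⅓ (x + a) - F₂,⅓ x) ≟ b) elements

  ∈-solutions⁺ : ∀ {a b x} → F₂,⅓ (x + a) - F₂,⅓ x ≡ b → x ∈ solutions a b
  ∈-solutions⁺ {a} {b} {x} e = ∈-filter⁺ (λ x → (F₂,⅓ (x + a) - F₂,⅓ x) ≟ b) (elements-complete x) e

  ∈-solutions⁻ : ∀ {a b x} → x ∈ solutions a b → F₂,⅓ (x + a) - F₂,⅓ x ≡ b
  ∈-solutions⁻ {a} {b} x∈ = proj₂ (∈-filter⁻ (λ x → (F₂,⅓ (x + a) - F₂,⅓ x) ≟ b) {xs = elements} x∈)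

  covered⇒δ≤4 : ∀ a b l → length l ℕ.≤ 4 → (∀ {x} → F₂,⅓ (x + a) - F₂,⅓ x ≡ b → x ∈ l) → δ F₂,⅓ a b ℕ.≤ 4
  covered⇒δ≤4 a b l l≤4 covers = ℕₚ.≤-trans
    (unique-⊆-length (Unique.filter⁺ (λ x → (F₂,⅓ (x + a) - F₂,⅓ x) ≟ b) elements-unique) (covers ∘ ∈-solutions⁻)) l≤4

  square-cover : ∀ a b → Square⁺ a → ∃ λ l → length l ℕ.≤ 4 × (∀ {x} → F₂,⅓ (x + a) - F₂,⅓ x ≡ b → x ∈ l)
  square-cover a b a-sq with UpperBound.cover a a-sq (κ ⁻¹ * b)
  ... | l , l≤4 , covers = l , l≤4 , λ {x} e → covers (UpperBound.solution a a-sq (κ ⁻¹ * b) x (trans e b≡))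
    where
    b≡ : b ≡ κ * (κ ⁻¹ * b)
    b≡ = trans (sym (𝔽.*-identityˡ b)) (trans (cong (_* b) (sym (⁻¹-inverse κ κ≢0))) (𝔽.*-assoc κ (κ ⁻¹) b))

  δ≤4 : ∀ a b → a ≢ 0# → δ F₂,⅓ a b ℕ.≤ 4
  δ≤4 a b a≢0 with square-or-neg a≢0
  ... | inj₁ a-sq = let l , l≤4 , covers = square-cover a b a-sq in covered⇒δ≤4 a b l l≤4 covers
  -- x solves the equation for (a , b) iff x + a solves it for (-a , -b).
  ... | inj₂ -a-sq = let l , l≤4 , covers = square-cover (- a) (- b) -a-sq in
    covered⇒δ≤4 a b (map (_- a) l) (ℕₚ.≤-trans (ℕₚ.≤-reflexive (length-map (_- a) l)) l≤4)
      (λ {x} e → subst (_∈ map (_- a) l) (solve 2 (λ x a → (x :+ a) :- a := x) refl x a) (∈-map⁺ (_- a) (covers (reverse x e))))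
    where
    reverse : ∀ x → F₂,⅓ (x + a) - F₂,⅓ x ≡ b → F₂,⅓ (x + a + - a) - F₂,⅓ (x + a) ≡ - b
    reverse x refl = trans (cong (λ y → F₂,⅓ y - F₂,⅓ (x + a)) (solve 2 (λ x a → (x :+ a) :- a := x) refl x a))
      (solve 2 (λ y z → z :- y := :- (y :- z)) refl (F₂,⅓ (x + a)) (F₂,⅓ x))

  -- A difference equation with four solutions

  module LowerBound (u : Carrier) (u≢0 : u ≢ 0#) (sq₁ : Square⁺ (1# + u * u)) (sq₂ : Square⁺ (1# - three * (u * u)))
                    (sq₃ : Square⁺ (u * u + four * u + 1#)) (sq₄ : Square⁺ (u * u - four * u + 1#)) where

    -- For a = 1 the solutions are -2 ± s, 1 ± t and (s² - 3)/2 with s² + t² = 4; they are written here in terms of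
    -- s = 2(1 - u²)/(1 + u²), t = 4u/(1 + u²) and multiplied by a = 4(1 + u²)².
    E a x₁ x₂ x₃ x₄ x₅ B : Carrier
    E  = 1# + u * u
    a  = four * (E * E)
    x₁ = - ((four * u) * (four * u) * E)
    x₂ = - (four * four * E)
    x₃ = two * two * (E * (u * u + four * u + 1#))
    x₄ = two * two * (E * (u * u - four * u + 1#))
    x₅ = two * ((u * u + four * u + 1#) * (u * u - four * u + 1#))
    B  = two * ((x₁ + a) * (x₁ + a)) - x₁ * x₁

    2-not-square : ¬ Square⁺ two
    2-not-square sq = ¬square-neg sq square[-2]

    -- u = -1 would make the square 1 + u² equal to the non-square 2. This keeps x₃ + a away from
    -- zero and x₁ apart from x₂.
    1+u≢0 : 1# + u ≢ 0#
    1+u≢0 e = 2-not-square (subst Square⁺ (trans (cong (λ y → 1# + y * y) u≡-1) (solve 0 (num 1 :+ (:- num 1) :* (:- num 1) := num 2) refl)) sq₁)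
      where
      u≡-1 : u ≡ - 1#
      u≡-1 = -‿zero⇒≡ (trans (solve 1 (λ u → u :- (:- num 1) := num 1 :+ u) refl u) e)

    1-u≢0 : 1# - u ≢ 0#
    1-u≢0 e = 2-not-square (subst Square⁺ (trans (cong (λ y → 1# + y * y) (sym (-‿zero⇒≡ e))) (solve 0 (num 1 :+ num 1 :* num 1 := num 2) refl)) sq₁)

    E≢0 : E ≢ 0#
    E≢0 = square-≢0 sq₁

    a≢0 : a ≢ 0#
    a≢0 = *-≢0 4≢0 (*-≢0 E≢0 E≢0)

    solution-PN : ∀ {x} → Square⁺ (x + a) → Square⁺ (- x) → two * ((x + a) * (x + a)) - x * x ≡ B → x ∈ solutions a (κ * B)
    solution-PN sq sq′ e = ∈-solutions⁺ (trans (difference (F-P sq) (F-N sq′)) (cong (κ *_) e))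

    solution-ZN : ∀ {x} → x + a ≡ 0# → Square⁺ (- x) → two * ((x + a) * (x + a)) - x * x ≡ B → x ∈ solutions a (κ * B)
    solution-ZN {x} z sq′ e = ∈-solutions⁺ (trans (difference (F-Z z) (F-N sq′)) (cong (κ *_) (trans
      (cong (_- x * x) (sym (trans (cong (λ y → two * (y * y)) z) (solve 0 (num 2 :* (num 0 :* num 0) := num 0) refl)))) e)))

    solution-NP : ∀ {x} → Square⁺ (- (x + a)) → Square⁺ x → (x + a) * (x + a) - two * (x * x) ≡ B → x ∈ solutions a (κ * B)
    solution-NP sq sq′ e = ∈-solutions⁺ (trans (difference (F-N sq) (F-P sq′)) (cong (κ *_) e))

    solution-NN : ∀ {x} → Square⁺ (- (x + a)) → Square⁺ (- x) → (x + a) * (x + a) - x * x ≡ B → x ∈ solutions a (κ * B)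
    solution-NN sq sq′ e = ∈-solutions⁺ (trans (difference (F-N sq) (F-N sq′)) (cong (κ *_) e))

    private
      :E :a :x₁ :x₂ :x₃ :x₄ :x₅ :B :g₃ :g₄ : Polynomial 1 → Polynomial 1
      :E u = num 1 :+ u :* u
      :a u = num 4 :* (:E u :* :E u)
      :g₃ u = u :* u :+ num 4 :* u :+ num 1
      :g₄ u = u :* u :- num 4 :* u :+ num 1
      :x₁ u = :- ((num 4 :* u) :* (num 4 :* u) :* :E u)
      :x₂ u = :- (num 4 :* num 4 :* :E u)
      :x₃ u = num 2 :* num 2 :* (:E u :* :g₃ u)
      :x₄ u = num 2 :* num 2 :* (:E u :* :g₄ u)
      :x₅ u = num 2 :* (:g₃ u :* :g₄ u)
      :B u = num 2 :* ((:x₁ u :+ :a u) :* (:x₁ u :+ :a u)) :- :x₁ u :* :x₁ u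

    -x₁-sq : Square⁺ (- x₁)
    -x₁-sq = subst Square⁺ (sym (-‿involutive _)) (square-scaled (four * u) (*-≢0 4≢0 u≢0) sq₁)

    x₁+a-sq : Square⁺ (x₁ + a)
    x₁+a-sq = subst Square⁺ (solve 1 (λ u → num 2 :* num 2 :* (:E u :* (num 1 :- num 3 :* (u :* u))) := :x₁ u :+ :a u) refl u)
      (square-scaled two 2≢0 (square-* sq₁ sq₂))

    -x₂-sq : Square⁺ (- x₂)
    -x₂-sq = subst Square⁺ (sym (-‿involutive _)) (square-scaled four 4≢0 sq₁)

    x₂+a≡ : x₂ + a ≡ two * two * (E * (u * u - three))
    x₂+a≡ = solve 1 (λ u → :x₂ u :+ :a u := num 2 :* num 2 :* (:E u :* (u :* u :- num 3))) refl u

    x₃-sq : Square⁺ x₃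
    x₃-sq = square-scaled two 2≢0 (square-* sq₁ sq₃)

    x₄-sq : Square⁺ x₄
    x₄-sq = square-scaled two 2≢0 (square-* sq₁ sq₄)

    -[x₃+a]-sq : Square⁺ (- (x₃ + a))
    -[x₃+a]-sq = subst Square⁺ (solve 1 (λ u → (num 2 :* (num 1 :+ u)) :* (num 2 :* (num 1 :+ u)) :* ((:- num 2) :* :E u) := :- (:x₃ u :+ :a u)) refl u)
      (square-scaled (two * (1# + u)) (*-≢0 2≢0 1+u≢0) (square-* square[-2] sq₁))

    -[x₄+a]-sq : Square⁺ (- (x₄ + a))
    -[x₄+a]-sq = subst Square⁺ (solve 1 (λ u → (num 2 :* (num 1 :- u)) :* (num 2 :* (num 1 :- u)) :* ((:- num 2) :* :E u) := :- (:x₄ u :+ :a u)) refl u)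
      (square-scaled (two * (1# - u)) (*-≢0 2≢0 1-u≢0) (square-* square[-2] sq₁))

    -x₅-sq : Square⁺ (- x₅)
    -x₅-sq = subst Square⁺ (solve 1 (λ u → (:- num 2) :* (:g₃ u :* :g₄ u) := :- :x₅ u) refl u) (square-* square[-2] (square-* sq₃ sq₄))

    x₁∈ : x₁ ∈ solutions a (κ * B)
    x₁∈ = solution-PN x₁+a-sq -x₁-sq refl

    x₃∈ : x₃ ∈ solutions a (κ * B)
    x₃∈ = solution-NP -[x₃+a]-sq x₃-sq (solve 1 (λ u → (:x₃ u :+ :a u) :* (:x₃ u :+ :a u) :- num 2 :* (:x₃ u :* :x₃ u) := :B u) refl u)

    x₄∈ : x₄ ∈ solutions a (κ * B)
    x₄∈ = solution-NP -[x₄+a]-sq x₄-sq (solve 1 (λ u → (:x₄ u :+ :a u) :* (:x₄ u :+ :a u) :- num 2 :* (:x₄ u :* :x₄ u) := :B u) refl u)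

    P≢N : ∀ {x y} → Square⁺ x → Square⁺ (- y) → x ≢ y
    P≢N sq -sq refl = ¬square-neg sq -sq

    x₃≢x₄ : x₃ ≢ x₄
    x₃≢x₄ e = *-≢0 2≢0 (*-≢0 (*-≢0 4≢0 4≢0) (*-≢0 E≢0 u≢0))
      (trans (solve 1 (λ u → num 2 :* (num 4 :* num 4 :* (:E u :* u)) := :x₃ u :- :x₄ u) refl u) (trans (cong (_- x₄) e) (𝔽.-‿inverseʳ x₄)))

    x₁≢x₂ : x₁ ≢ x₂
    x₁≢x₂ e = *-≢0 (*-≢0 4≢0 4≢0) (*-≢0 E≢0 (*-≢0 1+u≢0 1-u≢0))
      (trans (solve 1 (λ u → num 4 :* num 4 :* (:E u :* ((num 1 :+ u) :* (num 1 :- u))) := :x₁ u :- :x₂ u) refl u)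
        (trans (cong (_- x₂) e) (𝔽.-‿inverseʳ x₂)))

    x₂-value : two * ((x₂ + a) * (x₂ + a)) - x₂ * x₂ ≡ B
    x₂-value = solve 1 (λ u → num 2 :* ((:x₂ u :+ :a u) :* (:x₂ u :+ :a u)) :- :x₂ u :* :x₂ u := :B u) refl u

    -- Admissibility leaves the character of u² - 3 open. If it is a square or zero, x₂ is a
    -- solution, since x₂ + a = 4E(u² - 3); otherwise -(x₅ + a) = -2(1 - 3u²)(3 - u²) is a square
    -- and x₅ takes its place.
    fourth : ∃ λ y → y ∈ solutions a (κ * B) × x₁ ≢ y × Square⁺ (- y)
    fourth with sign (u * u - three)
    ... | P sq = x₂ , solution-PN (subst Square⁺ (sym x₂+a≡) (square-scaled two 2≢0 (square-* sq₁ sq))) -x₂-sq x₂-value , x₁≢x₂ , -x₂-sq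
    ... | Z z = x₂ , solution-ZN (trans x₂+a≡ (trans (cong (λ y → two * two * (E * y)) z)
                  (solve 1 (λ E → num 2 :* num 2 :* (E :* num 0) := num 0) refl E))) -x₂-sq x₂-value , x₁≢x₂ , -x₂-sq
    ... | N -sq = x₅ , solution-NN -[x₅+a]-sq -x₅-sq (solve 1 (λ u → (:x₅ u :+ :a u) :* (:x₅ u :+ :a u) :- :x₅ u :* :x₅ u := :B u) refl u) ,
                  (λ e → P≢N x₁+a-sq -[x₅+a]-sq (cong (_+ a) e)) , -x₅-sq
      where
      -[x₅+a]-sq : Square⁺ (- (x₅ + a))
      -[x₅+a]-sq = subst Square⁺ (solve 1 (λ u → (:- num 2) :* ((num 1 :- num 3 :* (u :* u)) :* (:- (u :* u :- num 3))) := :- (:x₅ u :+ :a u)) refl u)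
        (square-* square[-2] (square-* sq₂ -sq))

    δ≡4 : δ F₂,⅓ a (κ * B) ≡ 4
    δ≡4 with fourth
    ... | y , y∈ , x₁≢y , -y-sq = ℕₚ.≤-antisym (δ≤4 a (κ * B) a≢0) (unique-⊆-length distinct ⊆solutions)
      where
      distinct : Unique (x₁ ∷ y ∷ x₃ ∷ x₄ ∷ [])
      distinct = (x₁≢y ∷ P≢N x₃-sq -x₁-sq ∘ sym ∷ P≢N x₄-sq -x₁-sq ∘ sym ∷ [])
               ∷ (P≢N x₃-sq -y-sq ∘ sym ∷ P≢N x₄-sq -y-sq ∘ sym ∷ []) ∷ (x₃≢x₄ ∷ []) ∷ [] ∷ []
      ⊆solutions : ∀ {x} → x ∈ x₁ ∷ y ∷ x₃ ∷ x₄ ∷ [] → x ∈ solutions a (κ * B)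
      ⊆solutions (here refl)                         = x₁∈
      ⊆solutions (there (here refl))                 = y∈
      ⊆solutions (there (there (here refl)))         = x₃∈
      ⊆solutions (there (there (there (here refl)))) = x₄∈

  uniformity : ∃ Admissible → DiffUniformity≡ F₂,⅓ 4
  uniformity (u , u≢0 , sq₁ , sq₂ , sq₃ , sq₄) = δ≤4 , a , κ * B , a≢0 , δ≡4
    where open LowerBound u u≢0 sq₁ sq₂ sq₃ sq₄

open import Data.Nat using (ℕ; _^_; _%_; _>_)

theorem6 : (p n q : ℕ) → Prime p → p ≢ 2 → p ≢ 3 → q ≡ p ^ n →
    q % 8 ≡ 3 → q > 43 → (K : FiniteField q) →
    FiniteField.DiffUniformity≡ K (FiniteField.F₂,⅓ K) 4
theorem6 p n q p-prime _ p≢3 q≡pⁿ q%8≡3 q>43 K =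
  Uniformity.uniformity K {p} {n} p-prime q≡pⁿ (q / 8) (≡3-mod-8⇒ q q%8≡3) (three≢0 {p} {n} p-prime p≢3 q≡pⁿ)
    (exists-admissible {p} {n} p-prime p≢3 q≡pⁿ q%8≡3 q>43)
  where open Existence K
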